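{- Let $n\geq 1$ and let $T$ be a tree with $n$ vertices. For every partition $\lambda\vdash n$ let $c_\lambda(T)$ be the coefficient of the power-sum symmetric function $p_\lambda$ in the chromatic symmetric function ${\mathbf X}_T$. Then $$ {\mathbf K}_T(x,y) ~=~ \sum_{a>0} \sum_{b\geq 0} x^a y^b \sum_{\lambda\vdash n} \psi(\lambda,a,b)\, c_\lambda(T) $$ and $$ {\mathbf S}_T(q,r) ~=~ \sum_{i=1}^{n-1} \sum_{j=1}^i q^i r^j \sum_{\lambda\vdash n} \phi(\lambda,i,j)\, c_\lambda(T), $$ where for a partition $\lambda=(\lambda_1\geq\cdots\geq\lambda_\ell)\vdash n$ and integers $a,b,i,j$, $$\psi(\lambda,a,b) = (-1)^{a+b} \binom{\ell-1}{\ell-n+a+b} \sum_{k=1}^{\ell} \binom{\lambda_k-1}{a},$$ $$\phi(\lambda,i,j) = (-1)^{i+j} \binom{\ell-1}{\ell-n+i} \sum_{d=1}^j (-1)^d \binom{i-d}{j-d} \sum_{k=1}^\ell \binom{\lambda_k-1}{d}.$$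
   Context: All graphs are finite and simple. For a graph $G$, a proper coloring is a map $\kappa:V(G)\to\{1,2,3,\dots\}$ with $\kappa(v)\neq\kappa(w)$ whenever $v,w$ are adjacent; the chromatic symmetric function is ${\mathbf X}_G=\sum_\kappa\prod_{v\in V(G)}x_{\kappa(v)}$ (sum over all proper colorings, in commuting indeterminates $x_1,x_2,\dots$), a homogeneous symmetric function of degree $n=\#V(G)$. Here $p_k=\sum_i x_i^k$ and $p_\lambda=\prod_k p_{\lambda_k}$; the $p_\lambda$, $\lambda\vdash n$, form a basis of degree-$n$ symmetric functions over $\mathbb Q$, and $\ell$ denotes the length (number of parts) of $\lambda$. Binomial coefficients $\binom{m}{k}$ are zero when $k<0$ or $k>m$ (for $m\ge 0$). For a tree $T$, identify subtrees with their edge sets. The subtree polynomial is ${\mathbf S}_T(q,r)=\sum_S q^{\#S} r^{\#L(S)}$, summed over all subtrees $S$ of $T$ with at least one edge, where $\#S$ is the number of edges of $S$ and $L(S)$ is the set of leaf edges of $S$ (edges incident to a vertex of degree 1 in $S$). For a nonempty $A\subseteq E(T)$, the connector $K(A)$ is the unique minimal subset of $E(T)\setminus A$ such that $A\cup K(A)$ is (the edge set of) a tree. The connector polynomial is ${\mathbf K}_T(x,y)=\sum_{\emptyset\neq A\subseteq E(T)} x^{\#A}y^{\#K(A)}$. -}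

module Defs where

open import Data.Bool using (Bool; true; false; if_then_else_; _∧_; _∨_; not; T)
open import Data.Nat as ℕ using (ℕ; zero; suc; _∸_; _≤ᵇ_; _≡ᵇ_; _<ᵇ_)
open import Data.Nat.Combinatorics using (_C_)
open import Data.Fin as Fin using (Fin; toℕ)
open import Data.Vec as Vec using (Vec; lookup)
open import Data.List using (List; []; _∷_; _++_; [_]; map; concatMap; upTo; allFin; length; foldr; filterᵇ)
open import Data.List.Membership.Propositional using (_∈_)
open import Data.List.Relation.Unary.All using (All)
open import Data.List.Relation.Unary.Unique.Propositional using (Unique)
open import Data.Product using (Σ; _×_; _,_; proj₁; proj₂)
open import Data.Sum using (_⊎_)
open import Data.Integer using (+_)
open import Data.Rational as ℚ using (ℚ; 0ℚ; 1ℚ; _+_; _*_; _/_)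
open import Relation.Nullary using (¬_; does)
open import Relation.Binary.PropositionalEquality using (_≡_; _≢_)

allᵇ : {A : Set} → (A → Bool) → List A → Bool
allᵇ p = foldr (λ x b → p x ∧ b) true

sumℚ : List ℚ → ℚ
sumℚ = foldr _+_ 0ℚ

prodℚ : List ℚ → ℚ
prodℚ = foldr _*_ 1ℚ

ℕ→ℚ : ℕ → ℚ
ℕ→ℚ k = + k / 1

neg1^ : ℕ → ℚ
neg1^ zero    = 1ℚ
neg1^ (suc m) = ℚ.- (neg1^ m)

_^ℚ_ : ℚ → ℕ → ℚ
x ^ℚ zero  = 1ℚ
x ^ℚ suc m = x * (x ^ℚ m)

data Count {A : Set} (P : A → Set) : List A → ℕ → Set where
  nil  : Count P [] 0
  here : ∀ {x xs k} → P x → Count P xs k → Count P (x ∷ xs) (suc k)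
  skip : ∀ {x xs k} → ¬ P x → Count P xs k → Count P (x ∷ xs) k

CountIs : {A : Set} → (A → Set) → List A → ℚ → Set
CountIs P L r = Σ ℕ λ k → Count P L k × ℕ→ℚ k ≡ r

-- all sublists (= all subsets, when the list has no duplicates)
subs : {A : Set} → List A → List (List A)
subs []       = [] ∷ []
subs (x ∷ xs) = subs xs ++ map (x ∷_) (subs xs)

-- Graphs on the vertex set Fin n, given by a list of edges (u , v), u < v

Edge : ℕ → Set
Edge n = Fin n × Fin n

SimpleEdges : ∀ {n} → List (Edge n) → Set
SimpleEdges E = All (λ e → toℕ (proj₁ e) ℕ.< toℕ (proj₂ e)) E × Unique E

Adj : ∀ {n} → List (Edge n) → Fin n → Fin n → Set
Adj E u v = (u , v) ∈ E ⊎ (v , u) ∈ E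

data Walk {n} (E : List (Edge n)) : Fin n → Fin n → Set where
  stop : ∀ {u} → Walk E u u
  step : ∀ {u w v} → Adj E u w → Walk E w v → Walk E u v

Chain : ∀ {n} → List (Edge n) → List (Fin n) → Set
Chain E []            = Data.Unit.⊤ where import Data.Unit
Chain E (v ∷ [])      = Data.Unit.⊤ where import Data.Unit
Chain E (v ∷ w ∷ vs) = Adj E v w × Chain E (w ∷ vs)

Cycle : ∀ {n} → List (Edge n) → Set
Cycle {n} E = Σ (Fin n) λ v0 → Σ (List (Fin n)) λ vs →
  (2 ℕ.≤ length vs) × Unique (v0 ∷ vs) × Chain E (v0 ∷ vs ++ [ v0 ])

IsTree : (n : ℕ) → List (Edge n) → Set
IsTree n E = SimpleEdges E × (∀ u v → Walk E u v) × ¬ Cycle E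

Incident : ∀ {n} → List (Edge n) → Fin n → Set
Incident S u = Σ _ λ e → e ∈ S × (u ≡ proj₁ e ⊎ u ≡ proj₂ e)

-- the edge set S (nonempty) is the edge set of a tree (spanned on the
-- vertices incident to S): connected and acyclic
IsTreeEdges : ∀ {n} → List (Edge n) → Set
IsTreeEdges S = S ≢ [] × (∀ u v → Incident S u → Incident S v → Walk S u v) × ¬ Cycle S

_⊆_ : {A : Set} → List A → List A → Set
A ⊆ B = All (_∈ B) A

Disjoint : {A : Set} → List A → List A → Set
Disjoint A B = All (λ x → ¬ (x ∈ B)) A

_=ᶠ_ : ∀ {n} → Fin n → Fin n → Bool
u =ᶠ v = does (u Fin.≟ v)

deg : ∀ {n} → List (Edge n) → Fin n → ℕ
deg S v = length (filterᵇ (λ e → (proj₁ e =ᶠ v) ∨ (proj₂ e =ᶠ v)) S)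

leafEdges : ∀ {n} → List (Edge n) → List (Edge n)
leafEdges S = filterᵇ (λ e → (deg S (proj₁ e) ≡ᵇ 1) ∨ (deg S (proj₂ e) ≡ᵇ 1)) S

SubtreeWith : ∀ {n} → List (Edge n) → ℕ → ℕ → List (Edge n) → Set
SubtreeWith E i j S = IsTreeEdges S × length S ≡ i × length (leafEdges S) ≡ j

IsConnector : ∀ {n} → List (Edge n) → List (Edge n) → List (Edge n) → Set
IsConnector E A K =
  K ⊆ E × Unique K × Disjoint K A × IsTreeEdges (A ++ K) ×
  (∀ K′ → K′ ⊆ K → IsTreeEdges (A ++ K′) → K ⊆ K′)

ConnectorWith : ∀ {n} → List (Edge n) → ℕ → ℕ → List (Edge n) → Set
ConnectorWith E a b A =
  A ≢ [] × length A ≡ a × Σ _ λ K → IsConnector E A K × length K ≡ b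

decreasingᵇ : List ℕ → Bool
decreasingᵇ []           = true
decreasingᵇ (x ∷ [])     = true
decreasingᵇ (x ∷ y ∷ xs) = (y ≤ᵇ x) ∧ decreasingᵇ (y ∷ xs)

sumℕ : List ℕ → ℕ
sumℕ = foldr ℕ._+_ 0

isPartitionᵇ : ℕ → List ℕ → Bool
isPartitionᵇ n λ′ = decreasingᵇ λ′ ∧ allᵇ (1 ≤ᵇ_) λ′ ∧ (sumℕ λ′ ≡ᵇ n)

listsOf : ℕ → List ℕ → List (List ℕ)
listsOf zero    xs = [] ∷ []
listsOf (suc l) xs = concatMap (λ x → map (x ∷_) (listsOf l xs)) xs

partitions : ℕ → List (List ℕ)
partitions n = filterᵇ (isPartitionᵇ n)
  (concatMap (λ l → listsOf l (map suc (upTo n))) (upTo (suc n)))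

-- Chromatic symmetric function, specialised to x_1..x_N (x_i = 0 for i > N)

allMaps : (n N : ℕ) → List (Vec (Fin N) n)
allMaps zero    N = Vec.[] ∷ []
allMaps (suc n) N = concatMap (λ c → map (c Vec.∷_) (allMaps n N)) (allFin N)

properᵇ : ∀ {n N} → List (Edge n) → Vec (Fin N) n → Bool
properᵇ E κ = allᵇ (λ e → not (lookup κ (proj₁ e) =ᶠ lookup κ (proj₂ e))) E

chromEval : ∀ {n} → List (Edge n) → (N : ℕ) → (Fin N → ℚ) → ℚ
chromEval {n} E N x =
  sumℚ (map (λ κ → prodℚ (map (λ v → x (lookup κ v)) (allFin n)))
            (filterᵇ (properᵇ E) (allMaps n N)))

pEval : (N : ℕ) → (Fin N → ℚ) → ℕ → ℚ
pEval N x k = sumℚ (map (λ i → x i ^ℚ k) (allFin N))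

pλEval : (N : ℕ) → (Fin N → ℚ) → List ℕ → ℚ
pλEval N x λ′ = prodℚ (map (pEval N x) λ′)

-- c λ is the coefficient of p_λ in X_T, i.e. X_T = Σ_{λ ⊢ n} c_λ p_λ as
-- symmetric functions; equivalently, the identity holds after setting
-- x_i = 0 for i > N and evaluating x_1..x_N at arbitrary rationals, for all N
IsPowerSumExpansion : (n : ℕ) → List (Edge n) → (List ℕ → ℚ) → Set
IsPowerSumExpansion n E c = ∀ N (x : Fin N → ℚ) →
  chromEval E N x ≡ sumℚ (map (λ λ′ → c λ′ * pλEval N x λ′) (partitions n))

-- binom(ℓ - 1, ℓ - n + m) with an integer lower index (0 if negative)
binomShift : (ℓ n m : ℕ) → ℕ
binomShift ℓ n m = if (ℓ ℕ.+ m) <ᵇ n then 0 else ((ℓ ∸ 1) C ((ℓ ℕ.+ m) ∸ n))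

partSum : List ℕ → ℕ → ℕ
partSum λ′ d = sumℕ (map (λ p → (p ∸ 1) C d) λ′)

ψ : ℕ → List ℕ → ℕ → ℕ → ℚ
ψ n λ′ a b = neg1^ (a ℕ.+ b) * ℕ→ℚ (binomShift (length λ′) n (a ℕ.+ b))
                             * ℕ→ℚ (partSum λ′ a)

-- only used for 1 ≤ j ≤ i, where i - d, j - d ≥ 0 for 1 ≤ d ≤ j
φ : ℕ → List ℕ → ℕ → ℕ → ℚ
φ n λ′ i j = neg1^ (i ℕ.+ j) * ℕ→ℚ (binomShift (length λ′) n i)
  * sumℚ (map (λ d → neg1^ d * ℕ→ℚ ((i ∸ d) C (j ∸ d)) * ℕ→ℚ (partSum λ′ d))
              (map suc (upTo j)))

coeffK : ℕ → (List ℕ → ℚ) → ℕ → ℕ → ℚ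
coeffK n c zero    b = 0ℚ
coeffK n c (suc a) b = sumℚ (map (λ λ′ → ψ n λ′ (suc a) b * c λ′) (partitions n))

coeffS : ℕ → (List ℕ → ℚ) → ℕ → ℕ → ℚ
coeffS n c i j =
  if (1 ≤ᵇ j) ∧ (j ≤ᵇ i) ∧ (i <ᵇ n)
  then sumℚ (map (λ λ′ → φ n λ′ i j * c λ′) (partitions n))
  else 0ℚ

-- Grow T leaf by leaf.  Removing the last leaf turns Stanley's expansion of X_T as a sum of
-- (-1)^|F| p_type(F) over F ⊆ E(T) into a recursion on weighted trees.  The λ-sums of the theorem
-- depend on X_T only through Σ c_λ G(ℓ(λ)) Σ_k H(λ_k), and such a sum is read off the values of X_T
-- at M ones and m copies of y, so that the c_λ may be replaced by Stanley's coefficients.  The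
-- generating function Σ_F z^|F| (1-z)^(n-1-|F|) Σ_k ((1+q)^(λ_k(F)-1) - 1) obeys the same
-- leaf recursion as Σ_A q^|A| z^|A ∪ K(A)|, which gives the first formula.  For the second one,
-- A ∪ K(A) = S exactly if S is a subtree and L(S) ⊆ A ⊆ S, and
-- Σ x^|A| (1-x)^(|S|-|A|) over L(S) ⊆ A ⊆ S equals x^|L(S)|.
module Submission where

open import Defs
open import Data.Bool using (Bool; true; false; if_then_else_; _∧_; _∨_; T)
import Data.Bool.Properties as Boolₚ
open import Data.Empty using (⊥-elim)
open import Data.Fin as Fin using (Fin; zero; suc; toℕ)
open import Data.Fin.Subset using (Subset; ⁅_⁆; _∪_) renaming (_∈_ to _∈ˢ_; _∉_ to _∉ˢ_; ⊥ to ∅)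
import Data.Fin.Subset.Properties as Subₚ
open import Data.Integer as ℤ using (ℤ)
import Data.Integer.Properties as ℤₚ
open import Data.List using (List; []; _∷_; _++_; [_]; map; concatMap; filterᵇ; filter; length; allFin; tabulate; upTo)
import Data.List.Properties as Listₚ
import Data.List.Relation.Binary.Permutation.Propositional.Properties as ↭ₚ
import Data.List.Membership.DecPropositional as DecMembership
open import Data.List.Membership.Propositional using (_∈_; _∉_; lose; find)
open import Data.List.Membership.Propositional.Properties using (∈-map⁺; ∈-map⁻; ∈-allFin; ∈-++⁺ˡ; ∈-++⁺ʳ; ∈-++⁻; ∈-filter⁺; ∈-filter⁻)
open import Data.List.Membership.Propositional.Properties.WithK using (unique∧set⇒bag)
open import Data.List.Relation.Binary.BagAndSetEquality using (∼bag⇒↭)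
open import Data.List.Relation.Binary.Permutation.Propositional as ↭ using (_↭_; ↭-sym)
open import Data.List.Relation.Binary.Permutation.Propositional.Properties using (∈-resp-↭; ↭-length; filter-↭)
open import Data.List.Relation.Unary.All as All using (All; []; _∷_)
import Data.List.Relation.Unary.All.Properties as Allₚ
open import Data.List.Relation.Unary.AllPairs using ([]; _∷_)
open import Data.List.Relation.Unary.Any as Any using (Any; here; there)
open import Data.List.Relation.Unary.Unique.Propositional using (Unique)
import Data.List.Relation.Unary.Unique.Propositional.Properties as Uniqueₚ
open import Data.Maybe using (just; nothing)
open import Data.Nat as ℕ using (ℕ; zero; suc; s≤s; z≤n; _≤_)
open import Data.Nat.Combinatorics using (_C_)
import Data.Nat.Combinatorics as Comb
import Data.Nat.Coprimality as Coprime
import Data.Nat.Properties as ℕₚ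
open import Data.Product using (Σ; ∃; _×_; _,_; proj₁; proj₂)
open import Data.Product.Properties using (≡-dec)
open import Data.Rational as ℚ using (ℚ; 0ℚ; 1ℚ; mkℚ; _+_; _*_; -_; _-_; 1/_; ↥_)
import Data.Rational.Properties as ℚₚ
open import Data.Sum using (_⊎_; inj₁; inj₂; [_,_]′)
open import Data.Unit using (tt)
open import Data.Vec as Vec using (Vec; lookup)
open import Function using (_∘_; id; mk⇔)
open import Function.Bundles using (module Equivalence)
open import Relation.Binary.Definitions using (tri<; tri≈; tri>)
open import Relation.Binary.PropositionalEquality
  using (_≡_; _≢_; refl; sym; trans; cong; cong₂; subst; subst₂; module ≡-Reasoning)
open import Relation.Nullary using (¬_; ¬?; _×-dec_; Dec; yes; no; does; contradiction)
open import Relation.Nullary.Decidable using (dec-true; dec-false; T?)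
import Tactic.RingSolver.Core.AlmostCommutativeRing as ACR
open import Tactic.RingSolver using (solve-∀)

-- Polynomial identities are used through their values at natural numbers; `extract` turns these
-- into statements about coefficients. The binomial coefficients of the theorem arise in this way.
-- If F has f edges and ℓ = h + 1 components, where f + h = n - 1, then the coefficient of z^m in
-- z^f (1-z)^h is (-1)^(f+m) C(h, m-f), and m - f = ℓ - n + m: it is Stanley's sign (-1)^f times the
-- factor (-1)^m C(ℓ-1, ℓ-n+m) of `ψ`. Likewise C(λ_k - 1, a) is the coefficient of q^a, a > 0, in
-- (1+q)^(λ_k-1) - 1, and (-1)^(d+j) C(i-d, j-d) is that of x^j in x^d (1-x)^(i-d). The obstacle to
-- a leaf recursion for A ∪ K(A) is that cutting off a leaf w which has to be reached forces its
-- neighbour u to be reached, even if no edge of A remains at u. Hence Steiner trees are taken of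
-- vertex sets instead of edge sets, and the sums allow marked vertices, with weights that record
-- contracted edges.

private variable
  A B : Set
  n N : ℕ

ℚ-ring : ACR.AlmostCommutativeRing _ _
ℚ-ring = ACR.fromCommutativeRing ℚₚ.+-*-commutativeRing isZero
  where
  isZero : ∀ x → _
  isZero x with 0ℚ ℚ.≟ x
  ... | yes p = just p
  ... | no _  = nothing

-- Finite sums

∑ : List A → (A → ℚ) → ℚ
∑ []       f = 0ℚ
∑ (x ∷ xs) f = f x + ∑ xs f

sumℚ-map : (xs : List A) (f : A → ℚ) → sumℚ (map f xs) ≡ ∑ xs f
sumℚ-map []       f = refl
sumℚ-map (x ∷ xs) f = cong (f x +_) (sumℚ-map xs f)

∑-cong-∈ : {f g : A → ℚ} (xs : List A) → (∀ x → x ∈ xs → f x ≡ g x) → ∑ xs f ≡ ∑ xs g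
∑-cong-∈ []       f≗g = refl
∑-cong-∈ (x ∷ xs) f≗g = cong₂ _+_ (f≗g x (here refl)) (∑-cong-∈ xs λ y y∈ → f≗g y (there y∈))

∑-cong : {f g : A → ℚ} (xs : List A) → (∀ x → f x ≡ g x) → ∑ xs f ≡ ∑ xs g
∑-cong xs f≗g = ∑-cong-∈ xs λ x _ → f≗g x

∑-zero : (xs : List A) → ∑ xs (λ _ → 0ℚ) ≡ 0ℚ
∑-zero []       = refl
∑-zero (x ∷ xs) = trans (ℚₚ.+-identityˡ _) (∑-zero xs)

∑-++ : (xs ys : List A) (f : A → ℚ) → ∑ (xs ++ ys) f ≡ ∑ xs f + ∑ ys f
∑-++ []       ys f = sym (ℚₚ.+-identityˡ _)
∑-++ (x ∷ xs) ys f = trans (cong (f x +_) (∑-++ xs ys f)) (sym (ℚₚ.+-assoc (f x) _ _))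

∑-map : (h : A → B) (xs : List A) (f : B → ℚ) → ∑ (map h xs) f ≡ ∑ xs (f ∘ h)
∑-map h []       f = refl
∑-map h (x ∷ xs) f = cong (f (h x) +_) (∑-map h xs f)

∑-concatMap : (h : A → List B) (xs : List A) (f : B → ℚ) →
  ∑ (concatMap h xs) f ≡ ∑ xs (λ x → ∑ (h x) f)
∑-concatMap h []       f = refl
∑-concatMap h (x ∷ xs) f =
  trans (∑-++ (h x) (concatMap h xs) f) (cong (∑ (h x) f +_) (∑-concatMap h xs f))

∑-+ : (xs : List A) (f g : A → ℚ) → ∑ xs (λ x → f x + g x) ≡ ∑ xs f + ∑ xs g
∑-+ []       f g = refl
∑-+ (x ∷ xs) f g = trans (cong (_+_ (f x + g x)) (∑-+ xs f g)) (lem (f x) (g x) _ _)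
  where
  lem : ∀ a b c d → a + b + (c + d) ≡ a + c + (b + d)
  lem = solve-∀ ℚ-ring

∑-*ˡ : (c : ℚ) (xs : List A) (f : A → ℚ) → ∑ xs (λ x → c * f x) ≡ c * ∑ xs f
∑-*ˡ c []       f = sym (ℚₚ.*-zeroʳ c)
∑-*ˡ c (x ∷ xs) f = trans (cong (c * f x +_) (∑-*ˡ c xs f)) (sym (ℚₚ.*-distribˡ-+ c _ _))

∑-*ʳ : (c : ℚ) (xs : List A) (f : A → ℚ) → ∑ xs (λ x → f x * c) ≡ ∑ xs f * c
∑-*ʳ c xs f = trans (∑-cong xs λ x → ℚₚ.*-comm (f x) c)
  (trans (∑-*ˡ c xs f) (ℚₚ.*-comm c _))

∑-- : (xs : List A) (f g : A → ℚ) → ∑ xs (λ x → f x - g x) ≡ ∑ xs f - ∑ xs g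
∑-- []       f g = refl
∑-- (x ∷ xs) f g = trans (cong (_+_ (f x - g x)) (∑-- xs f g)) (lem (f x) (g x) _ _)
  where
  lem : ∀ a b c d → a - b + (c - d) ≡ a + c - (b + d)
  lem = solve-∀ ℚ-ring

∑-swap : (xs : List A) (ys : List B) (f : A → B → ℚ) →
  ∑ xs (λ x → ∑ ys (f x)) ≡ ∑ ys (λ y → ∑ xs (λ x → f x y))
∑-swap []       ys f = sym (∑-zero ys)
∑-swap (x ∷ xs) ys f = trans (cong (∑ ys (f x) +_) (∑-swap xs ys f)) (sym (∑-+ ys (f x) _))

𝟙 : Bool → ℚ
𝟙 b = if b then 1ℚ else 0ℚ

∑-filterᵇ : (p : A → Bool) (xs : List A) (f : A → ℚ) →
  ∑ (filterᵇ p xs) f ≡ ∑ xs (λ x → 𝟙 (p x) * f x)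
∑-filterᵇ p []       f = refl
∑-filterᵇ p (x ∷ xs) f with p x
... | true  = cong₂ _+_ (sym (ℚₚ.*-identityˡ (f x))) (∑-filterᵇ p xs f)
... | false = trans (∑-filterᵇ p xs f)
  (sym (trans (cong (_+ _) (ℚₚ.*-zeroˡ (f x))) (ℚₚ.+-identityˡ _)))

∏ : List A → (A → ℚ) → ℚ
∏ []       f = 1ℚ
∏ (x ∷ xs) f = f x * ∏ xs f

prodℚ-map : (xs : List A) (f : A → ℚ) → prodℚ (map f xs) ≡ ∏ xs f
prodℚ-map []       f = refl
prodℚ-map (x ∷ xs) f = cong (f x *_) (prodℚ-map xs f)

∏-cong-∈ : {f g : A → ℚ} (xs : List A) → (∀ x → x ∈ xs → f x ≡ g x) → ∏ xs f ≡ ∏ xs g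
∏-cong-∈ []       f≗g = refl
∏-cong-∈ (x ∷ xs) f≗g = cong₂ _*_ (f≗g x (here refl)) (∏-cong-∈ xs λ y y∈ → f≗g y (there y∈))

-- Naturals inside ℚ

ℕ→ℚ-mkℚ : ∀ k → ℕ→ℚ k ≡ mkℚ (ℤ.+ k) 0 (Coprime.sym (Coprime.1-coprimeTo k))
ℕ→ℚ-mkℚ k = ℚₚ.normalize-coprime (Coprime.sym (Coprime.1-coprimeTo k))

ℕ→ℚ-+ : ∀ m n → ℕ→ℚ (m ℕ.+ n) ≡ ℕ→ℚ m + ℕ→ℚ n
ℕ→ℚ-+ m n rewrite ℕ→ℚ-mkℚ m | ℕ→ℚ-mkℚ n =
  cong (ℚ._/ 1) (sym (cong₂ ℤ._+_ (ℤₚ.*-identityʳ (ℤ.+ m)) (ℤₚ.*-identityʳ (ℤ.+ n))))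

ℕ→ℚ-* : ∀ m n → ℕ→ℚ (m ℕ.* n) ≡ ℕ→ℚ m * ℕ→ℚ n
ℕ→ℚ-* m n rewrite ℕ→ℚ-mkℚ m | ℕ→ℚ-mkℚ n = cong (ℚ._/ 1) (ℤₚ.pos-* m n)

ℕ→ℚ-injective : ∀ {m n} → ℕ→ℚ m ≡ ℕ→ℚ n → m ≡ n
ℕ→ℚ-injective {m} {n} eq = ℤₚ.+-injective
  (cong ↥_ (trans (sym (ℕ→ℚ-mkℚ m)) (trans eq (ℕ→ℚ-mkℚ n))))

ℕ→ℚ-^ : ∀ m k → ℕ→ℚ (m ℕ.^ k) ≡ ℕ→ℚ m ^ℚ k
ℕ→ℚ-^ m zero    = refl
ℕ→ℚ-^ m (suc k) = trans (ℕ→ℚ-* m (m ℕ.^ k)) (cong (ℕ→ℚ m *_) (ℕ→ℚ-^ m k))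

^ℚ-+ : ∀ x k l → x ^ℚ (k ℕ.+ l) ≡ x ^ℚ k * x ^ℚ l
^ℚ-+ x zero    l = sym (ℚₚ.*-identityˡ _)
^ℚ-+ x (suc k) l = trans (cong (x *_) (^ℚ-+ x k l)) (sym (ℚₚ.*-assoc x _ _))

^ℚ-distrib-* : ∀ x y k → (x * y) ^ℚ k ≡ x ^ℚ k * y ^ℚ k
^ℚ-distrib-* x y zero    = refl
^ℚ-distrib-* x y (suc k) = trans (cong (_*_ (x * y)) (^ℚ-distrib-* x y k)) (lem x y _ _)
  where
  lem : ∀ a b c d → a * b * (c * d) ≡ a * c * (b * d)
  lem = solve-∀ ℚ-ring

1^ℚ : ∀ k → 1ℚ ^ℚ k ≡ 1ℚ
1^ℚ zero    = refl
1^ℚ (suc k) = trans (ℚₚ.*-identityˡ _) (1^ℚ k)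

-- Extraction of coefficients

2^-injective : ∀ {k l} → ℕ→ℚ 2 ^ℚ k ≡ ℕ→ℚ 2 ^ℚ l → k ≡ l
2^-injective {k} {l} eq = ℕ-inj (ℕ→ℚ-injective (trans (ℕ→ℚ-^ 2 k) (trans eq (sym (ℕ→ℚ-^ 2 l)))))
  where
  2^-mono : ∀ {k l} → k ℕ.< l → 2 ℕ.^ k ℕ.< 2 ℕ.^ l
  2^-mono = ℕₚ.^-monoʳ-< 2 (s≤s (s≤s z≤n))
  ℕ-inj : 2 ℕ.^ k ≡ 2 ℕ.^ l → k ≡ l
  ℕ-inj eq with ℕₚ.<-cmp k l
  ... | tri< k<l _ _ = contradiction eq (ℕₚ.<⇒≢ (2^-mono k<l))
  ... | tri≈ _ k≡l _ = k≡l
  ... | tri> _ _ k>l = contradiction (sym eq) (ℕₚ.<⇒≢ (2^-mono k>l))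

*-solvable : ∀ x c → (x ≡ 0ℚ → c ≡ 0ℚ) → Σ ℚ λ y → x * y ≡ c
*-solvable x c x≡0⇒c≡0 with x ℚ.≟ 0ℚ
... | yes refl = 0ℚ , sym (x≡0⇒c≡0 refl)
... | no x≢0 = (1/ x) * c , trans (sym (ℚₚ.*-assoc x _ c))
    (trans (cong (_* c) (ℚₚ.*-inverseʳ x)) (ℚₚ.*-identityˡ c))
  where instance _ = ℚ.≢-nonZero x≢0

x-y≡0⇒x≡y : ∀ x y → x - y ≡ 0ℚ → x ≡ y
x-y≡0⇒x≡y x y eq = trans (sym (lem x y)) (trans (cong (_+ y) eq) (ℚₚ.+-identityˡ y))
  where
  lem : ∀ x y → x - y + y ≡ x
  lem = solve-∀ ℚ-ring

-- A polynomial vanishing on ℕ is annihilated by every linear functional.  If Σ dᵢ t^eᵢ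
-- vanishes for all t then so does Σ dᵢ (2^eᵢ - 2^k) t^eᵢ, which gets rid of the exponent k.
extract-among : (ks : List ℕ) (L : List A) (e : A → ℕ) (d : A → ℚ) →
  (∀ i → i ∈ L → e i ∈ ks ⊎ d i ≡ 0ℚ) →
  (∀ t → ∑ L (λ i → d i * ℕ→ℚ t ^ℚ e i) ≡ 0ℚ) →
  ∀ (g : ℕ → ℚ) → ∑ L (λ i → d i * g (e i)) ≡ 0ℚ
extract-among [] L e d cover vanish g = trans (∑-cong-∈ L λ i i∈ → lem i (cover i i∈)) (∑-zero L)
  where
  lem : ∀ i → e i ∈ [] ⊎ d i ≡ 0ℚ → d i * g (e i) ≡ 0ℚ
  lem i (inj₂ eq) = trans (cong (_* g (e i)) eq) (ℚₚ.*-zeroˡ (g (e i)))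
extract-among (k ∷ ks) L e d cover vanish g = begin
  ∑ L (λ i → d i * g (e i))                          ≡⟨ ∑-cong L split ⟩
  ∑ L (λ i → d i * w (e i) * g′ (e i) + d i * g k)   ≡⟨ ∑-+ L (λ i → d i * w (e i) * g′ (e i)) _ ⟩
  ∑ L (λ i → d i * w (e i) * g′ (e i)) + ∑ L (λ i → d i * g k)                          ≡⟨ cong₂ _+_ IH (trans (∑-*ʳ (g k) L d) (cong (_* g k) total)) ⟩
  0ℚ + 0ℚ * g k                                      ≡⟨ cong (0ℚ +_) (ℚₚ.*-zeroˡ (g k)) ⟩
  0ℚ                                                 ∎
  where
  open ≡-Reasoning
  pow : ℕ → ℚ
  pow m = ℕ→ℚ 2 ^ℚ m
  w : ℕ → ℚ
  w m = pow m - pow k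
  -- A divided difference: 2^m = 2^k only for m = k, where g m - g k vanishes as well. So g m = w m
  -- * g′ m + g k for every m; the first summand falls to the induction on `ks` and the constant one
  -- to `total`.
  g′-spec : ∀ m → Σ ℚ λ y → w m * y ≡ g m - g k
  g′-spec m = *-solvable (w m) _ λ eq →
    trans (cong (λ j → g j - g k) (2^-injective (x-y≡0⇒x≡y _ _ eq))) (ℚₚ.+-inverseʳ (g k))
  g′ : ℕ → ℚ
  g′ m = proj₁ (g′-spec m)
  lem₁ : ∀ a b c → a * (b - c) + a * c ≡ a * b
  lem₁ = solve-∀ ℚ-ring
  split : ∀ i → d i * g (e i) ≡ d i * w (e i) * g′ (e i) + d i * g k
  split i = sym (trans (cong (_+ d i * g k)
    (trans (ℚₚ.*-assoc (d i) _ _) (cong (d i *_) (proj₂ (g′-spec (e i)))))) (lem₁ (d i) _ _))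
  -- At t = 1 all powers are 1.
  total : ∑ L d ≡ 0ℚ
  total = trans (∑-cong L λ i → sym (trans (cong (d i *_) (1^ℚ (e i))) (ℚₚ.*-identityʳ _))) (vanish 1)
  cover′ : ∀ i → i ∈ L → e i ∈ ks ⊎ d i * w (e i) ≡ 0ℚ
  cover′ i i∈ with cover i i∈
  ... | inj₁ (here eq)   = inj₂ (trans (cong (d i *_) (trans (cong w eq) (ℚₚ.+-inverseʳ (pow k)))) (ℚₚ.*-zeroʳ (d i)))
  ... | inj₁ (there e∈)  = inj₁ e∈
  ... | inj₂ eq          = inj₂ (trans (cong (_* w (e i)) eq) (ℚₚ.*-zeroˡ (w (e i))))
  lem₂ : ∀ a b c s → a * (b - c) * s ≡ a * (b * s) - c * (a * s)
  lem₂ = solve-∀ ℚ-ring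
  -- The factor 2^e turns t^e into (2t)^e, so the reweighted sum combines the values at 2t and at t.
  vanish′ : ∀ t → ∑ L (λ i → d i * w (e i) * ℕ→ℚ t ^ℚ e i) ≡ 0ℚ
  vanish′ t = begin
    _ ≡⟨ ∑-cong L (λ i → trans (lem₂ (d i) (pow (e i)) (pow k) (ℕ→ℚ t ^ℚ e i))
           (cong (λ s → d i * s - pow k * (d i * ℕ→ℚ t ^ℚ e i)) (sym (trans (cong (_^ℚ e i) (ℕ→ℚ-* 2 t)) (^ℚ-distrib-* _ _ (e i)))))) ⟩
    ∑ L (λ i → d i * ℕ→ℚ (2 ℕ.* t) ^ℚ e i - pow k * (d i * ℕ→ℚ t ^ℚ e i)) ≡⟨ ∑-- L (λ i → d i * ℕ→ℚ (2 ℕ.* t) ^ℚ e i) _ ⟩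
    ∑ L (λ i → d i * ℕ→ℚ (2 ℕ.* t) ^ℚ e i) - ∑ L (λ i → pow k * (d i * ℕ→ℚ t ^ℚ e i)) ≡⟨ cong₂ _-_ (vanish (2 ℕ.* t)) (trans (∑-*ˡ (pow k) L _) (cong (pow k *_) (vanish t))) ⟩
    0ℚ - pow k * 0ℚ ≡⟨ cong (λ s → 0ℚ - s) (ℚₚ.*-zeroʳ (pow k)) ⟩
    0ℚ ∎
  IH : ∑ L (λ i → d i * w (e i) * g′ (e i)) ≡ 0ℚ
  IH = extract-among ks L e _ cover′ vanish′ g′

extract : (L : List A) (e : A → ℕ) (d : A → ℚ) →
  (∀ t → ∑ L (λ i → d i * ℕ→ℚ t ^ℚ e i) ≡ 0ℚ) →
  ∀ (g : ℕ → ℚ) → ∑ L (λ i → d i * g (e i)) ≡ 0ℚ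
extract L e d = extract-among (map e L) L e d (λ i i∈ → inj₁ (∈-map⁺ e i∈))

-- Trees grown leaf by leaf

Joins : Edge n → Fin n → Fin n → Set
Joins e u w = e ≡ (u , w) ⊎ e ≡ (w , u)

data Growth {n} : List (Fin n) → List (Edge n) → Set where
  root : ∀ r → Growth [ r ] []
  leaf : ∀ {vs es u w e} → Growth vs es → u ∈ vs → w ∉ vs → Joins e u w →
         Growth (w ∷ vs) (e ∷ es)

growth-incident : ∀ {vs} {es : List (Edge n)} → Growth vs es →
  ∀ e → e ∈ es → proj₁ e ∈ vs × proj₂ e ∈ vs
growth-incident (leaf T u∈ w∉ (inj₁ refl)) e (here refl) = there u∈ , here refl
growth-incident (leaf T u∈ w∉ (inj₂ refl)) e (here refl) = here refl , there u∈
growth-incident (leaf T u∈ w∉ j) e (there e∈) =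
  there (proj₁ (growth-incident T e e∈)) , there (proj₂ (growth-incident T e e∈))

growth-unique-vertices : ∀ {vs} {es : List (Edge n)} → Growth vs es → Unique vs
growth-unique-vertices (root r)          = [] ∷ []
growth-unique-vertices (leaf T u∈ w∉ j) = Allₚ.¬Any⇒All¬ _ w∉ ∷ growth-unique-vertices T

growth-length : ∀ {vs} {es : List (Edge n)} → Growth vs es → length vs ≡ suc (length es)
growth-length (root r)          = refl
growth-length (leaf T u∈ w∉ j) = cong suc (growth-length T)

_[_↦_] : (Fin n → A) → Fin n → A → Fin n → A
(f [ w ↦ a ]) v = if does (v Fin.≟ w) then a else f v

[↦]-same : (f : Fin n → A) (w : Fin n) (a : A) → (f [ w ↦ a ]) w ≡ a
[↦]-same f w a rewrite dec-true (w Fin.≟ w) refl = refl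

[↦]-other : (f : Fin n → A) (w : Fin n) (a : A) {v : Fin n} → v ≢ w → (f [ w ↦ a ]) v ≡ f v
[↦]-other f w a {v} v≢w rewrite dec-false (v Fin.≟ w) v≢w = refl

[↦]-cong : (f g : Fin n → A) (w : Fin n) (a : A) {v : Fin n} → (v ≢ w → f v ≡ g v) →
  (f [ w ↦ a ]) v ≡ (g [ w ↦ a ]) v
[↦]-cong f g w a {v} eq with v Fin.≟ w
... | yes _  = refl
... | no v≢w = eq v≢w

-- Sums over colourings

Colouring : ℕ → ℕ → Set
Colouring n N = Fin n → Fin N

-- The base colouring κ supplies the colours outside of `vs`. Fixing it allows the vertices to be
-- summed one at a time, in the order in which the tree has grown.
∑κ : List (Fin n) → (Colouring n N → ℚ) → Colouring n N → ℚ
∑κ         []       f κ = f κ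
∑κ {N = N} (v ∷ vs) f κ = ∑ (allFin N) λ c → ∑κ vs f (κ [ v ↦ c ])

∑κ-cong : (vs : List (Fin n)) {f g : Colouring n N → ℚ} (κ : Colouring n N) →
  (∀ κ′ → (∀ v → v ∉ vs → κ′ v ≡ κ v) → f κ′ ≡ g κ′) → ∑κ vs f κ ≡ ∑κ vs g κ
∑κ-cong []       κ f≗g = f≗g κ λ _ _ → refl
∑κ-cong {N = N} (v ∷ vs) κ f≗g = ∑-cong (allFin N) λ c → ∑κ-cong vs _ λ κ′ κ′≗ → f≗g κ′ λ v′ v′∉ →
  trans (κ′≗ v′ (v′∉ ∘ there)) ([↦]-other κ v c (v′∉ ∘ here))

-- Colourings are functions and are compared pointwise, so every summand has to come with the
-- vertices that it looks at. For the trivially true predicate `everywhere` this is mere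
-- extensionality.
DependsOn : (Fin n → Set) → (Colouring n N → ℚ) → Set
DependsOn P f = ∀ κ κ′ → (∀ v → P v → κ v ≡ κ′ v) → f κ ≡ f κ′

∑κ-base : (vs : List (Fin n)) {P : Fin n → Set} {f : Colouring n N → ℚ} → DependsOn P f →
  (κ κ′ : Colouring n N) → (∀ v → P v → v ∉ vs → κ v ≡ κ′ v) → ∑κ vs f κ ≡ ∑κ vs f κ′
∑κ-base []       f-dep κ κ′ κ≗κ′ = f-dep κ κ′ λ v Pv → κ≗κ′ v Pv λ ()
∑κ-base {N = N} (v ∷ vs) f-dep κ κ′ κ≗κ′ = ∑-cong (allFin N) λ c → ∑κ-base vs f-dep _ _ λ v′ Pv′ v′∉ →
  [↦]-cong κ κ′ v c λ v′≢v → κ≗κ′ v′ Pv′ λ { (here eq) → v′≢v eq ; (there v′∈) → v′∉ v′∈ }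

∑κ-∑ : (vs : List (Fin n)) (xs : List A) (f : A → Colouring n N → ℚ) (κ : Colouring n N) →
  ∑ xs (λ x → ∑κ vs (f x) κ) ≡ ∑κ vs (λ κ′ → ∑ xs (λ x → f x κ′)) κ
∑κ-∑ []       xs f κ = refl
∑κ-∑ {N = N} (v ∷ vs) xs f κ = trans (∑-swap xs (allFin N) _)
  (∑-cong (allFin N) λ c → ∑κ-∑ vs xs f _)

∑κ-*ˡ : (vs : List (Fin n)) (a : ℚ) (f : Colouring n N → ℚ) (κ : Colouring n N) →
  ∑κ vs (λ κ′ → a * f κ′) κ ≡ a * ∑κ vs f κ
∑κ-*ˡ []       a f κ = refl
∑κ-*ˡ {N = N} (v ∷ vs) a f κ = trans (∑-cong (allFin N) λ c → ∑κ-*ˡ vs a f _) (∑-*ˡ a (allFin N) _)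

∑κ-- : (vs : List (Fin n)) (f g : Colouring n N → ℚ) (κ : Colouring n N) →
  ∑κ vs (λ κ′ → f κ′ - g κ′) κ ≡ ∑κ vs f κ - ∑κ vs g κ
∑κ-- []       f g κ = refl
∑κ-- {N = N} (v ∷ vs) f g κ = trans (∑-cong (allFin N) λ c → ∑κ-- vs f g _) (∑-- (allFin N) _ _)

everywhere : Fin n → Set
everywhere v = v ≡ v

∑κ-↭ : {vs vs′ : List (Fin n)} {f : Colouring n N → ℚ} → DependsOn everywhere f →
  vs ↭ vs′ → ∀ κ → ∑κ vs f κ ≡ ∑κ vs′ f κ
∑κ-↭ f-dep ↭.refl        κ = refl
∑κ-↭ {N = N} f-dep (↭.prep v p)  κ = ∑-cong (allFin N) λ c → ∑κ-↭ f-dep p _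
∑κ-↭ f-dep (↭.trans p q) κ = trans (∑κ-↭ f-dep p κ) (∑κ-↭ f-dep q κ)
∑κ-↭ {N = N} {f = f} f-dep (↭.swap {xs = vs} {ys = vs′} v w p) κ with v Fin.≟ w
-- For a repeated vertex the later update overrides the earlier one, and both orders give the same
-- nested sum.
... | yes refl = ∑-cong (allFin N) λ c → ∑-cong (allFin N) λ d → ∑κ-↭ f-dep p _
... | no v≢w = trans (∑-cong (allFin N) λ c → ∑-cong (allFin N) λ d →
    trans (∑κ-base vs f-dep _ _ λ v′ _ _ → commute c d v′) (∑κ-↭ f-dep p _))
  (∑-swap (allFin N) (allFin N) λ c d → ∑κ vs′ f ((κ [ w ↦ d ]) [ v ↦ c ]))
  where
  commute : ∀ c d v′ → ((κ [ v ↦ c ]) [ w ↦ d ]) v′ ≡ ((κ [ w ↦ d ]) [ v ↦ c ]) v′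
  commute c d v′ with v′ Fin.≟ w | v′ Fin.≟ v
  ... | yes refl | yes refl = ⊥-elim (v≢w refl)
  ... | yes _    | no _     = refl
  ... | no _     | yes _    = refl
  ... | no _     | no _     = refl

_◂_ : Fin N → Colouring n N → Colouring (suc n) N
(c ◂ κ) zero    = c
(c ◂ κ) (suc v) = κ v

∑κ-map-suc : (vs : List (Fin n)) {f : Colouring (suc n) N → ℚ} → DependsOn everywhere f →
  (κ : Colouring (suc n) N) →
  ∑κ (map suc vs) f κ ≡ ∑κ vs (λ κ′ → f (κ zero ◂ κ′)) (κ ∘ suc)
∑κ-map-suc []       f-dep κ = f-dep _ _ λ { zero _ → refl ; (suc v) _ → refl }
∑κ-map-suc {N = N} (v ∷ vs) {f} f-dep κ = ∑-cong (allFin N) λ c → trans (∑κ-map-suc vs f-dep _)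
  (∑κ-base vs {P = everywhere} (λ κ₁ κ₂ eq → f-dep _ _ λ { zero _ → refl ; (suc v) _ → eq v refl }) _ _ λ v′ _ _ → shifted c v′)
  where
  shifted : ∀ c v′ → (κ [ suc v ↦ c ]) (suc v′) ≡ ((κ ∘ suc) [ v ↦ c ]) v′
  shifted c v′ with v′ Fin.≟ v
  ... | yes _ = refl
  ... | no _  = refl

-- All vertices are summed over, so any base colouring will do. One has to exist, though, which for
-- n > 0 requires a colour.
∑-allMaps : ∀ n {N} {f : Colouring n N → ℚ} → DependsOn everywhere f → (κ : Colouring n N) →
  ∑ (allMaps n N) (f ∘ lookup) ≡ ∑κ (allFin n) f κ
∑-allMaps zero    {f = f} f-dep κ = trans (ℚₚ.+-identityʳ _) (f-dep _ _ λ ())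
∑-allMaps (suc n) {N} {f} f-dep κ = begin
  ∑ (allMaps (suc n) N) (f ∘ lookup)
    ≡⟨ ∑-concatMap _ (allFin N) _ ⟩
  ∑ (allFin N) (λ c → ∑ (map (c Vec.∷_) (allMaps n N)) (f ∘ lookup))
    ≡⟨ ∑-cong (allFin N) fixed-first ⟩
  ∑ (allFin N) (λ c → ∑κ (map suc (allFin n)) f (κ [ zero ↦ c ]))
    ≡⟨ ∑-cong (allFin N) (λ c → cong (λ vs → ∑κ vs f (κ [ zero ↦ c ])) (Listₚ.map-tabulate id suc)) ⟩
  ∑κ (allFin (suc n)) f κ ∎
  where
  open ≡-Reasoning
  cons-dep : ∀ c → DependsOn everywhere λ κ′ → f (c ◂ κ′)
  cons-dep c κ₁ κ₂ eq = f-dep _ _ λ { zero _ → refl ; (suc v) _ → eq v refl }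
  fixed-first : ∀ c → ∑ (map (c Vec.∷_) (allMaps n N)) (f ∘ lookup) ≡ ∑κ (map suc (allFin n)) f (κ [ zero ↦ c ])
  fixed-first c = begin
    ∑ (map (c Vec.∷_) (allMaps n N)) (f ∘ lookup)
      ≡⟨ ∑-map (c Vec.∷_) (allMaps n N) _ ⟩
    ∑ (allMaps n N) (λ κ′ → f (lookup (c Vec.∷ κ′)))
      ≡⟨ ∑-cong (allMaps n N) (λ κ′ → f-dep _ _ λ { zero _ → refl ; (suc v) _ → refl }) ⟩
    ∑ (allMaps n N) (λ κ′ → f (c ◂ lookup κ′))
      ≡⟨ ∑-allMaps n (cons-dep c) (κ ∘ suc) ⟩
    ∑κ (allFin n) (λ κ′ → f (c ◂ κ′)) (κ ∘ suc)
      ≡⟨ ∑κ-base (allFin n) (cons-dep c) _ _ (λ v _ v∉ → ⊥-elim (v∉ (∈-allFin v))) ⟩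
    ∑κ (allFin n) (λ κ′ → f (c ◂ κ′)) ((κ [ zero ↦ c ]) ∘ suc)
      ≡⟨ ∑κ-cong (allFin n) _ (λ κ′ _ → f-dep _ _ λ { zero _ → refl ; (suc v) _ → refl }) ⟩
    _
      ≡⟨ sym (∑κ-map-suc (allFin n) f-dep (κ [ zero ↦ c ])) ⟩
    ∑κ (map suc (allFin n)) f (κ [ zero ↦ c ]) ∎

-- Stanley's power sum expansion

monochromatic : Colouring n N → Edge n → ℚ
monochromatic κ e = 𝟙 (κ (proj₁ e) =ᶠ κ (proj₂ e))

-- Contracting an edge makes vertices of weight greater than 1, whence the weights wt.
weigh : (Fin N → ℚ) → List (Fin n) → List (Edge n) → (Fin n → ℕ) → Colouring n N → ℚ
weigh x vs es wt κ = ∏ vs (λ v → x (κ v) ^ℚ wt v) * ∏ es (λ e → 1ℚ - monochromatic κ e)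

merge : (Fin n → ℕ) → Fin n → Fin n → Fin n → ℕ
merge wt u w = wt [ u ↦ wt u ℕ.+ wt w ]

-- One triple (f , h , τ) for every set of edges F: the numbers of edges inside and outside of
-- F, and the weights of the components of F.
terms : ∀ {vs} {es : List (Edge n)} → Growth vs es → (Fin n → ℕ) → List (ℕ × ℕ × List ℕ)
terms (root r) wt = [ 0 , 0 , [ wt r ] ]
terms (leaf {u = u} {w} T _ _ _) wt =
  -- If the new edge is outside of F, then w is a component of its own; if it is in F, then it is
  -- contracted and u takes over the weight of w.
  map (λ (f , h , τ) → f , suc h , wt w ∷ τ) (terms T wt) ++
  map (λ (f , h , τ) → suc f , h , τ) (terms T (merge wt u w))

p∏ : (Fin N → ℚ) → List ℕ → ℚ
p∏ {N} x τ = ∏ τ (λ k → ∑ (allFin N) (λ c → x c ^ℚ k))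

=ᶠ-refl : (u : Fin n) → (u =ᶠ u) ≡ true
=ᶠ-refl u = dec-true (u Fin.≟ u) refl

=ᶠ-sym : (u v : Fin n) → (u =ᶠ v) ≡ (v =ᶠ u)
=ᶠ-sym u v with u Fin.≟ v
... | yes refl = sym (=ᶠ-refl u)
... | no u≢v = sym (dec-false (v Fin.≟ u) (u≢v ∘ sym))

monochromatic-joins : ∀ {e : Edge n} {u w} → Joins e u w → (κ : Colouring n N) {c : Fin N} →
  κ w ≡ c → monochromatic κ e ≡ 𝟙 (κ u =ᶠ c)
monochromatic-joins (inj₁ refl) κ refl = refl
monochromatic-joins {u = u} {w} (inj₂ refl) κ refl = cong 𝟙 (=ᶠ-sym (κ w) (κ u))

∑-select : (_≟_ : (x y : A) → Dec (x ≡ y)) (xs : List A) → Unique xs → (c : A) → c ∈ xs → (f : A → ℚ) →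
  ∑ xs (λ d → 𝟙 (does (c ≟ d)) * f d) ≡ f c
∑-select _≟_ (.c ∷ xs) (c∉ ∷ xs!) c (here refl) f = begin
  𝟙 (does (c ≟ c)) * f c + ∑ xs (λ d → 𝟙 (does (c ≟ d)) * f d)
    ≡⟨ cong₂ _+_ (trans (cong (λ b → 𝟙 b * f c) (dec-true (c ≟ c) refl)) (ℚₚ.*-identityˡ (f c))) rest ⟩
  f c + 0ℚ ≡⟨ ℚₚ.+-identityʳ (f c) ⟩
  f c ∎
  where
  open ≡-Reasoning
  rest : ∑ xs (λ d → 𝟙 (does (c ≟ d)) * f d) ≡ 0ℚ
  rest = trans (∑-cong-∈ xs λ d d∈ → trans (cong (λ b → 𝟙 b * f d)
    (dec-false (c ≟ d) (All.lookup c∉ d∈))) (ℚₚ.*-zeroˡ (f d))) (∑-zero xs)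
∑-select _≟_ (d ∷ xs) (d∉ ∷ xs!) c (there c∈) f = begin
  𝟙 (does (c ≟ d)) * f d + ∑ xs (λ d → 𝟙 (does (c ≟ d)) * f d)
    ≡⟨ cong₂ _+_ (trans (cong (λ b → 𝟙 b * f d) (dec-false (c ≟ d) (λ c≡d → All.lookup d∉ c∈ (sym c≡d)))) (ℚₚ.*-zeroˡ (f d)))
         (∑-select _≟_ xs xs! c c∈ f) ⟩
  0ℚ + f c ≡⟨ ℚₚ.+-identityˡ (f c) ⟩
  f c ∎
  where open ≡-Reasoning

∏-merge : (x : Fin N → ℚ) (vs : List (Fin n)) → Unique vs → (wt : Fin n → ℕ) (u w : Fin n) →
  u ∈ vs → (κ : Colouring n N) →
  ∏ vs (λ v → x (κ v) ^ℚ merge wt u w v) ≡ x (κ u) ^ℚ wt w * ∏ vs (λ v → x (κ v) ^ℚ wt v)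
∏-merge x (v ∷ vs) (v∉ ∷ vs!) wt u w (here refl) κ = begin
  x (κ v) ^ℚ merge wt v w v * ∏ vs (λ v′ → x (κ v′) ^ℚ merge wt v w v′)
    ≡⟨ cong₂ _*_ (trans (cong (x (κ v) ^ℚ_) ([↦]-same wt v _)) (^ℚ-+ (x (κ v)) (wt v) (wt w)))
         (∏-cong-∈ vs λ v′ v′∈ → cong (x (κ v′) ^ℚ_) ([↦]-other wt v _ λ v′≡v → All.lookup v∉ v′∈ (sym v′≡v))) ⟩
  x (κ v) ^ℚ wt v * x (κ v) ^ℚ wt w * ∏ vs (λ v′ → x (κ v′) ^ℚ wt v′)
    ≡⟨ lem (x (κ v) ^ℚ wt v) (x (κ v) ^ℚ wt w) _ ⟩
  x (κ v) ^ℚ wt w * (x (κ v) ^ℚ wt v * ∏ vs (λ v′ → x (κ v′) ^ℚ wt v′)) ∎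
  where
  open ≡-Reasoning
  lem : ∀ a b c → a * b * c ≡ b * (a * c)
  lem = solve-∀ ℚ-ring
∏-merge x (v ∷ vs) (v∉ ∷ vs!) wt u w (there u∈) κ =
  trans (cong₂ _*_ (cong (x (κ v) ^ℚ_) ([↦]-other wt u _ (All.lookup v∉ u∈))) (∏-merge x vs vs! wt u w u∈ κ))
    (lem (x (κ v) ^ℚ wt v) (x (κ u) ^ℚ wt w) _)
  where
  lem : ∀ a b c → a * (b * c) ≡ b * (a * c)
  lem = solve-∀ ℚ-ring

weigh-local : ∀ {vs} {es : List (Edge n)} → Growth vs es → (x : Fin N → ℚ) (wt : Fin n → ℕ) →
  DependsOn (_∈ vs) (weigh x vs es wt)
weigh-local {vs = vs} {es} T x wt κ κ′ eq = cong₂ _*_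
  (∏-cong-∈ vs λ v v∈ → cong (λ c → x c ^ℚ wt v) (eq v v∈))
  (∏-cong-∈ es λ e e∈ → cong (λ b → 1ℚ - 𝟙 b)
    (cong₂ _=ᶠ_ (eq _ (proj₁ (growth-incident T e e∈))) (eq _ (proj₂ (growth-incident T e e∈)))))

-- Deletion and contraction of a pendant edge. Its factor is 1 - [κ u = κ w]: the 1 lets the colour
-- of w run freely and gives a power sum, the indicator gives w the colour of u and moves its weight
-- there.
∑κ-weigh-leaf : ∀ {vs} {es : List (Edge n)} {u w e} (T : Growth vs es) (u∈ : u ∈ vs) (w∉ : w ∉ vs) →
  Joins e u w → (x : Fin N → ℚ) (wt : Fin n → ℕ) (κ : Colouring n N) →
  ∑κ (w ∷ vs) (weigh x (w ∷ vs) (e ∷ es) wt) κ ≡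
    ∑ (allFin N) (λ c → x c ^ℚ wt w) * ∑κ vs (weigh x vs es wt) κ - ∑κ vs (weigh x vs es (merge wt u w)) κ
∑κ-weigh-leaf {n} {N} {vs} {es} {u} {w} {e} T u∈ w∉ j x wt κ = begin
  ∑ (allFin N) (λ c → ∑κ vs (weigh x (w ∷ vs) (e ∷ es) wt) (κ [ w ↦ c ]))
    ≡⟨ ∑-cong (allFin N) (λ c → trans (∑κ-cong vs (κ [ w ↦ c ]) (unfold c)) (∑κ-base vs (G-local c) _ _ (λ v v∈ v∉ → ⊥-elim (v∉ v∈)))) ⟩
  ∑ (allFin N) (λ c → ∑κ vs (G c) κ)
    ≡⟨ ∑κ-∑ vs (allFin N) G κ ⟩
  ∑κ vs (λ κ′ → ∑ (allFin N) (λ c → G c κ′)) κ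
    ≡⟨ ∑κ-cong vs κ (λ κ′ _ → sum-G κ′) ⟩
  ∑κ vs (λ κ′ → P * weigh x vs es wt κ′ - weigh x vs es (merge wt u w) κ′) κ
    ≡⟨ ∑κ-- vs _ _ κ ⟩
  ∑κ vs (λ κ′ → P * weigh x vs es wt κ′) κ - ∑κ vs (weigh x vs es (merge wt u w)) κ
    ≡⟨ cong (_- ∑κ vs (weigh x vs es (merge wt u w)) κ) (∑κ-*ˡ vs P _ κ) ⟩
  P * ∑κ vs (weigh x vs es wt) κ - ∑κ vs (weigh x vs es (merge wt u w)) κ ∎
  where
  open ≡-Reasoning
  P : ℚ
  P = ∑ (allFin N) (λ c → x c ^ℚ wt w)
  G : Fin N → Colouring n N → ℚ
  G c κ′ = x c ^ℚ wt w * (1ℚ - 𝟙 (κ′ u =ᶠ c)) * weigh x vs es wt κ′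
  G-local : ∀ c → DependsOn (_∈ vs) (G c)
  G-local c κ₁ κ₂ eq = cong₂ _*_ (cong (λ d → x c ^ℚ wt w * (1ℚ - 𝟙 (d =ᶠ c))) (eq u u∈)) (weigh-local T x wt κ₁ κ₂ eq)
  lem₁ : ∀ a b c d → a * b * (c * d) ≡ a * c * (b * d)
  lem₁ = solve-∀ ℚ-ring
  unfold : ∀ c κ′ → (∀ v → v ∉ vs → κ′ v ≡ (κ [ w ↦ c ]) v) → weigh x (w ∷ vs) (e ∷ es) wt κ′ ≡ G c κ′
  unfold c κ′ eq = trans (lem₁ (x (κ′ w) ^ℚ wt w) _ _ _)
    (cong (_* weigh x vs es wt κ′) (cong₂ _*_ (cong (λ d → x d ^ℚ wt w) w↦c) (cong (_-_ 1ℚ) (monochromatic-joins j κ′ w↦c))))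
    where
    w↦c : κ′ w ≡ c
    w↦c = trans (eq w w∉) ([↦]-same κ w c)
  lem₂ : ∀ a b z → a * (1ℚ - b) * z ≡ a * z - b * (a * z)
  lem₂ = solve-∀ ℚ-ring
  sum-G : ∀ κ′ → ∑ (allFin N) (λ c → G c κ′) ≡ P * weigh x vs es wt κ′ - weigh x vs es (merge wt u w) κ′
  sum-G κ′ = begin
    ∑ (allFin N) (λ c → G c κ′)
      ≡⟨ ∑-cong (allFin N) (λ c → lem₂ (x c ^ℚ wt w) (𝟙 (κ′ u =ᶠ c)) (weigh x vs es wt κ′)) ⟩
    ∑ (allFin N) (λ c → x c ^ℚ wt w * Z - 𝟙 (κ′ u =ᶠ c) * (x c ^ℚ wt w * Z))
      ≡⟨ ∑-- (allFin N) _ _ ⟩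
    ∑ (allFin N) (λ c → x c ^ℚ wt w * Z) - ∑ (allFin N) (λ c → 𝟙 (κ′ u =ᶠ c) * (x c ^ℚ wt w * Z))
      ≡⟨ cong₂ _-_ (∑-*ʳ Z (allFin N) _) (∑-select Fin._≟_ (allFin N) (Uniqueₚ.allFin⁺ N) (κ′ u) (∈-allFin (κ′ u)) _) ⟩
    P * Z - x (κ′ u) ^ℚ wt w * Z
      ≡⟨ cong (_-_ (P * Z)) (sym (trans (cong (_* ∏ es _) (∏-merge x vs (growth-unique-vertices T) wt u w u∈ κ′)) (ℚₚ.*-assoc (x (κ′ u) ^ℚ wt w) _ _))) ⟩
    P * Z - weigh x vs es (merge wt u w) κ′ ∎
    where
    Z : ℚ
    Z = weigh x vs es wt κ′

stanley : ∀ {vs} {es : List (Edge n)} (T : Growth vs es) (x : Fin N → ℚ) (wt : Fin n → ℕ) (κ : Colouring n N) →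
  ∑κ vs (weigh x vs es wt) κ ≡ ∑ (terms T wt) (λ (f , h , τ) → neg1^ f * p∏ x τ)
stanley {N = N} (root r) x wt κ = begin
  ∑ (allFin N) (λ c → x ((κ [ r ↦ c ]) r) ^ℚ wt r * 1ℚ * 1ℚ)
    ≡⟨ ∑-cong (allFin N) (λ c → trans (ℚₚ.*-identityʳ _) (trans (ℚₚ.*-identityʳ _) (cong (λ d → x d ^ℚ wt r) ([↦]-same κ r c)))) ⟩
  ∑ (allFin N) (λ c → x c ^ℚ wt r)
    ≡⟨ lem _ ⟩
  1ℚ * (∑ (allFin N) (λ c → x c ^ℚ wt r) * 1ℚ) + 0ℚ ∎
  where
  open ≡-Reasoning
  lem : ∀ a → a ≡ 1ℚ * (a * 1ℚ) + 0ℚ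
  lem = solve-∀ ℚ-ring
stanley {N = N} (leaf {vs} {es} {u} {w} {e} T u∈ w∉ j) x wt κ = begin
  ∑κ (w ∷ vs) (weigh x (w ∷ vs) (e ∷ es) wt) κ
    ≡⟨ ∑κ-weigh-leaf T u∈ w∉ j x wt κ ⟩
  P * ∑κ vs (weigh x vs es wt) κ - ∑κ vs (weigh x vs es (merge wt u w)) κ
    ≡⟨ cong₂ (λ a b → P * a - b) (stanley T x wt κ) (stanley T x (merge wt u w) κ) ⟩
  P * ∑ L₁ (λ (f , h , τ) → neg1^ f * p∏ x τ) - ∑ L₂ (λ (f , h , τ) → neg1^ f * p∏ x τ)
    ≡⟨ lem₀ P _ _ ⟩
  P * ∑ L₁ (λ (f , h , τ) → neg1^ f * p∏ x τ) + (- 1ℚ) * ∑ L₂ (λ (f , h , τ) → neg1^ f * p∏ x τ)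
    ≡⟨ cong₂ _+_ (sym (∑-*ˡ P L₁ _)) (sym (∑-*ˡ (- 1ℚ) L₂ _)) ⟩
  ∑ L₁ (λ (f , h , τ) → P * (neg1^ f * p∏ x τ)) + ∑ L₂ (λ (f , h , τ) → (- 1ℚ) * (neg1^ f * p∏ x τ))
    ≡⟨ cong₂ _+_ (∑-cong L₁ (λ (f , h , τ) → lem₁ P (neg1^ f) (p∏ x τ))) (∑-cong L₂ (λ (f , h , τ) → lem₂ (neg1^ f) (p∏ x τ))) ⟩
  ∑ L₁ (λ (f , h , τ) → neg1^ f * p∏ x (wt w ∷ τ)) + ∑ L₂ (λ (f , h , τ) → neg1^ (suc f) * p∏ x τ)
    ≡⟨ sym (cong₂ _+_ (∑-map _ L₁ _) (∑-map _ L₂ _)) ⟩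
  _
    ≡⟨ sym (∑-++ (map (λ (f , h , τ) → f , suc h , wt w ∷ τ) L₁) _ _) ⟩
  ∑ (terms (leaf T u∈ w∉ j) wt) (λ (f , h , τ) → neg1^ f * p∏ x τ) ∎
  where
  open ≡-Reasoning
  P : ℚ
  P = ∑ (allFin N) (λ c → x c ^ℚ wt w)
  L₁ L₂ : List (ℕ × ℕ × List ℕ)
  L₁ = terms T wt
  L₂ = terms T (merge wt u w)
  lem₀ : ∀ a b c → a * b - c ≡ a * b + (- 1ℚ) * c
  lem₀ = solve-∀ ℚ-ring
  lem₁ : ∀ a b c → a * (b * c) ≡ b * (a * c)
  lem₁ = solve-∀ ℚ-ring
  lem₂ : ∀ a b → (- 1ℚ) * (a * b) ≡ (- a) * b
  lem₂ = solve-∀ ℚ-ring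

∏-↭ : {xs ys : List A} → xs ↭ ys → (f : A → ℚ) → ∏ xs f ≡ ∏ ys f
∏-↭ ↭.refl        f = refl
∏-↭ (↭.prep x p)  f = cong (f x *_) (∏-↭ p f)
∏-↭ (↭.trans p q) f = trans (∏-↭ p f) (∏-↭ q f)
∏-↭ {xs = _ ∷ _ ∷ xs} (↭.swap x y p) f = trans (lem (f x) (f y) (∏ xs f)) (cong (λ a → f y * (f x * a)) (∏-↭ p f))
  where
  lem : ∀ a b c → a * (b * c) ≡ b * (a * c)
  lem = solve-∀ ℚ-ring

weigh-↭ : {vs vs′ : List (Fin n)} {es es′ : List (Edge n)} → vs ↭ vs′ → es ↭ es′ →
  (x : Fin N → ℚ) (wt : Fin n → ℕ) (κ : Colouring n N) → weigh x vs es wt κ ≡ weigh x vs′ es′ wt κ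
weigh-↭ p q x wt κ = cong₂ _*_ (∏-↭ p _) (∏-↭ q _)

weigh-ext : {vs : List (Fin n)} {es : List (Edge n)} (x : Fin N → ℚ) (wt : Fin n → ℕ) →
  DependsOn everywhere (weigh x vs es wt)
weigh-ext {vs = vs} {es} x wt κ κ′ eq = cong₂ _*_
  (∏-cong-∈ vs λ v _ → cong (λ c → x c ^ℚ wt v) (eq v refl))
  (∏-cong-∈ es λ e _ → cong (λ b → 1ℚ - 𝟙 b) (cong₂ _=ᶠ_ (eq _ refl) (eq _ refl)))

𝟙-properᵇ : (E : List (Edge n)) (κ : Vec (Fin N) n) →
  𝟙 (properᵇ E κ) ≡ ∏ E (λ e → 1ℚ - monochromatic (lookup κ) e)
𝟙-properᵇ []      κ = refl
𝟙-properᵇ (e ∷ E) κ with lookup κ (proj₁ e) =ᶠ lookup κ (proj₂ e)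
... | true  = sym (ℚₚ.*-zeroˡ (∏ E (λ e′ → 1ℚ - monochromatic (lookup κ) e′)))
... | false = trans (𝟙-properᵇ E κ) (sym (ℚₚ.*-identityˡ _))

chromEval-∑ : (E : List (Edge n)) (x : Fin N → ℚ) →
  chromEval E N x ≡ ∑ (allMaps n N) (weigh x (allFin n) E (λ _ → 1) ∘ lookup)
chromEval-∑ {n} {N} E x = begin
  chromEval E N x
    ≡⟨ sumℚ-map (filterᵇ (properᵇ E) (allMaps n N)) _ ⟩
  ∑ (filterᵇ (properᵇ E) (allMaps n N)) (λ κ → prodℚ (map (λ v → x (lookup κ v)) (allFin n)))
    ≡⟨ ∑-filterᵇ (properᵇ E) (allMaps n N) _ ⟩
  ∑ (allMaps n N) (λ κ → 𝟙 (properᵇ E κ) * prodℚ (map (λ v → x (lookup κ v)) (allFin n)))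
    ≡⟨ ∑-cong (allMaps n N) (λ κ → trans (ℚₚ.*-comm (𝟙 (properᵇ E κ)) _)
         (cong₂ _*_ (trans (prodℚ-map (allFin n) _) (∏-cong-∈ (allFin n) λ v _ → sym (ℚₚ.*-identityʳ _))) (𝟙-properᵇ E κ))) ⟩
  ∑ (allMaps n N) (weigh x (allFin n) E (λ _ → 1) ∘ lookup) ∎
  where open ≡-Reasoning

-- Without colours there is no base colouring for `stanley`, so N = 0 is treated apart: every τ in
-- `terms` is nonempty, and power sums in no variables vanish.
terms-no-colours : ∀ {vs} {es : List (Edge n)} (T : Growth vs es) (x : Fin 0 → ℚ) (wt : Fin n → ℕ) →
  ∑ (terms T wt) (λ (f , h , τ) → neg1^ f * p∏ x τ) ≡ 0ℚ
terms-no-colours T x wt = trans (∑-cong-∈ (terms T wt) (vanishing T wt)) (∑-zero (terms T wt))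
  where
  vanishing : ∀ {vs es} (T : Growth vs es) wt t → t ∈ terms T wt → neg1^ (proj₁ t) * p∏ x (proj₂ (proj₂ t)) ≡ 0ℚ
  vanishing (root r) wt t (here refl) = refl
  vanishing (leaf {u = u} {w} T u∈ w∉ j) wt t t∈ with ∈-++⁻ (map _ (terms T wt)) t∈
  ... | inj₁ t∈₁ with ∈-map⁻ _ t∈₁
  ...   | (f , h , τ) , _ , refl = trans (cong (neg1^ f *_) (ℚₚ.*-zeroˡ (p∏ x τ))) (ℚₚ.*-zeroʳ (neg1^ f))
  vanishing (leaf {u = u} {w} T u∈ w∉ j) wt t t∈ | inj₂ t∈₂ with ∈-map⁻ _ t∈₂
  ...   | (f , h , τ) , s∈ , refl = trans (sym (ℚₚ.neg-distribˡ-* (neg1^ f) (p∏ x τ))) (cong -_ (vanishing T (merge wt u w) _ s∈))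

chromEval-terms : ∀ {vs} {es E : List (Edge n)} (T : Growth vs es) → 1 ≤ n →
  vs ↭ allFin n → es ↭ E → ∀ N (x : Fin N → ℚ) →
  chromEval E N x ≡ ∑ (terms T (λ _ → 1)) (λ (f , h , τ) → neg1^ f * p∏ x τ)
chromEval-terms T (s≤s _) vs↭ es↭ zero x = sym (terms-no-colours T x _)
chromEval-terms {n} {vs} {es} {E} T 1≤n vs↭ es↭ N@(suc _) x = begin
  chromEval E N x
    ≡⟨ chromEval-∑ E x ⟩
  ∑ (allMaps n N) (weigh x (allFin n) E (λ _ → 1) ∘ lookup)
    ≡⟨ ∑-allMaps n (weigh-ext {vs = allFin n} {E} x (λ _ → 1)) (λ _ → zero) ⟩
  ∑κ (allFin n) (weigh x (allFin n) E (λ _ → 1)) (λ _ → zero)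
    ≡⟨ ∑κ-↭ (weigh-ext {vs = allFin n} {E} x (λ _ → 1)) (↭-sym vs↭) (λ _ → zero) ⟩
  ∑κ vs (weigh x (allFin n) E (λ _ → 1)) (λ _ → zero)
    ≡⟨ ∑κ-cong vs (λ _ → zero) (λ κ _ → weigh-↭ (↭-sym vs↭) (↭-sym es↭) x (λ _ → 1) κ) ⟩
  ∑κ vs (weigh x vs es (λ _ → 1)) (λ _ → zero)
    ≡⟨ stanley T x _ _ ⟩
  ∑ (terms T (λ _ → 1)) (λ (f , h , τ) → neg1^ f * p∏ x τ) ∎
  where open ≡-Reasoning

-- Linear relations between power sum products

∑-allFin-suc : (f : Fin (suc N) → ℚ) → ∑ (allFin (suc N)) f ≡ f zero + ∑ (allFin N) (f ∘ suc)
∑-allFin-suc {N} f = cong (f zero +_)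
  (trans (cong (λ cs → ∑ cs f) (sym (Listₚ.map-tabulate id suc))) (∑-map suc (allFin N) f))

twoValued : ∀ M m → ℚ → Fin (M ℕ.+ m) → ℚ
twoValued zero    m y c       = y
twoValued (suc M) m y zero    = 1ℚ
twoValued (suc M) m y (suc c) = twoValued M m y c

∑-const : ∀ N a → ∑ (allFin N) (λ _ → a) ≡ ℕ→ℚ N * a
∑-const zero    a = sym (ℚₚ.*-zeroˡ a)
∑-const (suc N) a = trans (∑-allFin-suc {N} (λ _ → a)) (trans (cong (a +_) (∑-const N a))
  (trans (lem a (ℕ→ℚ N)) (cong (_* a) (sym (ℕ→ℚ-+ 1 N)))))
  where
  lem : ∀ a b → a + b * a ≡ (1ℚ + b) * a
  lem = solve-∀ ℚ-ring

p-twoValued : ∀ M m y k →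
  ∑ (allFin (M ℕ.+ m)) (λ c → twoValued M m y c ^ℚ k) ≡ ℕ→ℚ M + ℕ→ℚ m * y ^ℚ k
p-twoValued zero    m y k = trans (∑-const m (y ^ℚ k)) (sym (ℚₚ.+-identityˡ _))
p-twoValued (suc M) m y k = trans (∑-allFin-suc {M ℕ.+ m} (λ c → twoValued (suc M) m y c ^ℚ k))
  (trans (cong₂ _+_ (1^ℚ k) (p-twoValued M m y k))
    (trans (sym (ℚₚ.+-assoc 1ℚ (ℕ→ℚ M) _)) (cong (_+ ℕ→ℚ m * y ^ℚ k) (sym (ℕ→ℚ-+ 1 M)))))

-- The exponents of the monomials of ∏ (M + m y^k) over k in τ, as a polynomial in M, m and y.
monomials : List ℕ → List (ℕ × ℕ × ℕ)
monomials []      = [ 0 , 0 , 0 ]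
monomials (k ∷ τ) = map (λ (α , β , γ) → suc α , β , γ) (monomials τ) ++
                    map (λ (α , β , γ) → α , suc β , k ℕ.+ γ) (monomials τ)

∑-monomials-∷ : ∀ k τ (F : ℕ × ℕ × ℕ → ℚ) → ∑ (monomials (k ∷ τ)) F ≡
  ∑ (monomials τ) (λ (α , β , γ) → F (suc α , β , γ)) + ∑ (monomials τ) (λ (α , β , γ) → F (α , suc β , k ℕ.+ γ))
∑-monomials-∷ k τ F = trans (∑-++ (map _ (monomials τ)) _ F)
  (cong₂ _+_ (∑-map _ (monomials τ) F) (∑-map _ (monomials τ) F))

∑-monomials : ∀ M m y τ →
  ∑ (monomials τ) (λ (α , β , γ) → M ^ℚ α * (m ^ℚ β * y ^ℚ γ)) ≡ ∏ τ (λ k → M + m * y ^ℚ k)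
∑-monomials M m y []      = refl
∑-monomials M m y (k ∷ τ) = begin
  _
    ≡⟨ ∑-monomials-∷ k τ _ ⟩
  ∑ (monomials τ) (λ (α , β , γ) → M * M ^ℚ α * (m ^ℚ β * y ^ℚ γ)) +
  ∑ (monomials τ) (λ (α , β , γ) → M ^ℚ α * (m * m ^ℚ β * y ^ℚ (k ℕ.+ γ)))
    ≡⟨ cong₂ _+_ (∑-cong (monomials τ) (λ (α , β , γ) → ℚₚ.*-assoc M (M ^ℚ α) _))
         (∑-cong (monomials τ) (λ (α , β , γ) → trans (cong (λ a → M ^ℚ α * (m * m ^ℚ β * a)) (^ℚ-+ y k γ)) (lem₁ (M ^ℚ α) m _ _ _))) ⟩
  ∑ (monomials τ) (λ (α , β , γ) → M * (M ^ℚ α * (m ^ℚ β * y ^ℚ γ))) +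
  ∑ (monomials τ) (λ (α , β , γ) → m * y ^ℚ k * (M ^ℚ α * (m ^ℚ β * y ^ℚ γ)))
    ≡⟨ cong₂ _+_ (∑-*ˡ M (monomials τ) _) (∑-*ˡ (m * y ^ℚ k) (monomials τ) _) ⟩
  M * S + m * y ^ℚ k * S
    ≡⟨ sym (ℚₚ.*-distribʳ-+ S M (m * y ^ℚ k)) ⟩
  (M + m * y ^ℚ k) * S
    ≡⟨ cong (_*_ (M + m * y ^ℚ k)) (∑-monomials M m y τ) ⟩
  ∏ (k ∷ τ) (λ k → M + m * y ^ℚ k) ∎
  where
  open ≡-Reasoning
  S : ℚ
  S = ∑ (monomials τ) (λ (α , β , γ) → M ^ℚ α * (m ^ℚ β * y ^ℚ γ))
  lem₁ : ∀ a m b c d → a * (m * b * (c * d)) ≡ m * c * (a * (b * d))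
  lem₁ = solve-∀ ℚ-ring

-- Applied to exponents, `δ m` is the functional that reads off the coefficient of the m-th power.
δ : ℕ → ℕ → ℚ
δ m k = 𝟙 (m ℕ.≡ᵇ k)

∑-monomials-m⁰ : ∀ (g₁ g₃ : ℕ → ℚ) τ →
  ∑ (monomials τ) (λ (α , β , γ) → g₁ α * (δ 0 β * g₃ γ)) ≡ g₁ (length τ) * g₃ 0
∑-monomials-m⁰ g₁ g₃ []      = lem (g₁ 0) (g₃ 0)
  where
  lem : ∀ a b → a * (1ℚ * b) + 0ℚ ≡ a * b
  lem = solve-∀ ℚ-ring
∑-monomials-m⁰ g₁ g₃ (k ∷ τ) = trans (∑-monomials-∷ k τ _)
  (trans (cong₂ _+_ (∑-monomials-m⁰ (g₁ ∘ suc) g₃ τ)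
     (trans (∑-cong (monomials τ) λ (α , β , γ) → lem (g₁ α) (g₃ (k ℕ.+ γ))) (∑-zero (monomials τ))))
    (ℚₚ.+-identityʳ _))
  where
  lem : ∀ a b → a * (0ℚ * b) ≡ 0ℚ
  lem = solve-∀ ℚ-ring

-- A monomial of degree 1 in m takes m y^k from one factor and M from each of the others. This is
-- where ℓ - 1 and the sum over the parts come from. For empty τ the truncated ℓ - 1 is harmless, as
-- the sum over the parts is 0.
∑-monomials-m¹ : ∀ (g₁ g₃ : ℕ → ℚ) τ →
  ∑ (monomials τ) (λ (α , β , γ) → g₁ α * (δ 1 β * g₃ γ)) ≡ g₁ (length τ ℕ.∸ 1) * ∑ τ g₃
∑-monomials-m¹ g₁ g₃ []      = lem (g₁ 0) (g₃ 0)
  where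
  lem : ∀ a b → a * (0ℚ * b) + 0ℚ ≡ a * 0ℚ
  lem = solve-∀ ℚ-ring
∑-monomials-m¹ g₁ g₃ (k ∷ τ) = begin
  _
    ≡⟨ ∑-monomials-∷ k τ _ ⟩
  ∑ (monomials τ) (λ (α , β , γ) → g₁ (suc α) * (δ 1 β * g₃ γ)) +
  ∑ (monomials τ) (λ (α , β , γ) → g₁ α * (δ 0 β * g₃ (k ℕ.+ γ)))
    ≡⟨ cong₂ _+_ (trans (∑-monomials-m¹ (g₁ ∘ suc) g₃ τ) (shift τ)) (∑-monomials-m⁰ g₁ (λ γ → g₃ (k ℕ.+ γ)) τ) ⟩
  g₁ (length τ) * ∑ τ g₃ + g₁ (length τ) * g₃ (k ℕ.+ 0)
    ≡⟨ trans (cong (λ j → g₁ (length τ) * ∑ τ g₃ + g₁ (length τ) * g₃ j) (ℕₚ.+-identityʳ k)) (lem (g₁ (length τ)) _ _) ⟩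
  g₁ (length τ) * (g₃ k + ∑ τ g₃) ∎
  where
  open ≡-Reasoning
  lem : ∀ a b c → a * b + a * c ≡ a * (c + b)
  lem = solve-∀ ℚ-ring
  shift : ∀ τ → g₁ (suc (length τ ℕ.∸ 1)) * ∑ τ g₃ ≡ g₁ (length τ) * ∑ τ g₃
  shift []      = trans (ℚₚ.*-zeroʳ (g₁ 1)) (sym (ℚₚ.*-zeroʳ (g₁ 0)))
  shift (_ ∷ _) = refl

-- Evaluating p_k at M ones and m copies of y gives M + m y^k; compare the coefficients of m.
p∏-relation : (X : List (ℚ × List ℕ)) → (∀ N (x : Fin N → ℚ) → ∑ X (λ (d , τ) → d * p∏ x τ) ≡ 0ℚ) →
  ∀ (g₁ g₃ : ℕ → ℚ) → ∑ X (λ (d , τ) → d * (g₁ (length τ ℕ.∸ 1) * ∑ τ g₃)) ≡ 0ℚ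
p∏-relation X vanish g₁ g₃ = begin
  ∑ X (λ (d , τ) → d * (g₁ (length τ ℕ.∸ 1) * ∑ τ g₃))
    ≡⟨ ∑-cong X (λ (d , τ) → cong (d *_) (sym (∑-monomials-m¹ g₁ g₃ τ))) ⟩
  ∑ X (λ (d , τ) → d * ∑ (monomials τ) (λ (α , β , γ) → g₁ α * (δ 1 β * g₃ γ)))
    ≡⟨ sym (expand _) ⟩
  ∑ L (λ (d , α , β , γ) → d * (g₁ α * (δ 1 β * g₃ γ)))
    ≡⟨ ∑-cong L (λ (d , α , β , γ) → lem₃ d (g₁ α) (δ 1 β) (g₃ γ)) ⟩
  ∑ L (λ (d , α , β , γ) → d * (g₁ α * δ 1 β) * g₃ γ)
    ≡⟨ extract L (λ (d , α , β , γ) → γ) (λ (d , α , β , γ) → d * (g₁ α * δ 1 β)) vanish₂ g₃ ⟩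
  0ℚ ∎
  where
  open ≡-Reasoning
  L : List (ℚ × ℕ × ℕ × ℕ)
  L = concatMap (λ (d , τ) → map (d ,_) (monomials τ)) X
  expand : ∀ (F : ℕ × ℕ × ℕ → ℚ) → ∑ L (λ (d , μ) → d * F μ) ≡ ∑ X (λ (d , τ) → d * ∑ (monomials τ) F)
  expand F = trans (∑-concatMap _ X _) (∑-cong X λ (d , τ) → trans (∑-map (d ,_) (monomials τ) _) (∑-*ˡ d (monomials τ) F))
  lem₁ : ∀ d a b c → d * (b * c) * a ≡ d * (a * (b * c))
  lem₁ = solve-∀ ℚ-ring
  lem₂ : ∀ d a b c → d * (c * a) * b ≡ d * (b * c) * a
  lem₂ = solve-∀ ℚ-ring
  lem₃ : ∀ d a b c → d * (a * (b * c)) ≡ d * (a * b) * c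
  lem₃ = solve-∀ ℚ-ring
  lem₄ : ∀ d a b c → d * (a * b) * c ≡ d * (c * a) * b
  lem₄ = solve-∀ ℚ-ring
  -- The variables are traded for functionals one at a time: M for `g₁`, then m for `δ 1`, and
  -- finally y for `g₃`.
  vanish₀ : ∀ M m y → ∑ L (λ (d , α , β , γ) → d * (ℕ→ℚ m ^ℚ β * ℕ→ℚ y ^ℚ γ) * ℕ→ℚ M ^ℚ α) ≡ 0ℚ
  vanish₀ M m y = begin
    _ ≡⟨ ∑-cong L (λ (d , α , β , γ) → lem₁ d (ℕ→ℚ M ^ℚ α) (ℕ→ℚ m ^ℚ β) (ℕ→ℚ y ^ℚ γ)) ⟩
    _ ≡⟨ expand (λ (α , β , γ) → ℕ→ℚ M ^ℚ α * (ℕ→ℚ m ^ℚ β * ℕ→ℚ y ^ℚ γ)) ⟩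
    _ ≡⟨ ∑-cong X (λ (d , τ) → cong (d *_) (trans (∑-monomials (ℕ→ℚ M) (ℕ→ℚ m) (ℕ→ℚ y) τ)
           (∏-cong-∈ τ λ k _ → sym (p-twoValued M m (ℕ→ℚ y) k)))) ⟩
    ∑ X (λ (d , τ) → d * p∏ (twoValued M m (ℕ→ℚ y)) τ) ≡⟨ vanish (M ℕ.+ m) (twoValued M m (ℕ→ℚ y)) ⟩
    0ℚ ∎
  vanish₁ : ∀ m y → ∑ L (λ (d , α , β , γ) → d * (ℕ→ℚ y ^ℚ γ * g₁ α) * ℕ→ℚ m ^ℚ β) ≡ 0ℚ
  vanish₁ m y = trans (∑-cong L λ (d , α , β , γ) → lem₂ d (g₁ α) (ℕ→ℚ m ^ℚ β) (ℕ→ℚ y ^ℚ γ))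
    (extract L (λ (d , α , β , γ) → α) (λ (d , α , β , γ) → d * (ℕ→ℚ m ^ℚ β * ℕ→ℚ y ^ℚ γ)) (λ M → vanish₀ M m y) g₁)
  vanish₂ : ∀ y → ∑ L (λ (d , α , β , γ) → d * (g₁ α * δ 1 β) * ℕ→ℚ y ^ℚ γ) ≡ 0ℚ
  vanish₂ y = trans (∑-cong L λ (d , α , β , γ) → lem₄ d (g₁ α) (δ 1 β) (ℕ→ℚ y ^ℚ γ))
    (extract L (λ (d , α , β , γ) → β) (λ (d , α , β , γ) → d * (ℕ→ℚ y ^ℚ γ * g₁ α)) (λ m → vanish₁ m y) (δ 1))

pλEval-p∏ : ∀ N (x : Fin N → ℚ) τ → pλEval N x τ ≡ p∏ x τ
pλEval-p∏ N x τ = trans (prodℚ-map τ (pEval N x)) (∏-cong-∈ τ λ k _ → sumℚ-map (allFin N) _)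

-- Both c and Stanley's signs expand the same function, so their difference is a linear relation
-- between power sum products, to which `p∏-relation` applies. The lists τ of `terms` may stay
-- unsorted, because the functional does not see the order of the parts.
expansion-functional : ∀ {vs} {es E : List (Edge n)} (T : Growth vs es) → 1 ≤ n →
  vs ↭ allFin n → es ↭ E → (c : List ℕ → ℚ) → IsPowerSumExpansion n E c → (g₁ g₃ : ℕ → ℚ) →
  ∑ (partitions n) (λ τ → c τ * (g₁ (length τ ℕ.∸ 1) * ∑ τ g₃)) ≡
  ∑ (terms T (λ _ → 1)) (λ (f , h , τ) → neg1^ f * (g₁ (length τ ℕ.∸ 1) * ∑ τ g₃))
expansion-functional {n} {E = E} T 1≤n vs↭ es↭ c expansion g₁ g₃ =
  x-y≡0⇒x≡y _ _ (trans (sym (combine λ τ → g₁ (length τ ℕ.∸ 1) * ∑ τ g₃)) (p∏-relation X vanish g₁ g₃))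
  where
  open ≡-Reasoning
  Tₛ : List (ℕ × ℕ × List ℕ)
  Tₛ = terms T (λ _ → 1)
  X : List (ℚ × List ℕ)
  X = map (λ τ → c τ , τ) (partitions n) ++ map (λ (f , h , τ) → - neg1^ f , τ) Tₛ
  lem : ∀ a b → (- a) * b ≡ (- 1ℚ) * (a * b)
  lem = solve-∀ ℚ-ring
  lem′ : ∀ a b → a + (- 1ℚ) * b ≡ a - b
  lem′ = solve-∀ ℚ-ring
  combine : ∀ (F : List ℕ → ℚ) → ∑ X (λ (d , τ) → d * F τ) ≡
    ∑ (partitions n) (λ τ → c τ * F τ) - ∑ Tₛ (λ (f , h , τ) → neg1^ f * F τ)
  combine F = begin
    ∑ X (λ (d , τ) → d * F τ)
      ≡⟨ ∑-++ (map (λ τ → c τ , τ) (partitions n)) _ _ ⟩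
    _ ≡⟨ cong₂ _+_ (∑-map _ (partitions n) _) (∑-map _ Tₛ _) ⟩
    ∑ (partitions n) (λ τ → c τ * F τ) + ∑ Tₛ (λ (f , h , τ) → (- neg1^ f) * F τ)
      ≡⟨ cong (∑ (partitions n) (λ τ → c τ * F τ) +_) (trans (∑-cong Tₛ λ (f , h , τ) → lem (neg1^ f) (F τ)) (∑-*ˡ (- 1ℚ) Tₛ _)) ⟩
    _ ≡⟨ lem′ (∑ (partitions n) (λ τ → c τ * F τ)) _ ⟩
    ∑ (partitions n) (λ τ → c τ * F τ) - ∑ Tₛ (λ (f , h , τ) → neg1^ f * F τ) ∎
  vanish : ∀ N (x : Fin N → ℚ) → ∑ X (λ (d , τ) → d * p∏ x τ) ≡ 0ℚ
  vanish N x = begin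
    ∑ X (λ (d , τ) → d * p∏ x τ)
      ≡⟨ combine (p∏ x) ⟩
    ∑ (partitions n) (λ τ → c τ * p∏ x τ) - ∑ Tₛ (λ (f , h , τ) → neg1^ f * p∏ x τ)
      ≡⟨ cong₂ _-_ (trans (∑-cong (partitions n) λ τ → cong (c τ *_) (sym (pλEval-p∏ N x τ))) (sym (trans (expansion N x) (sumℚ-map (partitions n) _))))
           (sym (chromEval-terms T 1≤n vs↭ es↭ N x)) ⟩
    chromEval E N x - chromEval E N x
      ≡⟨ ℚₚ.+-inverseʳ (chromEval E N x) ⟩
    0ℚ ∎

-- Growing a tree along its walks

_≟ᵉ_ : (e f : Edge n) → Dec (e ≡ f)
_≟ᵉ_ = ≡-dec Fin._≟_ Fin._≟_

_∈ᵛ?_ : (v : Fin n) (vs : List (Fin n)) → Dec (v ∈ vs)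
_∈ᵛ?_ = DecMembership._∈?_ Fin._≟_

_∈ᵉ?_ : (e : Edge n) (es : List (Edge n)) → Dec (e ∈ es)
_∈ᵉ?_ = DecMembership._∈?_ _≟ᵉ_

⊆-trans : {xs ys zs : List A} → xs ⊆ ys → ys ⊆ zs → xs ⊆ zs
⊆-trans xs⊆ ys⊆ = All.map (All.lookup ys⊆) xs⊆

⊆-there : {xs ys : List A} {y : A} → xs ⊆ ys → xs ⊆ (y ∷ ys)
⊆-there = All.map there

⊆-refl : {xs : List A} → xs ⊆ xs
⊆-refl = All.tabulate id

adj-mono : {S S′ : List (Edge n)} → S ⊆ S′ → ∀ {u v} → Adj S u v → Adj S′ u v
adj-mono S⊆ (inj₁ e∈) = inj₁ (All.lookup S⊆ e∈)
adj-mono S⊆ (inj₂ e∈) = inj₂ (All.lookup S⊆ e∈)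

adj-sym : {S : List (Edge n)} → ∀ {u v} → Adj S u v → Adj S v u
adj-sym (inj₁ e∈) = inj₂ e∈
adj-sym (inj₂ e∈) = inj₁ e∈

joins⇒adj : {es : List (Edge n)} → ∀ {e u w} → Joins e u w → e ∈ es → Adj es u w
joins⇒adj (inj₁ refl) e∈ = inj₁ e∈
joins⇒adj (inj₂ refl) e∈ = inj₂ e∈

adj⇒joins : {es : List (Edge n)} → ∀ {u w} → Adj es u w → ∃ λ e → e ∈ es × Joins e u w
adj⇒joins (inj₁ e∈) = _ , e∈ , inj₁ refl
adj⇒joins (inj₂ e∈) = _ , e∈ , inj₂ refl

growth-unique-edges : ∀ {vs} {es : List (Edge n)} → Growth vs es → Unique es
growth-unique-edges (root r) = []
growth-unique-edges (leaf {es = es} {w = w} {e = e} T u∈ w∉ j) = Allₚ.¬Any⇒All¬ _ (e∉ j) ∷ growth-unique-edges T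
  where
  e∉ : ∀ {u} → Joins e u w → e ∉ es
  e∉ (inj₁ refl) e∈ = w∉ (proj₂ (growth-incident T e e∈))
  e∉ (inj₂ refl) e∈ = w∉ (proj₁ (growth-incident T e e∈))

chain-mono : {S S′ : List (Edge n)} → S ⊆ S′ → ∀ vs → Chain S vs → Chain S′ vs
chain-mono S⊆ []           c       = tt
chain-mono S⊆ (v ∷ [])     c       = tt
chain-mono S⊆ (v ∷ w ∷ vs) (a , c) = adj-mono S⊆ a , chain-mono S⊆ (w ∷ vs) c

chain-snoc : {S : List (Edge n)} → ∀ vs {y z} → Chain S (vs ++ [ y ]) → Adj S y z → Chain S ((vs ++ [ y ]) ++ [ z ])
chain-snoc []           c       a = a , tt
chain-snoc (v ∷ [])     (b , c) a = b , chain-snoc [] c a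
chain-snoc (v ∷ w ∷ vs) (b , c) a = b , chain-snoc (w ∷ vs) c a

cycle-mono : {S S′ : List (Edge n)} → S ⊆ S′ → Cycle S → Cycle S′
cycle-mono S⊆ (v₀ , vs , 2≤ , vs! , c) = v₀ , vs , 2≤ , vs! , chain-mono S⊆ _ c

unique-snoc : {xs : List A} {y : A} → Unique xs → y ∉ xs → Unique (xs ++ [ y ])
unique-snoc xs! y∉ = Uniqueₚ.++⁺ xs! ([] ∷ []) λ { (y∈ , here refl) → y∉ y∈ }

-- The list l holds the inner vertices. The inclusion in `vs` guarantees that a path is not hit by a
-- leaf attached later.
SimplePath : List (Fin n) → List (Edge n) → Fin n → Fin n → Set
SimplePath vs es a b = ∃ λ l → Chain es (a ∷ l ++ [ b ]) × Unique (a ∷ l ++ [ b ]) × (a ∷ l ++ [ b ]) ⊆ vs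

simplePath : ∀ {vs} {es : List (Edge n)} → Growth vs es → ∀ {a b} → a ∈ vs → b ∈ vs → a ≢ b → SimplePath vs es a b
simplePath (root r) (here refl) (here refl) a≢b = ⊥-elim (a≢b refl)
simplePath (leaf T u∈ w∉ j) (here refl) (here refl) a≢b = ⊥-elim (a≢b refl)
simplePath (leaf T u∈ w∉ j) (there a∈) (there b∈) a≢b with simplePath T a∈ b∈ a≢b
... | l , c , l! , l⊆ = l , chain-mono (⊆-there ⊆-refl) _ c , l! , ⊆-there l⊆
simplePath (leaf {u = u} {w} T u∈ w∉ j) {b = b} (here refl) (there b∈) a≢b with u Fin.≟ b
... | yes refl = [] , (adj-sym (joins⇒adj j (here refl)) , tt) , (a≢b ∷ []) ∷ [] ∷ [] , here refl ∷ there b∈ ∷ []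
... | no u≢b with simplePath T u∈ b∈ u≢b
...   | l , c , l! , l⊆ = u ∷ l , (adj-sym (joins⇒adj j (here refl)) , chain-mono (⊆-there ⊆-refl) _ c) ,
        Allₚ.¬Any⇒All¬ _ (w∉ ∘ All.lookup l⊆) ∷ l! , here refl ∷ ⊆-there l⊆
simplePath (leaf {u = u} {w} T u∈ w∉ j) {a} (there a∈) (here refl) a≢b with a Fin.≟ u
... | yes refl = [] , (joins⇒adj j (here refl) , tt) , (a≢b ∷ []) ∷ [] ∷ [] , there a∈ ∷ here refl ∷ []
... | no a≢u with simplePath T a∈ u∈ a≢u
...   | l , c , l! , l⊆ = l ++ [ u ] , chain-snoc (a ∷ l) (chain-mono (⊆-there ⊆-refl) (a ∷ l ++ [ u ]) c) (joins⇒adj j (here refl)) ,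
        unique-snoc l! (w∉ ∘ All.lookup l⊆) , Allₚ.++⁺ (⊆-there l⊆) (here refl ∷ [])

module _ {E : List (Edge n)} where

  GrowthIn : List (Fin n) → Set
  GrowthIn ts = ∃ λ vs → ∃ λ es → Growth vs es × es ⊆ E × ts ⊆ vs

  -- Each step of the walk either stays among the vertices already reached or attaches a new leaf,
  -- so the growth keeps up with the walk until its end.
  grow-along : ∀ {ts a t} → (G : GrowthIn ts) → a ∈ proj₁ G → Walk E a t → GrowthIn (t ∷ ts)
  grow-along (vs , es , T , es⊆ , ts⊆) a∈ stop = vs , es , T , es⊆ , a∈ ∷ ts⊆
  grow-along (vs , es , T , es⊆ , ts⊆) a∈ (step {w = w} adj walk) with w ∈ᵛ? vs
  ... | yes w∈ = grow-along (vs , es , T , es⊆ , ts⊆) w∈ walk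
  ... | no w∉ with adj⇒joins adj
  ...   | e , e∈ , j = grow-along (w ∷ vs , e ∷ es , leaf T a∈ w∉ j , e∈ ∷ es⊆ , ⊆-there ts⊆) (here refl) walk

  grow-over : (r : Fin n) → (∀ v → Walk E r v) → ∀ ts → GrowthIn (ts ++ [ r ])
  grow-over r walk []       = [ r ] , [] , root r , [] , here refl ∷ []
  grow-over r walk (t ∷ ts) = grow-along G (All.lookup (proj₂ (proj₂ (proj₂ (proj₂ G)))) (∈-++⁺ʳ ts (here refl))) (walk t)
    where
    G : GrowthIn (ts ++ [ r ])
    G = grow-over r walk ts

-- An edge of E outside of a spanning growth would close a cycle.
growth-spans : {E : List (Edge n)} → SimpleEdges E → ¬ Cycle E → ∀ {vs es} → Growth vs es → es ⊆ E →
  (∀ v → v ∈ vs) → E ⊆ es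
growth-spans {n} {E} (ordered , _) acyclic {vs} {es} T es⊆ v∈ = All.tabulate closes
  where
  distinct : ∀ {e} → e ∈ E → proj₁ e ≢ proj₂ e
  distinct e∈ eq = ℕₚ.<⇒≢ (All.lookup ordered e∈) (cong toℕ eq)
  closes : ∀ {e} → e ∈ E → e ∈ es
  closes {a , b} e∈ with simplePath T (v∈ a) (v∈ b) (distinct e∈)
  ... | [] , (inj₁ e∈es , _) , _ = e∈es
  -- A path of one edge might be the reversed pair (b , a), which the ordering of the ends in a
  -- simple edge list excludes.
  ... | [] , (inj₂ e∈es , _) , _ = ⊥-elim (ℕₚ.<-asym (All.lookup ordered e∈) (All.lookup ordered (All.lookup es⊆ e∈es)))
  ... | x ∷ l , c , l! , _ = ⊥-elim (acyclic (a , x ∷ l ++ [ b ] ,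
          s≤s (subst (1 ≤_) (sym (trans (Listₚ.length-++ l) (ℕₚ.+-comm (length l) 1))) (s≤s z≤n)) ,
          l! , chain-snoc (a ∷ x ∷ l) (chain-mono es⊆ _ c) (inj₂ e∈)))

unique-set⇒↭ : {xs ys : List A} → Unique xs → Unique ys → xs ⊆ ys → ys ⊆ xs → xs ↭ ys
unique-set⇒↭ xs! ys! xs⊆ ys⊆ = ∼bag⇒↭ (unique∧set⇒bag xs! ys! (mk⇔ (All.lookup xs⊆) (All.lookup ys⊆)))

tree⇒growth : ∀ {E : List (Edge n)} → 1 ≤ n → IsTree n E →
  ∃ λ vs → ∃ λ es → Growth vs es × vs ↭ allFin n × es ↭ E
tree⇒growth {n = n@(suc _)} _ (simple , connected , acyclic) with grow-over zero (connected zero) (allFin n)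
... | vs , es , T , es⊆ , ts⊆ =
  vs , es , T ,
  unique-set⇒↭ (growth-unique-vertices T) (Uniqueₚ.allFin⁺ n) (All.tabulate λ {v} _ → ∈-allFin v) (All.tabulate λ {v} _ → spanning v) ,
  unique-set⇒↭ (growth-unique-edges T) (proj₂ simple) es⊆ (growth-spans simple acyclic T es⊆ spanning)
  where
  spanning : ∀ v → v ∈ vs
  spanning v = All.lookup ts⊆ (∈-++⁺ˡ (∈-allFin v))

-- Walks

walk-trans : {S : List (Edge n)} → ∀ {a b c} → Walk S a b → Walk S b c → Walk S a c
walk-trans stop       q = q
walk-trans (step a p) q = step a (walk-trans p q)

walk-sym : {S : List (Edge n)} → ∀ {a b} → Walk S a b → Walk S b a
walk-sym stop       = stop
walk-sym (step a p) = walk-trans (walk-sym p) (step (adj-sym a) stop)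

walk-mono : {S S′ : List (Edge n)} → S ⊆ S′ → ∀ {a b} → Walk S a b → Walk S′ a b
walk-mono S⊆ stop       = stop
walk-mono S⊆ (step a p) = step (adj-mono S⊆ a) (walk-mono S⊆ p)

Touches : Fin n → Edge n → Set
Touches p e = p ≡ proj₁ e ⊎ p ≡ proj₂ e

joins-touches : ∀ {e : Edge n} {u w} → Joins e u w → Touches u e × Touches w e
joins-touches (inj₁ refl) = inj₁ refl , inj₂ refl
joins-touches (inj₂ refl) = inj₂ refl , inj₁ refl

touches-joins : ∀ {e : Edge n} {u w x} → Joins e u w → Touches x e → x ≡ u ⊎ x ≡ w
touches-joins (inj₁ refl) t          = t
touches-joins (inj₂ refl) (inj₁ eq) = inj₂ eq
touches-joins (inj₂ refl) (inj₂ eq) = inj₁ eq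

joins-unique : ∀ {e : Edge n} {u w y} → u ≢ w → Joins e u w → Joins e w y → y ≡ u
joins-unique u≢w (inj₁ refl) (inj₁ refl) = ⊥-elim (u≢w refl)
joins-unique u≢w (inj₁ refl) (inj₂ refl) = refl
joins-unique u≢w (inj₂ refl) (inj₁ refl) = refl
joins-unique u≢w (inj₂ refl) (inj₂ refl) = ⊥-elim (u≢w refl)

PendantAt : List (Edge n) → Fin n → Edge n → Set
PendantAt S p e = ∀ f → f ∈ S → Touches p f → f ≡ e

_without_ : List (Edge n) → Edge n → List (Edge n)
S without e = filter (λ f → ¬? (f ≟ᵉ e)) S

∈-without⁺ : {S : List (Edge n)} → ∀ {e f} → f ∈ S → f ≢ e → f ∈ S without e
∈-without⁺ = ∈-filter⁺ _

∈-without⁻ : (S : List (Edge n)) → ∀ {e f} → f ∈ S without e → f ∈ S × f ≢ e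
∈-without⁻ S = ∈-filter⁻ _ {xs = S}

-- A walk can enter p only from u along e, and has to return to u in the same way, so every visit to
-- p can be cut out.
walk-without-pendant : {S : List (Edge n)} → ∀ {e u p} → Joins e u p → u ≢ p → PendantAt S p e →
  ∀ {a b} → a ≢ p → b ≢ p → Walk S a b → Walk (S without e) a b
walk-without-pendant {S = S} {e} {u} {p} j u≢p pendant = avoid
  where
  only : ∀ {y} → Adj S p y → y ≡ u
  only adj with adj⇒joins adj
  ... | f , f∈ , j′ with pendant f f∈ (proj₁ (joins-touches j′))
  ...   | refl = joins-unique u≢p j j′
  keep : ∀ {x y} → Adj S x y → x ≢ p → y ≢ p → Adj (S without e) x y
  keep adj x≢p y≢p with adj⇒joins adj
  ... | f , f∈ , j′ = joins⇒adj j′ (∈-without⁺ f∈ λ { refl →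
          [ x≢p ∘ sym , y≢p ∘ sym ]′ (touches-joins j′ (proj₂ (joins-touches j))) })
  avoid : ∀ {a b} → a ≢ p → b ≢ p → Walk S a b → Walk (S without e) a b
  avoid a≢p b≢p stop = stop
  avoid a≢p b≢p (step {w = c} adj walk) with c Fin.≟ p
  avoid a≢p b≢p (step adj walk) | no c≢p = step (keep adj a≢p c≢p) (avoid c≢p b≢p walk)
  avoid a≢p b≢p (step adj stop) | yes refl = ⊥-elim (b≢p refl)
  avoid a≢p b≢p (step adj (step adj′ walk)) | yes refl with only adj′ | only (adj-sym adj)
  ... | refl | refl = avoid a≢p b≢p walk

first-step : {S : List (Edge n)} → ∀ {a b} → a ≢ b → Walk S a b → ∃ λ f → f ∈ S × Touches a f
first-step a≢b stop = ⊥-elim (a≢b refl)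
first-step a≢b (step adj _) with adj⇒joins adj
... | f , f∈ , j = f , f∈ , proj₁ (joins-touches j)

-- Sublists

∉[] : {x : A} → x ∉ []
∉[] ()

⊆[]⇒≡[] : {xs : List A} → xs ⊆ [] → xs ≡ []
⊆[]⇒≡[] []       = refl
⊆[]⇒≡[] (() ∷ _)

[]∈subs : (xs : List A) → [] ∈ subs xs
[]∈subs []       = here refl
[]∈subs (x ∷ xs) = ∈-++⁺ˡ ([]∈subs xs)

∈subs⇒⊆ : (xs : List A) → ∀ {ys} → ys ∈ subs xs → ys ⊆ xs
∈subs⇒⊆ []       (here refl) = []
∈subs⇒⊆ (x ∷ xs) ys∈ with ∈-++⁻ (subs xs) ys∈
... | inj₁ ys∈₁ = ⊆-there (∈subs⇒⊆ xs ys∈₁)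
... | inj₂ ys∈₂ with ∈-map⁻ (x ∷_) ys∈₂
...   | _ , zs∈ , refl = here refl ∷ ⊆-there (∈subs⇒⊆ xs zs∈)

∈subs⇒unique : {xs : List A} → Unique xs → ∀ {ys} → ys ∈ subs xs → Unique ys
∈subs⇒unique {xs = []}     _         (here refl) = []
∈subs⇒unique {xs = x ∷ xs} (x∉ ∷ xs!) ys∈ with ∈-++⁻ (subs xs) ys∈
... | inj₁ ys∈₁ = ∈subs⇒unique xs! ys∈₁
... | inj₂ ys∈₂ with ∈-map⁻ (x ∷_) ys∈₂
...   | zs , zs∈ , refl = Allₚ.¬Any⇒All¬ zs (λ x∈ → All.lookup x∉ (All.lookup (∈subs⇒⊆ xs zs∈) x∈) refl) ∷ ∈subs⇒unique xs! zs∈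

∈subs⇒length≤ : (xs : List A) → ∀ {ys} → ys ∈ subs xs → length ys ≤ length xs
∈subs⇒length≤ []       (here refl) = z≤n
∈subs⇒length≤ (x ∷ xs) ys∈ with ∈-++⁻ (subs xs) ys∈
... | inj₁ ys∈₁ = ℕₚ.m≤n⇒m≤1+n (∈subs⇒length≤ xs ys∈₁)
... | inj₂ ys∈₂ with ∈-map⁻ (x ∷_) ys∈₂
...   | _ , zs∈ , refl = s≤s (∈subs⇒length≤ xs zs∈)

⊆-drop : {x : A} {ys zs : List A} → All (x ≢_) ys → ys ⊆ (x ∷ zs) → ys ⊆ zs
⊆-drop x∉ ys⊆ = All.tabulate λ y∈ → strip (All.lookup x∉ y∈) (All.lookup ys⊆ y∈)
  where
  strip : ∀ {x y zs} → x ≢ y → y ∈ (x ∷ zs) → y ∈ zs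
  strip x≢y (here refl) = ⊥-elim (x≢y refl)
  strip x≢y (there y∈)  = y∈

-- Sublists inherit the order of xs, so in the absence of duplicates their elements determine them.
-- This upgrades equalities of edge sets to equalities of lists.
subs-⊆-antisym : {xs : List A} → Unique xs → ∀ {ys zs} → ys ∈ subs xs → zs ∈ subs xs → ys ⊆ zs → zs ⊆ ys → ys ≡ zs
subs-⊆-antisym {xs = []} _ (here refl) (here refl) _ _ = refl
subs-⊆-antisym {xs = x ∷ xs} (x∉ ∷ xs!) ys∈ zs∈ ys⊆ zs⊆ with ∈-++⁻ (subs xs) ys∈ | ∈-++⁻ (subs xs) zs∈
... | inj₁ ys∈ | inj₁ zs∈ = subs-⊆-antisym xs! ys∈ zs∈ ys⊆ zs⊆
... | inj₁ ys∈ | inj₂ zs∈ with ∈-map⁻ (x ∷_) zs∈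
...   | zs , _ , refl = ⊥-elim (All.lookup x∉ (All.lookup (∈subs⇒⊆ xs ys∈) (All.head zs⊆)) refl)
subs-⊆-antisym {xs = x ∷ xs} (x∉ ∷ xs!) _ _ ys⊆ zs⊆ | inj₂ ys∈ | inj₁ zs∈ with ∈-map⁻ (x ∷_) ys∈
...   | ys , _ , refl = ⊥-elim (All.lookup x∉ (All.lookup (∈subs⇒⊆ xs zs∈) (All.head ys⊆)) refl)
subs-⊆-antisym {xs = x ∷ xs} (x∉ ∷ xs!) _ _ ys⊆ zs⊆ | inj₂ ys∈ | inj₂ zs∈ with ∈-map⁻ (x ∷_) ys∈ | ∈-map⁻ (x ∷_) zs∈
...   | ys , ys∈ , refl | zs , zs∈ , refl = cong (x ∷_) (subs-⊆-antisym xs! ys∈ zs∈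
        (⊆-drop (fresh ys∈) (All.tail ys⊆)) (⊆-drop (fresh zs∈) (All.tail zs⊆)))
  where
  fresh : ∀ {ys} → ys ∈ subs xs → All (x ≢_) ys
  fresh ys∈ = All.map (All.lookup x∉) (∈subs⇒⊆ xs ys∈)

-- Steiner trees

meets? : (R : Subset n) (vs : List (Fin n)) → Dec (Any (_∈ˢ R) vs)
meets? R = Any.any? (λ v → v Subₚ.∈? R)

-- The smallest set of edges connecting the vertices of R.
steiner : ∀ {vs} {es : List (Edge n)} → Growth vs es → Subset n → List (Edge n)
steiner (root r) R = []
steiner (leaf {vs} {es} {u} {w} {e} T _ _ _) R with w Subₚ.∈? R | meets? R vs
... | no _  | _     = steiner T R
... | yes _ | no _  = []
-- The leaf w is linked to the rest of R through u, which must then be reached as well.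
... | yes _ | yes _ = e ∷ steiner T (⁅ u ⁆ ∪ R)

∈⁅⁆∪⁻ : ∀ u (R : Subset n) {x} → x ∈ˢ (⁅ u ⁆ ∪ R) → x ≡ u ⊎ x ∈ˢ R
∈⁅⁆∪⁻ u R x∈ with Subₚ.x∈p∪q⁻ ⁅ u ⁆ R x∈
... | inj₁ x∈u = inj₁ (Subₚ.x∈⁅y⁆⇒x≡y u x∈u)
... | inj₂ x∈R = inj₂ x∈R

steiner∈subs : ∀ {vs} {es : List (Edge n)} (T : Growth vs es) R → steiner T R ∈ subs es
steiner∈subs (root r) R = here refl
steiner∈subs (leaf {vs} {es} {u} {w} {e} T _ _ _) R with w Subₚ.∈? R | meets? R vs
... | no _  | _     = ∈-++⁺ˡ (steiner∈subs T R)
... | yes _ | no _  = ∈-++⁺ˡ ([]∈subs es)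
... | yes _ | yes _ = ∈-++⁺ʳ (subs es) (∈-map⁺ (e ∷_) (steiner∈subs T (⁅ u ⁆ ∪ R)))

leaf-pendant : ∀ {vs} {es S : List (Edge n)} {w e} → Growth vs es → w ∉ vs → S ⊆ (e ∷ es) → PendantAt S w e
leaf-pendant T w∉ S⊆ f f∈ touch with All.lookup S⊆ f∈ | touch
... | here f≡e  | _         = f≡e
... | there f∈es | inj₁ refl = ⊥-elim (w∉ (proj₁ (growth-incident T f f∈es)))
... | there f∈es | inj₂ refl = ⊥-elim (w∉ (proj₂ (growth-incident T f f∈es)))

without-⊆ : {es : List (Edge n)} (S : List (Edge n)) {e : Edge n} → S ⊆ (e ∷ es) → (S without e) ⊆ es
without-⊆ {es = es} S {e} S⊆ = All.tabulate λ f∈ → strip (∈-without⁻ S f∈)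
  where
  strip : ∀ {f} → f ∈ S × f ≢ e → f ∈ es
  strip (f∈ , f≢e) with All.lookup S⊆ f∈
  ... | here f≡e    = ⊥-elim (f≢e f≡e)
  ... | there f∈es = f∈es

-- The edge e is the only one at w. If w is not in R, then e can be cut off from F. If both w and an
-- older vertex are in R, then F must contain e, and F without e still connects u with the older
-- vertices of R.
steiner-minimal : ∀ {vs} {es : List (Edge n)} (T : Growth vs es) R {F} → F ⊆ es →
  (∀ a b → a ∈ vs → a ∈ˢ R → b ∈ vs → b ∈ˢ R → Walk F a b) → steiner T R ⊆ F
steiner-minimal (root r) R F⊆ conn = []
steiner-minimal (leaf {vs} {es} {u} {w} {e} T u∈ w∉ j) R {F} F⊆ conn with w Subₚ.∈? R | meets? R vs
... | no _ | _ = ⊆-trans (steiner-minimal T R (without-⊆ F F⊆) λ a b a∈ a∈R b∈ b∈R →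
        walk-without-pendant j (λ { refl → w∉ u∈ }) (leaf-pendant T w∉ F⊆) (λ { refl → w∉ a∈ }) (λ { refl → w∉ b∈ })
          (conn a b (there a∈) a∈R (there b∈) b∈R))
      (All.tabulate (proj₁ ∘ ∈-without⁻ F))
... | yes _ | no _ = []
... | yes w∈R | yes meets = e∈F ∷ ⊆-trans (steiner-minimal T (⁅ u ⁆ ∪ R) (without-⊆ F F⊆) λ a b a∈ a∈R b∈ b∈R →
        walk-without-pendant j (λ { refl → w∉ u∈ }) (leaf-pendant T w∉ F⊆) (λ { refl → w∉ a∈ }) (λ { refl → w∉ b∈ })
          (walk-trans (walk-sym (from-w a a∈ (∈⁅⁆∪⁻ u R a∈R))) (from-w b b∈ (∈⁅⁆∪⁻ u R b∈R))))
      (All.tabulate (proj₁ ∘ ∈-without⁻ F))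
  where
  e∈F : e ∈ F
  e∈F with find meets
  ... | v , v∈ , v∈R with first-step (λ { refl → w∉ v∈ }) (conn w v (here refl) w∈R (there v∈) v∈R)
  ...   | f , f∈ , touch = subst (_∈ F) (leaf-pendant T w∉ F⊆ f f∈ touch) f∈
  from-w : ∀ a → a ∈ vs → a ≡ u ⊎ a ∈ˢ R → Walk F w a
  from-w a a∈ (inj₁ refl) = step (adj-sym (joins⇒adj j e∈F)) stop
  from-w a a∈ (inj₂ a∈R)  = conn w a (here refl) w∈R (there a∈) a∈R

-- The vertices of R are included since a Steiner tree without edges may be a single vertex.
SteinerVertex : ∀ {vs} {es : List (Edge n)} → Growth vs es → Subset n → Fin n → Set
SteinerVertex {vs = vs} T R x = (x ∈ vs × x ∈ˢ R) ⊎ Incident (steiner T R) x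

steiner-connected : ∀ {vs} {es : List (Edge n)} (T : Growth vs es) R →
  ∀ a b → SteinerVertex T R a → SteinerVertex T R b → Walk (steiner T R) a b
steiner-connected (root r) R a b (inj₁ (here refl , _)) (inj₁ (here refl , _)) = stop
steiner-connected (leaf {vs} {es} {u} {w} {e} T u∈ w∉ j) R a b a∈ b∈ with w Subₚ.∈? R | meets? R vs
... | no w∉R | _ = steiner-connected T R a b (old a∈) (old b∈)
  where
  old : ∀ {x} → (x ∈ w ∷ vs × x ∈ˢ R) ⊎ Incident (steiner T R) x → SteinerVertex T R x
  old (inj₁ (here refl , x∈R)) = ⊥-elim (w∉R x∈R)
  old (inj₁ (there x∈ , x∈R))  = inj₁ (x∈ , x∈R)
  old (inj₂ i)                = inj₂ i
... | yes _ | no ¬meets = subst₂ (Walk []) (sym (is-w a∈)) (sym (is-w b∈)) stop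
  where
  is-w : ∀ {x} → (x ∈ w ∷ vs × x ∈ˢ R) ⊎ Incident [] x → x ≡ w
  is-w (inj₁ (here refl , _))    = refl
  is-w (inj₁ (there x∈ , x∈R)) = ⊥-elim (¬meets (lose x∈ x∈R))
... | yes _ | yes _ = walk-trans (walk-sym (from-u a∈)) (from-u b∈)
  where
  R′ = ⁅ u ⁆ ∪ R
  tree = e ∷ steiner T R′
  within : ∀ {x} → SteinerVertex T R′ x → Walk tree u x
  within x∈ = walk-mono (⊆-there ⊆-refl) (steiner-connected T R′ u _ (inj₁ (u∈ , Subₚ.x∈p∪q⁺ (inj₁ (Subₚ.x∈⁅x⁆ u)))) x∈)
  to-w : Walk tree u w
  to-w = step (joins⇒adj j (here refl)) stop
  from-u : ∀ {x} → (x ∈ w ∷ vs × x ∈ˢ R) ⊎ Incident tree x → Walk tree u x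
  from-u (inj₁ (here refl , _))    = to-w
  from-u (inj₁ (there x∈ , x∈R)) = within (inj₁ (x∈ , Subₚ.x∈p∪q⁺ (inj₂ x∈R)))
  from-u (inj₂ (f , there f∈ , touch)) = within (inj₂ (f , f∈ , touch))
  from-u (inj₂ (f , here refl , touch)) with touches-joins j touch
  ... | inj₁ refl = stop
  ... | inj₂ refl = to-w

∈-steiner : ∀ {vs} {es : List (Edge n)} (T : Growth vs es) R {f} → f ∈ es →
  (∀ x → Touches x f → x ∈ˢ R) → f ∈ steiner T R
∈-steiner (leaf {vs} {es} {u} {w} {e} T u∈ w∉ j) R f∈ ends with w Subₚ.∈? R | meets? R vs | f∈
... | no w∉R | _ | here refl = ⊥-elim (w∉R (ends w (proj₂ (joins-touches j))))
... | no _ | _ | there f∈ = ∈-steiner T R f∈ ends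
... | yes _ | no ¬meets | here refl = ⊥-elim (¬meets (lose u∈ (ends u (proj₁ (joins-touches j)))))
... | yes _ | no ¬meets | there f∈ = ⊥-elim (¬meets (lose (proj₁ (growth-incident T _ f∈)) (ends _ (inj₁ refl))))
... | yes _ | yes _ | here refl = here refl
... | yes _ | yes _ | there f∈ = there (∈-steiner T (⁅ u ⁆ ∪ R) f∈ λ x touch → Subₚ.x∈p∪q⁺ (inj₂ (ends x touch)))

steiner-skip : ∀ {vs} {es : List (Edge n)} {u w e R} (T : Growth vs es) (u∈ : u ∈ vs) (w∉ : w ∉ vs) (j : Joins e u w) →
  w ∉ˢ R → steiner (leaf T u∈ w∉ j) R ≡ steiner T R
steiner-skip {w = w} {R = R} T u∈ w∉ j w∉R with w Subₚ.∈? R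
... | no _    = refl
... | yes w∈R = ⊥-elim (w∉R w∈R)

steiner-only : ∀ {vs} {es : List (Edge n)} {u w e R} (T : Growth vs es) (u∈ : u ∈ vs) (w∉ : w ∉ vs) (j : Joins e u w) →
  w ∈ˢ R → ¬ Any (_∈ˢ R) vs → steiner (leaf T u∈ w∉ j) R ≡ []
steiner-only {vs = vs} {w = w} {R = R} T u∈ w∉ j w∈R ¬m with w Subₚ.∈? R | meets? R vs
... | no w∉R | _     = ⊥-elim (w∉R w∈R)
... | yes _  | yes m = ⊥-elim (¬m m)
... | yes _  | no _  = refl

steiner-both : ∀ {vs} {es : List (Edge n)} {u w e R} (T : Growth vs es) (u∈ : u ∈ vs) (w∉ : w ∉ vs) (j : Joins e u w) →
  w ∈ˢ R → Any (_∈ˢ R) vs → steiner (leaf T u∈ w∉ j) R ≡ e ∷ steiner T (⁅ u ⁆ ∪ R)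
steiner-both {vs = vs} {w = w} {R = R} T u∈ w∉ j w∈R m with w Subₚ.∈? R | meets? R vs
... | no w∉R | _     = ⊥-elim (w∉R w∈R)
... | yes _  | no ¬m = ⊥-elim (¬m m)
... | yes _  | yes _ = refl

-- The reason why its leaf edges determine a subtree: a connected S that reaches R and sticks out of
-- the Steiner tree of R has a leaf vertex p outside of R. If e is in S and w is not in R, then w is
-- such a vertex; if e is in S and w in R, the search goes on in S without e, with u added to R.
leaf-outside : ∀ {vs} {es : List (Edge n)} (T : Growth vs es) R {S f} → S ⊆ es →
  (∀ a b → (a ∈ vs × a ∈ˢ R) ⊎ Incident S a → (b ∈ vs × b ∈ˢ R) ⊎ Incident S b → Walk S a b) →
  Any (_∈ˢ R) vs → f ∈ S → f ∉ steiner T R →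
  ∃ λ p → ∃ λ e → p ∉ˢ R × e ∈ S × Touches p e × PendantAt S p e
leaf-outside (root r) R S⊆ conn meets f∈ f∉ with All.lookup S⊆ f∈
... | ()
leaf-outside (leaf {vs} {es} {u} {w} {e} T u∈ w∉ j) R {S} {f} S⊆ conn meets f∈ f∉ = cases (e ∈ᵉ? S) (w Subₚ.∈? R) (meets? R vs)
  where
  Goal : Set
  Goal = ∃ λ p → ∃ λ e → p ∉ˢ R × e ∈ S × Touches p e × PendantAt S p e
  fresh : e ∉ S → S ⊆ es
  fresh e∉ = ⊆-drop (Allₚ.¬Any⇒All¬ S e∉) S⊆
  f-start : e ∉ S → proj₁ f ≢ w
  f-start e∉ refl = w∉ (proj₁ (growth-incident T f (All.lookup (fresh e∉) f∈)))
  R′ : Subset _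
  R′ = ⁅ u ⁆ ∪ R
  S′ : List (Edge _)
  S′ = S without e
  module _ (e∈ : e ∈ S) (w∈R : w ∈ˢ R) where
    u∈R′ : u ∈ˢ R′
    u∈R′ = Subₚ.x∈p∪q⁺ (inj₁ (Subₚ.x∈⁅x⁆ u))
    S′⊆ : S′ ⊆ es
    S′⊆ = without-⊆ S S⊆
    in-vs : ∀ {x} → (x ∈ vs × x ∈ˢ R′) ⊎ Incident S′ x → x ≢ w
    in-vs (inj₁ (x∈ , _)) refl = w∉ x∈
    in-vs (inj₂ (g , g∈ , inj₁ refl)) refl = w∉ (proj₁ (growth-incident T g (All.lookup S′⊆ g∈)))
    in-vs (inj₂ (g , g∈ , inj₂ refl)) refl = w∉ (proj₂ (growth-incident T g (All.lookup S′⊆ g∈)))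
    old : ∀ {x} → (x ∈ vs × x ∈ˢ R′) ⊎ Incident S′ x → (x ∈ w ∷ vs × x ∈ˢ R) ⊎ Incident S x
    old (inj₁ (x∈ , x∈R′)) with ∈⁅⁆∪⁻ u R x∈R′
    ... | inj₁ refl = inj₂ (e , e∈ , proj₁ (joins-touches j))
    ... | inj₂ x∈R  = inj₁ (there x∈ , x∈R)
    old (inj₂ (g , g∈ , touch)) = inj₂ (g , proj₁ (∈-without⁻ S g∈) , touch)
    conn′ : ∀ a b → (a ∈ vs × a ∈ˢ R′) ⊎ Incident S′ a → (b ∈ vs × b ∈ˢ R′) ⊎ Incident S′ b → Walk S′ a b
    conn′ a b a∈ b∈ = walk-without-pendant j (λ { refl → w∉ u∈ }) (leaf-pendant T w∉ S⊆) (in-vs a∈) (in-vs b∈) (conn a b (old a∈) (old b∈))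
    recurse : ∀ {g} → g ∈ S′ → g ∉ steiner T R′ → Goal
    recurse g∈ g∉ with leaf-outside T R′ S′⊆ conn′ (lose u∈ u∈R′) g∈ g∉
    ... | p , e₀ , p∉R′ , e₀∈ , touch , pendant =
          p , e₀ , p∉R′ ∘ Subₚ.x∈p∪q⁺ ∘ inj₂ , proj₁ (∈-without⁻ S e₀∈) , touch , λ h h∈ touch′ → pendant h (∈-without⁺ h∈ λ { refl → not-e touch′ }) touch′
      where
      -- Both ends of e lie in R′ and p does not, so p remains pendant when e is put back.
      not-e : ¬ Touches p e
      not-e touch′ with touches-joins j touch′
      ... | inj₁ refl = p∉R′ u∈R′
      ... | inj₂ refl = p∉R′ (Subₚ.x∈p∪q⁺ (inj₂ w∈R))
    grown : (m : Dec (Any (_∈ˢ R) vs)) → Goal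
    grown (yes m) = recurse (∈-without⁺ f∈ λ f≡e → f∉ (subst (f ∈_) (sym (steiner-both T u∈ w∉ j w∈R m)) (here f≡e)))
      (f∉ ∘ subst (f ∈_) (sym (steiner-both T u∈ w∉ j w∈R m)) ∘ there)
    -- Here w is the only vertex of R in the tree. If S has an edge g besides e, then g is outside
    -- of the Steiner tree of u alone, which has no edges, and the search goes on. Otherwise S
    -- consists of e, and its other end u is the leaf vertex.
    grown (no ¬m) with S′ in S′-eq
    ... | g ∷ _ = recurse (subst (g ∈_) (sym S′-eq) (here refl)) λ g∈ → ∉[] (All.lookup (steiner-minimal T R′ [] trivial) g∈)
      where
      only-u : ∀ {x} → x ∈ vs → x ∈ˢ R′ → x ≡ u
      only-u x∈ x∈R′ with ∈⁅⁆∪⁻ u R x∈R′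
      ... | inj₁ eq  = eq
      ... | inj₂ x∈R = ⊥-elim (¬m (lose x∈ x∈R))
      trivial : ∀ a b → a ∈ vs → a ∈ˢ R′ → b ∈ vs → b ∈ˢ R′ → Walk [] a b
      trivial a b a∈ a∈R′ b∈ b∈R′ = subst₂ (Walk []) (sym (only-u a∈ a∈R′)) (sym (only-u b∈ b∈R′)) stop
    ... | [] = u , e , (λ u∈R → ¬m (lose u∈ u∈R)) , e∈ , proj₁ (joins-touches j) , pendant
      where
      pendant : PendantAt S u e
      pendant g g∈ _ with g ≟ᵉ e
      ... | yes g≡e = g≡e
      ... | no g≢e with subst (g ∈_) S′-eq (∈-without⁺ g∈ g≢e)
      ...   | ()
  cases : Dec (e ∈ S) → Dec (w ∈ˢ R) → Dec (Any (_∈ˢ R) vs) → Goal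
  cases (no e∉) (no w∉R) _ = leaf-outside T R (fresh e∉) (λ a b a∈ b∈ → conn a b (new a∈) (new b∈)) (tail meets) f∈
      (f∉ ∘ subst (f ∈_) (sym (steiner-skip T u∈ w∉ j w∉R)))
    where
    new : ∀ {x} → (x ∈ vs × x ∈ˢ R) ⊎ Incident S x → (x ∈ w ∷ vs × x ∈ˢ R) ⊎ Incident S x
    new (inj₁ (x∈ , x∈R)) = inj₁ (there x∈ , x∈R)
    new (inj₂ i)          = inj₂ i
    tail : Any (_∈ˢ R) (w ∷ vs) → Any (_∈ˢ R) vs
    tail (here w∈R) = ⊥-elim (w∉R w∈R)
    tail (there m)  = m
  cases (no e∉) (yes w∈R) _ with first-step (f-start e∉ ∘ sym) (conn w (proj₁ f) (inj₁ (here refl , w∈R)) (inj₂ (f , f∈ , inj₁ refl)))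
  ... | g , g∈ , touch = ⊥-elim (e∉ (subst (_∈ S) (leaf-pendant T w∉ S⊆ g g∈ touch) g∈))
  cases (yes e∈) (no w∉R) _ = w , e , w∉R , e∈ , proj₂ (joins-touches j) , leaf-pendant T w∉ S⊆
  cases (yes e∈) (yes w∈R) m = grown e∈ w∈R m

-- The closure A ∪ K(A) of a set of edges

ends : Edge n → Subset n
ends e = ⁅ proj₁ e ⁆ ∪ ⁅ proj₂ e ⁆

verts : List (Edge n) → Subset n
verts []      = ∅
verts (e ∷ A) = ends e ∪ verts A

∈-ends⁺ : ∀ {e : Edge n} {x} → Touches x e → x ∈ˢ ends e
∈-ends⁺ (inj₁ refl) = Subₚ.x∈p∪q⁺ (inj₁ (Subₚ.x∈⁅x⁆ _))
∈-ends⁺ (inj₂ refl) = Subₚ.x∈p∪q⁺ (inj₂ (Subₚ.x∈⁅x⁆ _))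

∈-ends⁻ : ∀ (e : Edge n) {x} → x ∈ˢ ends e → Touches x e
∈-ends⁻ e x∈ with ∈⁅⁆∪⁻ _ _ x∈
... | inj₁ eq = inj₁ eq
... | inj₂ x∈ = inj₂ (Subₚ.x∈⁅y⁆⇒x≡y _ x∈)

∈-verts⁺ : {A : List (Edge n)} → ∀ {x} → Incident A x → x ∈ˢ verts A
∈-verts⁺ (e , here refl , touch) = Subₚ.x∈p∪q⁺ (inj₁ (∈-ends⁺ touch))
∈-verts⁺ (e , there e∈ , touch) = Subₚ.x∈p∪q⁺ (inj₂ (∈-verts⁺ (e , e∈ , touch)))

∈-verts⁻ : (A : List (Edge n)) → ∀ {x} → x ∈ˢ verts A → Incident A x
∈-verts⁻ []      x∈ = ⊥-elim (Subₚ.∉⊥ x∈)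
∈-verts⁻ (e ∷ A) x∈ with Subₚ.x∈p∪q⁻ (ends e) (verts A) x∈
... | inj₁ x∈e = e , here refl , ∈-ends⁻ e x∈e
... | inj₂ x∈A with ∈-verts⁻ A x∈A
...   | f , f∈ , touch = f , there f∈ , touch

incident-mono : {S S′ : List (Edge n)} → S ⊆ S′ → ∀ {x} → Incident S x → Incident S′ x
incident-mono S⊆ (e , e∈ , touch) = e , All.lookup S⊆ e∈ , touch

ConnectedEdges : List (Edge n) → Set
ConnectedEdges S = ∀ u v → Incident S u → Incident S v → Walk S u v

isTreeEdges-cong : {S S′ : List (Edge n)} → S ⊆ S′ → S′ ⊆ S → IsTreeEdges S → IsTreeEdges S′
isTreeEdges-cong {n} {S} {S′} S⊆ S′⊆ (S≢[] , conn , acyclic) =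
  (λ { refl → S≢[] (⊆[]⇒≡[] S⊆) }) ,
  (λ u v u∈ v∈ → walk-mono S⊆ (conn u v (incident-mono S′⊆ u∈) (incident-mono S′⊆ v∈))) ,
  acyclic ∘ cycle-mono S′⊆

module Closure {n} {vs : List (Fin n)} {es : List (Edge n)} (T : Growth vs es) (acyclic : ¬ Cycle es) where

  closure : List (Edge n) → List (Edge n)
  closure A = steiner T (verts A)

  closure∈subs : ∀ A → closure A ∈ subs es
  closure∈subs A = steiner∈subs T (verts A)

  es-unique : Unique es
  es-unique = growth-unique-edges T

  closure-unique : ∀ A → Unique (closure A)
  closure-unique A = ∈subs⇒unique es-unique (closure∈subs A)

  closure⊆es : ∀ A → closure A ⊆ es
  closure⊆es A = ∈subs⇒⊆ es (closure∈subs A)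

  ⊆-closure : ∀ {A} → A ⊆ es → A ⊆ closure A
  ⊆-closure {A} A⊆ = All.tabulate λ {e} e∈ →
    ∈-steiner T (verts A) (All.lookup A⊆ e∈) λ x touch → ∈-verts⁺ (e , e∈ , touch)

  closure-connected : ∀ A → ConnectedEdges (closure A)
  closure-connected A u v u∈ v∈ = steiner-connected T (verts A) u v (inj₂ u∈) (inj₂ v∈)

  closure-minimal : ∀ {A F} → F ⊆ es → A ⊆ F → ConnectedEdges F → closure A ⊆ F
  closure-minimal {A} F⊆ A⊆ conn = steiner-minimal T (verts A) F⊆ λ a b _ a∈ _ b∈ →
    conn a b (incident-mono A⊆ (∈-verts⁻ A a∈)) (incident-mono A⊆ (∈-verts⁻ A b∈))

  nonempty-⊆ : {S S′ : List (Edge n)} → S ≢ [] → S ⊆ S′ → S′ ≢ []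
  nonempty-⊆ S≢[] []       refl = S≢[] refl
  nonempty-⊆ S≢[] (() ∷ _) refl

  closure-tree : ∀ {A} → A ⊆ es → A ≢ [] → IsTreeEdges (closure A)
  closure-tree {A} A⊆ A≢[] = nonempty-⊆ A≢[] (⊆-closure A⊆) , closure-connected A , acyclic ∘ cycle-mono (closure⊆es A)

  connector : List (Edge n) → List (Edge n)
  connector A = filter (λ f → ¬? (f ∈ᵉ? A)) (closure A)

  connector⊆closure : ∀ A → connector A ⊆ closure A
  connector⊆closure A = All.tabulate λ f∈ → proj₁ (∈-filter⁻ _ {xs = closure A} f∈)

  connector-disjoint : ∀ A → Disjoint (connector A) A
  connector-disjoint A = All.tabulate λ f∈ → proj₂ (∈-filter⁻ _ {xs = closure A} f∈)

  connector-unique : ∀ A → Unique (connector A)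
  connector-unique A = Uniqueₚ.filter⁺ _ (closure-unique A)

  module _ {A : List (Edge n)} (A∈ : A ∈ subs es) where

    private
      A⊆ : A ⊆ es
      A⊆ = ∈subs⇒⊆ es A∈

    ++connector⊆closure : (A ++ connector A) ⊆ closure A
    ++connector⊆closure = Allₚ.++⁺ (⊆-closure A⊆) (connector⊆closure A)

    closure⊆++connector : closure A ⊆ (A ++ connector A)
    closure⊆++connector = All.tabulate split
      where
      split : ∀ {f} → f ∈ closure A → f ∈ A ++ connector A
      split {f} f∈ with f ∈ᵉ? A
      ... | yes f∈A = ∈-++⁺ˡ f∈A
      ... | no f∉A  = ∈-++⁺ʳ A (∈-filter⁺ _ f∈ f∉A)

    length-closure : length (closure A) ≡ length A ℕ.+ length (connector A)
    length-closure = trans (↭-length (unique-set⇒↭ (closure-unique A)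
      (Uniqueₚ.++⁺ (∈subs⇒unique es-unique A∈) (connector-unique A) λ (f∈A , f∈K) → All.lookup (connector-disjoint A) f∈K f∈A)
      closure⊆++connector ++connector⊆closure)) (Listₚ.length-++ A)

    connector-minimal : ∀ {K} → K ⊆ es → IsTreeEdges (A ++ K) → connector A ⊆ K
    connector-minimal {K} K⊆ (_ , conn , _) = All.tabulate λ f∈ → strip f∈ (∈-++⁻ A (All.lookup
        (closure-minimal {A} (Allₚ.++⁺ A⊆ K⊆) (All.tabulate ∈-++⁺ˡ) conn) (All.lookup (connector⊆closure A) f∈)))
      where
      strip : ∀ {f} → f ∈ connector A → f ∈ A ⊎ f ∈ K → f ∈ K
      strip f∈ (inj₁ f∈A) = ⊥-elim (All.lookup (connector-disjoint A) f∈ f∈A)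
      strip f∈ (inj₂ f∈K) = f∈K

    connector-isConnector : A ≢ [] → IsConnector es A (connector A)
    connector-isConnector A≢[] =
      ⊆-trans (connector⊆closure A) (closure⊆es A) , connector-unique A , connector-disjoint A ,
      isTreeEdges-cong closure⊆++connector ++connector⊆closure (closure-tree A⊆ A≢[]) ,
      λ K′ K′⊆ tree → connector-minimal (⊆-trans K′⊆ (⊆-trans (connector⊆closure A) (closure⊆es A))) tree

    -- The minimality of K speaks only of subsets of K. Minimality of the closure puts `connector A`
    -- inside K, and then that of K gives the reverse inclusion.
    isConnector-length : ∀ {K} → A ≢ [] → IsConnector es A K → length K ≡ length (connector A)
    isConnector-length A≢[] (K⊆ , K! , _ , tree , minimal) = ↭-length (unique-set⇒↭ K! (connector-unique A)
      (minimal (connector A) (connector-minimal K⊆ tree) (isTreeEdges-cong closure⊆++connector ++connector⊆closure (closure-tree A⊆ A≢[])))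
      (connector-minimal K⊆ tree))

    connectorWith⇒ : ∀ {a b} → ConnectorWith es a b A → A ≢ [] × length A ≡ a × length (closure A) ≡ a ℕ.+ b
    connectorWith⇒ (A≢[] , |A| , K , isK , |K|) = A≢[] , |A| ,
      trans length-closure (cong₂ ℕ._+_ |A| (trans (sym (isConnector-length A≢[] isK)) |K|))

    connectorWith⇐ : ∀ {a b} → A ≢ [] → length A ≡ a → length (closure A) ≡ a ℕ.+ b → ConnectorWith es a b A
    connectorWith⇐ A≢[] refl |C| = A≢[] , refl , connector A , connector-isConnector A≢[] ,
      ℕₚ.+-cancelˡ-≡ (length A) _ _ (trans (sym length-closure) |C|)

  tree⇒closed : ∀ {S} → S ∈ subs es → ConnectedEdges S → closure S ≡ S
  tree⇒closed {S} S∈ conn = subs-⊆-antisym es-unique (closure∈subs S) S∈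
    (closure-minimal (∈subs⇒⊆ es S∈) ⊆-refl conn) (⊆-closure (∈subs⇒⊆ es S∈))

  closed⇒tree : ∀ {S} → S ∈ subs es → S ≢ [] → closure S ≡ S → IsTreeEdges S
  closed⇒tree {S} S∈ S≢[] eq = subst IsTreeEdges eq (closure-tree (∈subs⇒⊆ es S∈) S≢[])

-- Degrees and leaf edges of a closure

touchesᵇ : Fin n → Edge n → Bool
touchesᵇ p e = (proj₁ e =ᶠ p) ∨ (proj₂ e =ᶠ p)

touches⇒ᵇ : ∀ {p} (e : Edge n) → Touches p e → T (touchesᵇ p e)
touches⇒ᵇ e (inj₁ refl) rewrite =ᶠ-refl (proj₁ e) = tt
touches⇒ᵇ {p = p} e (inj₂ refl) rewrite =ᶠ-refl (proj₂ e) = Equivalence.from Boolₚ.T-∨ (inj₂ tt)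

ᵇ⇒touches : ∀ {p} (e : Edge n) → T (touchesᵇ p e) → Touches p e
ᵇ⇒touches {p = p} e t with proj₁ e Fin.≟ p | proj₂ e Fin.≟ p
... | yes eq | _      = inj₁ (sym eq)
... | no _   | yes eq = inj₂ (sym eq)

unique-singleton : {L : List A} {x : A} → Unique L → x ∈ L → (∀ y → y ∈ L → y ≡ x) → length L ≡ 1
unique-singleton {L = y ∷ []}    _ _ _ = refl
unique-singleton {L = y ∷ z ∷ L} ((y≢z ∷ _) ∷ _) _ only =
  ⊥-elim (y≢z (trans (only y (here refl)) (sym (only z (there (here refl))))))

singleton-≡ : {L : List A} {x y : A} → length L ≡ 1 → x ∈ L → y ∈ L → x ≡ y
singleton-≡ {L = _ ∷ []} _ (here refl) (here refl) = refl

pendant⇒deg≡1 : {S : List (Edge n)} → ∀ {p e} → Unique S → e ∈ S → Touches p e → PendantAt S p e → deg S p ≡ 1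
pendant⇒deg≡1 {S = S} {p} {e} S! e∈ touch pendant = unique-singleton
  (Uniqueₚ.filter⁺ (T? ∘ touchesᵇ p) S!) (∈-filter⁺ (T? ∘ touchesᵇ p) e∈ (touches⇒ᵇ e touch)) λ f f∈ →
  let f∈S , t = ∈-filter⁻ (T? ∘ touchesᵇ p) {xs = S} f∈ in pendant f f∈S (ᵇ⇒touches f t)

deg≡1⇒pendant : {S : List (Edge n)} → ∀ {p e} → e ∈ S → Touches p e → deg S p ≡ 1 → PendantAt S p e
deg≡1⇒pendant {p = p} {e} e∈ touch deg≡1 f f∈ touch′ = singleton-≡ deg≡1
  (∈-filter⁺ (T? ∘ touchesᵇ p) f∈ (touches⇒ᵇ f touch′)) (∈-filter⁺ (T? ∘ touchesᵇ p) e∈ (touches⇒ᵇ e touch))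

leafᵇ : List (Edge n) → Edge n → Bool
leafᵇ S e = (deg S (proj₁ e) ℕ.≡ᵇ 1) ∨ (deg S (proj₂ e) ℕ.≡ᵇ 1)

∈-leafEdges⁺ : {S : List (Edge n)} → ∀ {p e} → e ∈ S → Touches p e → deg S p ≡ 1 → e ∈ leafEdges S
∈-leafEdges⁺ {S = S} e∈ (inj₁ refl) deg≡1 = ∈-filter⁺ (T? ∘ leafᵇ S) e∈ (Equivalence.from Boolₚ.T-∨ (inj₁ (ℕₚ.≡⇒≡ᵇ _ _ deg≡1)))
∈-leafEdges⁺ {S = S} e∈ (inj₂ refl) deg≡1 = ∈-filter⁺ (T? ∘ leafᵇ S) e∈ (Equivalence.from Boolₚ.T-∨ (inj₂ (ℕₚ.≡⇒≡ᵇ _ _ deg≡1)))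

∈-leafEdges⁻ : (S : List (Edge n)) → ∀ {e} → e ∈ leafEdges S → e ∈ S × ∃ λ p → Touches p e × deg S p ≡ 1
∈-leafEdges⁻ S {e} e∈ with ∈-filter⁻ (T? ∘ leafᵇ S) {xs = S} e∈
... | e∈S , t with Equivalence.to (Boolₚ.T-∨ {deg S (proj₁ e) ℕ.≡ᵇ 1}) t
...   | inj₁ t₁ = e∈S , proj₁ e , inj₁ refl , ℕₚ.≡ᵇ⇒≡ _ _ t₁
...   | inj₂ t₂ = e∈S , proj₂ e , inj₂ refl , ℕₚ.≡ᵇ⇒≡ _ _ t₂

growth-edge-ends : ∀ {vs} {es : List (Edge n)} → Growth vs es → ∀ {e} → e ∈ es → proj₁ e ≢ proj₂ e
growth-edge-ends (leaf T u∈ w∉ (inj₁ refl)) (here refl) refl = w∉ u∈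
growth-edge-ends (leaf T u∈ w∉ (inj₂ refl)) (here refl) refl = w∉ u∈
growth-edge-ends (leaf T u∈ w∉ j) (there e∈) = growth-edge-ends T e∈

other-end : ∀ {e : Edge n} {p} → proj₁ e ≢ proj₂ e → Touches p e → ∃ λ u → Joins e u p × u ≢ p
other-end {e = e} ne (inj₁ refl) = proj₂ e , inj₂ refl , ne ∘ sym
other-end {e = e} ne (inj₂ refl) = proj₁ e , inj₁ refl , ne

module ClosureLeaves {n} {vs : List (Fin n)} {es : List (Edge n)} (T : Growth vs es) (acyclic : ¬ Cycle es) where

  open Closure T acyclic

  pendant-leafEdge : ∀ {S} → S ∈ subs es → ∀ {p e} → e ∈ S → Touches p e → PendantAt S p e → e ∈ leafEdges S
  pendant-leafEdge S∈ e∈ touch pendant =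
    ∈-leafEdges⁺ e∈ touch (pendant⇒deg≡1 (∈subs⇒unique es-unique S∈) e∈ touch pendant)

  -- Suppose that a leaf edge e of the closure is not in A. Its end of degree 1 is then not a vertex
  -- of A, so the vertices of A stay connected without e, against the minimality of the Steiner
  -- tree.
  leafEdges⊆ : ∀ {A} → A ∈ subs es → leafEdges (closure A) ⊆ A
  leafEdges⊆ {A} A∈ = All.tabulate prove
    where
    S : List (Edge n)
    S = closure A
    A⊆ : A ⊆ es
    A⊆ = ∈subs⇒⊆ es A∈
    prove : ∀ {e} → e ∈ leafEdges S → e ∈ A
    prove {e} e∈ with e ∈ᵉ? A
    ... | yes e∈A = e∈A
    ... | no e∉A with ∈-leafEdges⁻ S e∈
    ...   | e∈S , p , touch , deg≡1 with other-end (growth-edge-ends T (All.lookup (closure⊆es A) e∈S)) touch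
    ...     | u , j , u≢p = ⊥-elim (proj₂ (∈-without⁻ S (All.lookup S⊆ e∈S)) refl)
      where
      pendant : PendantAt S p e
      pendant = deg≡1⇒pendant e∈S touch deg≡1
      avoids : ∀ {a} → a ∈ˢ verts A → a ≢ p
      avoids a∈ refl with ∈-verts⁻ A a∈
      ... | f , f∈ , touch′ = e∉A (subst (_∈ A) (pendant f (All.lookup (⊆-closure A⊆) f∈) touch′) f∈)
      in-S : ∀ {a} → a ∈ˢ verts A → Incident S a
      in-S a∈ = incident-mono (⊆-closure A⊆) (∈-verts⁻ A a∈)
      S⊆ : S ⊆ (S without e)
      S⊆ = steiner-minimal T (verts A) (⊆-trans (All.tabulate (proj₁ ∘ ∈-without⁻ S)) (closure⊆es A)) λ a b _ a∈ _ b∈ →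
        walk-without-pendant j u≢p pendant (avoids a∈) (avoids b∈) (closure-connected A a b (in-S a∈) (in-S b∈))

  -- If S stuck out of the closure, `leaf-outside` would give a leaf vertex of S that is not a
  -- vertex of A. But its edge is a leaf edge of S and hence in A.
  leaves-close : ∀ {A S} → S ∈ subs es → ConnectedEdges S → A ≢ [] → A ⊆ S → leafEdges S ⊆ A → S ⊆ closure A
  leaves-close {[]}        S∈ conn A≢[] A⊆S L⊆A = ⊥-elim (A≢[] refl)
  leaves-close {A@(g ∷ _)} {S} S∈ conn A≢[] A⊆S L⊆A = All.tabulate prove
    where
    S⊆ : S ⊆ es
    S⊆ = ∈subs⇒⊆ es S∈
    in-S : ∀ {x} → (x ∈ vs × x ∈ˢ verts A) ⊎ Incident S x → Incident S x
    in-S (inj₁ (_ , x∈)) = incident-mono A⊆S (∈-verts⁻ A x∈)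
    in-S (inj₂ i)        = i
    meets : Any (_∈ˢ verts A) vs
    meets = lose (proj₁ (growth-incident T g (All.lookup S⊆ (All.head A⊆S)))) (∈-verts⁺ {A = A} (g , here refl , inj₁ refl))
    prove : ∀ {f} → f ∈ S → f ∈ closure A
    prove {f} f∈ with f ∈ᵉ? closure A
    ... | yes f∈C = f∈C
    ... | no f∉C with leaf-outside T (verts A) S⊆ (λ a b a∈ b∈ → conn a b (in-S a∈) (in-S b∈)) meets f∈ f∉C
    ...   | p , e , p∉ , e∈ , touch , pendant =
            ⊥-elim (p∉ (∈-verts⁺ {A = A} (e , All.lookup L⊆A (pendant-leafEdge S∈ e∈ touch pendant) , touch)))

  closure≡⇒ : ∀ {A S} → A ∈ subs es → A ≢ [] → closure A ≡ S → IsTreeEdges S × leafEdges S ⊆ A × A ⊆ S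
  closure≡⇒ A∈ A≢[] refl = closure-tree (∈subs⇒⊆ es A∈) A≢[] , leafEdges⊆ A∈ , ⊆-closure (∈subs⇒⊆ es A∈)

  closure≡⇐ : ∀ {A S} → S ∈ subs es → A ≢ [] → IsTreeEdges S → leafEdges S ⊆ A → A ⊆ S → closure A ≡ S
  closure≡⇐ {A} S∈ A≢[] (_ , conn , _) L⊆A A⊆S = subs-⊆-antisym es-unique (closure∈subs A) S∈
    (closure-minimal (∈subs⇒⊆ es S∈) A⊆S conn) (leaves-close S∈ conn A≢[] A⊆S L⊆A)

  -- This is `leaf-outside` for a single vertex, whose Steiner tree has no edges. It yields j ≥ 1,
  -- and shows that an A above the leaf edges is nonempty.
  tree-has-leaf : ∀ {S} → S ∈ subs es → IsTreeEdges S → leafEdges S ≢ []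
  tree-has-leaf {[]}        S∈ (S≢[] , _) _ = S≢[] refl
  tree-has-leaf {S@(f ∷ _)} S∈ (_ , conn , _) L≡[]
    with leaf-outside T R S⊆ (λ a b a∈ b∈ → conn a b (in-S a∈) (in-S b∈)) (lose f-start (Subₚ.x∈⁅x⁆ _)) (here refl)
           (λ f∈ → ∉[] (All.lookup (steiner-minimal T R [] trivial) f∈))
    where
    R : Subset n
    R = ⁅ proj₁ f ⁆
    S⊆ : S ⊆ es
    S⊆ = ∈subs⇒⊆ es S∈
    f-start : proj₁ f ∈ vs
    f-start = proj₁ (growth-incident T f (All.head S⊆))
    in-S : ∀ {x} → (x ∈ vs × x ∈ˢ R) ⊎ Incident S x → Incident S x
    in-S (inj₁ (_ , x∈)) = f , here refl , inj₁ (Subₚ.x∈⁅y⁆⇒x≡y _ x∈)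
    in-S (inj₂ i)        = i
    trivial : ∀ a b → a ∈ vs → a ∈ˢ R → b ∈ vs → b ∈ˢ R → Walk [] a b
    trivial a b _ a∈ _ b∈ = subst₂ (Walk []) (sym (Subₚ.x∈⁅y⁆⇒x≡y _ a∈)) (sym (Subₚ.x∈⁅y⁆⇒x≡y _ b∈)) stop
  ... | p , e , _ , e∈ , touch , pendant with subst (e ∈_) L≡[] (pendant-leafEdge S∈ e∈ touch pendant)
  ...   | ()

-- Sums over vertex sets

Supported : List (Fin n) → Subset n → Set
Supported vs R = ∀ v → v ∈ˢ R → v ∈ vs

-- The sum of q^|A| Ψ(R) ∏ ω(v) over all A ⊆ es and all sets of marked vertices v, where R is
-- the set of vertices that are marked or incident to A.
marked : ∀ {vs} {es : List (Edge n)} → Growth vs es → ℚ → (Fin n → ℚ) → (Subset n → ℚ) → ℚ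
marked (root r) q ω Ψ = Ψ ∅ + ω r * Ψ ⁅ r ⁆
marked (leaf {u = u} {w} T _ _ _) q ω Ψ =
  marked T q ω Ψ + ω w * marked T q ω (λ R → Ψ (⁅ w ⁆ ∪ R)) +
  -- If A contains the new edge, then w is in R whether it is marked or not.
  q * (1ℚ + ω w) * marked T q ω (λ R → Ψ (⁅ w ⁆ ∪ (⁅ u ⁆ ∪ R)))

supported-∪ : ∀ {vs : List (Fin n)} {u R} → u ∈ vs → Supported vs R → Supported vs (⁅ u ⁆ ∪ R)
supported-∪ {u = u} {R} u∈ sR v v∈ with ∈⁅⁆∪⁻ u R v∈
... | inj₁ refl = u∈
... | inj₂ v∈R  = sR v v∈R

supported-there : ∀ {vs : List (Fin n)} {w R} → Supported vs R → Supported (w ∷ vs) R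
supported-there sR v v∈ = there (sR v v∈)

marked-cong : ∀ {vs} {es : List (Edge n)} (T : Growth vs es) q ω {Ψ Φ : Subset n → ℚ} →
  (∀ R → Supported vs R → Ψ R ≡ Φ R) → marked T q ω Ψ ≡ marked T q ω Φ
marked-cong (root r) q ω eq = cong₂ (λ a b → a + ω r * b)
  (eq ∅ λ v v∈ → ⊥-elim (Subₚ.∉⊥ v∈)) (eq ⁅ r ⁆ λ v v∈ → here (Subₚ.x∈⁅y⁆⇒x≡y _ v∈))
marked-cong (leaf {u = u} {w} T u∈ w∉ j) q ω eq = cong₂ _+_
  (cong₂ (λ a b → a + ω w * b)
    (marked-cong T q ω λ R sR → eq R (supported-there sR))
    (marked-cong T q ω λ R sR → eq (⁅ w ⁆ ∪ R) (supported-∪ (here refl) (supported-there sR))))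
  (cong (_*_ (q * (1ℚ + ω w)))
    (marked-cong T q ω λ R sR → eq _ (supported-∪ (here refl) (supported-∪ (there u∈) (supported-there sR)))))

marked-weight-cong : ∀ {vs} {es : List (Edge n)} (T : Growth vs es) q {ω ω′ : Fin n → ℚ} →
  (∀ v → v ∈ vs → ω v ≡ ω′ v) → ∀ Ψ → marked T q ω Ψ ≡ marked T q ω′ Ψ
marked-weight-cong (root r) q eq Ψ = cong (λ a → Ψ ∅ + a * Ψ ⁅ r ⁆) (eq r (here refl))
marked-weight-cong (leaf {u = u} {w} T u∈ w∉ j) q {ω} {ω′} eq Ψ rewrite eq w (here refl) = cong₂ _+_
  (cong₂ (λ a b → a + ω′ w * b) (rec Ψ) (rec _)) (cong (_*_ (q * (1ℚ + ω′ w))) (rec _))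
  where
  rec : ∀ Ψ → marked T q ω Ψ ≡ marked T q ω′ Ψ
  rec = marked-weight-cong T q λ v v∈ → eq v (there v∈)

marked-linear : ∀ {vs} {es : List (Edge n)} (T : Growth vs es) q ω a b (Ψ Φ : Subset n → ℚ) →
  marked T q ω (λ R → a * Ψ R + b * Φ R) ≡ a * marked T q ω Ψ + b * marked T q ω Φ
marked-linear (root r) q ω a b Ψ Φ = lem a b (ω r) (Ψ ∅) (Ψ ⁅ r ⁆) (Φ ∅) (Φ ⁅ r ⁆)
  where
  lem : ∀ a b o p p′ f f′ → a * p + b * f + o * (a * p′ + b * f′) ≡ a * (p + o * p′) + b * (f + o * f′)
  lem = solve-∀ ℚ-ring
marked-linear (leaf {u = u} {w} T u∈ w∉ j) q ω a b Ψ Φ =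
  trans (cong₂ _+_ (cong₂ (λ s t → s + ω w * t) (marked-linear T q ω a b Ψ Φ) (marked-linear T q ω a b _ _))
    (cong (_*_ (q * (1ℚ + ω w))) (marked-linear T q ω a b _ _)))
    (lem a b (ω w) (q * (1ℚ + ω w)) _ _ _ _ _ _)
  where
  lem : ∀ a b o k p₁ p₂ p₃ f₁ f₂ f₃ → a * p₁ + b * f₁ + o * (a * p₂ + b * f₂) + k * (a * p₃ + b * f₃) ≡
    a * (p₁ + o * p₂ + k * p₃) + b * (f₁ + o * f₂ + k * f₃)
  lem = solve-∀ ℚ-ring

marked-zero : ∀ {vs} {es : List (Edge n)} (T : Growth vs es) q ω → marked T q ω (λ _ → 0ℚ) ≡ 0ℚ
marked-zero T q ω = trans (marked-cong T q ω λ _ _ → lem) (trans (marked-linear T q ω 0ℚ 0ℚ (λ _ → 0ℚ) (λ _ → 0ℚ)) (lem′ (marked T q ω (λ _ → 0ℚ))))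
  where
  lem : 0ℚ ≡ 0ℚ * 0ℚ + 0ℚ * 0ℚ
  lem = refl
  lem′ : ∀ a → 0ℚ * a + 0ℚ * a ≡ 0ℚ
  lem′ = solve-∀ ℚ-ring

∪-swap : ∀ (P Q R : Subset n) → P ∪ (Q ∪ R) ≡ Q ∪ (P ∪ R)
∪-swap P Q R = trans (sym (Subₚ.∪-assoc P Q R)) (trans (cong (_∪ R) (Subₚ.∪-comm P Q)) (Subₚ.∪-assoc Q P R))

∪-absorb : ∀ (P R : Subset n) → P ∪ (P ∪ R) ≡ P ∪ R
∪-absorb P R = trans (sym (Subₚ.∪-assoc P P R)) (cong (_∪ R) (Subₚ.∪-idem P))

-- Characterised by 1 + (a ⊕ b) = (1 + a)(1 + b).
_⊕_ : ℚ → ℚ → ℚ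
a ⊕ b = a + b + a * b

-- Marking a vertex is idempotent, so (1 + ωᵤ mᵤ)(1 + y mᵤ) = 1 + (ωᵤ ⊕ y) mᵤ.
marked-extra : ∀ {vs} {es : List (Edge n)} (T : Growth vs es) q ω {u} → u ∈ vs → ∀ y Ψ →
  marked T q (ω [ u ↦ ω u ⊕ y ]) Ψ ≡ marked T q ω Ψ + y * marked T q ω (λ R → Ψ (⁅ u ⁆ ∪ R))
marked-extra (root r) q ω (here refl) y Ψ
  rewrite [↦]-same ω r (ω r ⊕ y) | Subₚ.∪-identityʳ ⁅ r ⁆ | Subₚ.∪-idem ⁅ r ⁆ = lem (Ψ ∅) (ω r) y (Ψ ⁅ r ⁆)
  where
  lem : ∀ a o y b → a + (o + y + o * y) * b ≡ a + o * b + y * (b + o * b)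
  lem = solve-∀ ℚ-ring
marked-extra (leaf {vs} {u = u₀} {w} T u∈ w∉ j) q ω (here refl) y Ψ
  rewrite [↦]-same ω w (ω w ⊕ y) =
  trans (cong₂ _+_ (cong₂ (λ s t → s + (ω w ⊕ y) * t) (same Ψ) (same _)) (cong (_*_ (q * (1ℚ + (ω w ⊕ y)))) (same _)))
  (trans (lem (ω w) y q (marked T q ω Ψ) _ _)
    (cong (λ s → marked T q ω Ψ + ω w * marked T q ω (λ R → Ψ (⁅ w ⁆ ∪ R)) + q * (1ℚ + ω w) * marked T q ω (λ R → Ψ (⁅ w ⁆ ∪ (⁅ u₀ ⁆ ∪ R))) + y * s)
      (cong₂ _+_ (cong (λ s → marked T q ω (λ R → Ψ (⁅ w ⁆ ∪ R)) + ω w * s) (marked-cong T q ω λ R _ → cong Ψ (sym (∪-absorb ⁅ w ⁆ R))))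
        (cong (_*_ (q * (1ℚ + ω w))) (marked-cong T q ω λ R _ → cong Ψ (sym (∪-absorb ⁅ w ⁆ (⁅ u₀ ⁆ ∪ R))))))))
  where
  same : ∀ Ψ → marked T q (ω [ w ↦ ω w ⊕ y ]) Ψ ≡ marked T q ω Ψ
  same = marked-weight-cong T q λ v v∈ → [↦]-other ω w _ λ { refl → w∉ v∈ }
  lem : ∀ o y q a b c → a + (o + y + o * y) * b + q * (1ℚ + (o + y + o * y)) * c ≡
    a + o * b + q * (1ℚ + o) * c + y * (b + o * b + q * (1ℚ + o) * c)
  lem = solve-∀ ℚ-ring
marked-extra (leaf {u = u₀} {w} T u₀∈ w∉ j) q ω {u} (there u∈) y Ψ
  rewrite [↦]-other ω u (ω u ⊕ y) {w} (λ { refl → w∉ u∈ }) =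
  trans (cong₂ _+_ (cong₂ (λ s t → s + ω w * t) (marked-extra T q ω u∈ y Ψ)
      (trans (marked-extra T q ω u∈ y _) (cong (λ s → marked T q ω (λ R → Ψ (⁅ w ⁆ ∪ R)) + y * s)
        (marked-cong T q ω λ R _ → cong Ψ (∪-swap ⁅ w ⁆ ⁅ u ⁆ R)))))
      (cong (_*_ (q * (1ℚ + ω w))) (trans (marked-extra T q ω u∈ y _)
        (cong (λ s → marked T q ω (λ R → Ψ (⁅ w ⁆ ∪ (⁅ u₀ ⁆ ∪ R))) + y * s)
          (marked-cong T q ω λ R _ → cong Ψ (trans (cong (⁅ w ⁆ ∪_) (∪-swap ⁅ u₀ ⁆ ⁅ u ⁆ R)) (∪-swap ⁅ w ⁆ ⁅ u ⁆ _)))))))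
    (lem (ω w) (q * (1ℚ + ω w)) y (M Ψ) (M λ R → Ψ (⁅ u ⁆ ∪ R)) (M λ R → Ψ (⁅ w ⁆ ∪ R)) (M λ R → Ψ (⁅ u ⁆ ∪ (⁅ w ⁆ ∪ R)))
      (M λ R → Ψ (⁅ w ⁆ ∪ (⁅ u₀ ⁆ ∪ R))) (M λ R → Ψ (⁅ u ⁆ ∪ (⁅ w ⁆ ∪ (⁅ u₀ ⁆ ∪ R)))))
  where
  M : (Subset _ → ℚ) → ℚ
  M = marked T q ω
  lem : ∀ o k y a a′ b b′ c c′ → a + y * a′ + o * (b + y * b′) + k * (c + y * c′) ≡
    a + o * b + k * c + y * (a′ + o * b′ + k * c′)
  lem = solve-∀ ℚ-ring

marked-unmarked : ∀ {vs} {es : List (Edge n)} (T : Growth vs es) q (Ψ : Subset n → ℚ) →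
  marked T q (λ _ → 0ℚ) Ψ ≡ ∑ (subs es) (λ A → q ^ℚ length A * Ψ (verts A))
marked-unmarked (root r) q Ψ = lem (Ψ ∅) (Ψ ⁅ r ⁆)
  where
  lem : ∀ a b → a + 0ℚ * b ≡ 1ℚ * a + 0ℚ
  lem = solve-∀ ℚ-ring
marked-unmarked (leaf {es = es} {u} {w} {e} T u∈ w∉ j) q Ψ = begin
  marked T q (λ _ → 0ℚ) Ψ + 0ℚ * marked T q (λ _ → 0ℚ) (λ R → Ψ (⁅ w ⁆ ∪ R)) + q * (1ℚ + 0ℚ) * marked T q (λ _ → 0ℚ) (λ R → Ψ (⁅ w ⁆ ∪ (⁅ u ⁆ ∪ R)))
    ≡⟨ lem (marked T q (λ _ → 0ℚ) Ψ) (marked T q (λ _ → 0ℚ) (λ R → Ψ (⁅ w ⁆ ∪ R))) q (marked T q (λ _ → 0ℚ) (λ R → Ψ (⁅ w ⁆ ∪ (⁅ u ⁆ ∪ R)))) ⟩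
  marked T q (λ _ → 0ℚ) Ψ + q * marked T q (λ _ → 0ℚ) (λ R → Ψ (⁅ w ⁆ ∪ (⁅ u ⁆ ∪ R)))
    ≡⟨ cong₂ (λ a b → a + q * b) (marked-unmarked T q Ψ) (trans (marked-cong T q _ λ R _ → cong Ψ (both-ends j R)) (marked-unmarked T q _)) ⟩
  ∑ (subs es) (λ A → q ^ℚ length A * Ψ (verts A)) + q * ∑ (subs es) (λ A → q ^ℚ length A * Ψ (ends e ∪ verts A))
    ≡⟨ cong (∑ (subs es) (λ A → q ^ℚ length A * Ψ (verts A)) +_) (sym (trans (∑-map (e ∷_) (subs es) _)
         (trans (∑-cong (subs es) λ A → ℚₚ.*-assoc q _ _) (∑-*ˡ q (subs es) _)))) ⟩
  _
    ≡⟨ sym (∑-++ (subs es) (map (e ∷_) (subs es)) _) ⟩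
  ∑ (subs (e ∷ es)) (λ A → q ^ℚ length A * Ψ (verts A)) ∎
  where
  open ≡-Reasoning
  lem : ∀ a b q c → a + 0ℚ * b + q * (1ℚ + 0ℚ) * c ≡ a + q * c
  lem = solve-∀ ℚ-ring
  both-ends : ∀ {e : Edge _} {u w} → Joins e u w → ∀ R → ⁅ w ⁆ ∪ (⁅ u ⁆ ∪ R) ≡ ends e ∪ R
  both-ends {u = u} {w} (inj₁ refl) R = trans (∪-swap ⁅ w ⁆ ⁅ u ⁆ R) (sym (Subₚ.∪-assoc ⁅ u ⁆ ⁅ w ⁆ R))
  both-ends {u = u} {w} (inj₂ refl) R = sym (Subₚ.∪-assoc ⁅ w ⁆ ⁅ u ⁆ R)

-- Weights of Steiner trees and their leaf recursion

steiner-cong : ∀ {vs} {es : List (Edge n)} (T : Growth vs es) {R R′} →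
  (∀ v → v ∈ vs → v ∈ˢ R → v ∈ˢ R′) → (∀ v → v ∈ vs → v ∈ˢ R′ → v ∈ˢ R) → steiner T R ≡ steiner T R′
steiner-cong {n} {vs} {es} T {R} {R′} R⊆ R′⊆ = subs-⊆-antisym (growth-unique-edges T) (steiner∈subs T R) (steiner∈subs T R′)
  (half R R′ R⊆) (half R′ R R′⊆)
  where
  half : ∀ R R′ → (∀ v → v ∈ vs → v ∈ˢ R → v ∈ˢ R′) → steiner T R ⊆ steiner T R′
  half R R′ R⊆ = steiner-minimal T R (∈subs⇒⊆ es (steiner∈subs T R′)) λ a b a∈ a∈R b∈ b∈R →
    steiner-connected T R′ a b (inj₁ (a∈ , R⊆ a a∈ a∈R)) (inj₁ (b∈ , R⊆ b b∈ b∈R))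

χ : List (Fin n) → Subset n → ℚ
χ vs R = 𝟙 (does (meets? R vs))

χ-yes : ∀ {vs : List (Fin n)} {R} → Any (_∈ˢ R) vs → χ vs R ≡ 1ℚ
χ-yes {vs = vs} {R} m = cong 𝟙 (dec-true (meets? R vs) m)

χ-no : ∀ {vs : List (Fin n)} {R} → ¬ Any (_∈ˢ R) vs → χ vs R ≡ 0ℚ
χ-no {vs = vs} {R} ¬m = cong 𝟙 (dec-false (meets? R vs) ¬m)

χ-leaf : ∀ {vs : List (Fin n)} {w R} → w ∉ vs → Supported vs R → χ (w ∷ vs) R ≡ χ vs R
χ-leaf {vs = vs} {w} {R} w∉ sR = cases (meets? R vs)
  where
  cases : Dec (Any (_∈ˢ R) vs) → χ (w ∷ vs) R ≡ χ vs R
  cases (yes m) = trans (χ-yes {vs = w ∷ vs} (there m)) (sym (χ-yes m))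
  cases (no ¬m) = trans (χ-no {vs = w ∷ vs} λ { (here w∈R) → w∉ (sR w w∈R) ; (there m) → ¬m m }) (sym (χ-no ¬m))

∈-∪-here : ∀ u (R : Subset n) → u ∈ˢ (⁅ u ⁆ ∪ R)
∈-∪-here u R = Subₚ.x∈p∪q⁺ (inj₁ (Subₚ.x∈⁅x⁆ u))

∈-∪-there : ∀ u (R : Subset n) {x} → x ∈ˢ R → x ∈ˢ (⁅ u ⁆ ∪ R)
∈-∪-there u R x∈ = Subₚ.x∈p∪q⁺ (inj₂ x∈)

-- Only A = ∅ with no marked vertex leaves R empty, and this choice has weight 1.
marked-empty : ∀ {vs} {es : List (Edge n)} (T : Growth vs es) q ω → marked T q ω (λ R → 1ℚ - χ vs R) ≡ 1ℚ
marked-empty (root r) q ω = trans (cong₂ (λ a b → 1ℚ - a + ω r * (1ℚ - b))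
    (χ-no {vs = [ r ]} λ { (here r∈) → Subₚ.∉⊥ r∈ }) (χ-yes {vs = [ r ]} (here (Subₚ.x∈⁅x⁆ r)))) (lem (ω r))
  where
  lem : ∀ o → 1ℚ - 0ℚ + o * (1ℚ - 1ℚ) ≡ 1ℚ
  lem = solve-∀ ℚ-ring
marked-empty (leaf {vs} {u = u} {w} T u∈ w∉ j) q ω = trans
  (cong₂ _+_ (cong₂ (λ a b → a + ω w * b)
      (trans (marked-cong T q ω λ R sR → cong (_-_ 1ℚ) (χ-leaf w∉ sR)) (marked-empty T q ω))
      (vanish λ R → R))
    (cong (_*_ (q * (1ℚ + ω w))) (vanish (⁅ u ⁆ ∪_))))
  (lem (ω w) (q * (1ℚ + ω w)))
  where
  vanish : ∀ (F : Subset _ → Subset _) → marked T q ω (λ R → 1ℚ - χ (w ∷ vs) (⁅ w ⁆ ∪ F R)) ≡ 0ℚ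
  vanish F = trans (marked-cong T q ω λ R _ → cong (_-_ 1ℚ) (χ-yes {vs = w ∷ vs} (here (∈-∪-here w (F R))))) (marked-zero T q ω)
  lem : ∀ o k → 1ℚ + o * 0ℚ + k * 0ℚ ≡ 1ℚ
  lem = solve-∀ ℚ-ring

module GeneratingFunction (q z : ℚ) where

  -- The factor `χ` discards R = ∅, that is A = ∅ without marks, for which there is no connector.
  steinerWeight : ∀ {vs} {es : List (Edge n)} → Growth vs es → Subset n → ℚ
  steinerWeight {vs = vs} T R = χ vs R * z ^ℚ length (steiner T R)

  weight-old : ∀ {vs} {es : List (Edge n)} {u w e} (T : Growth vs es) (u∈ : u ∈ vs) (w∉ : w ∉ vs) (j : Joins e u w) →
    ∀ R → Supported vs R → steinerWeight (leaf T u∈ w∉ j) R ≡ steinerWeight T R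
  weight-old {w = w} T u∈ w∉ j R sR = cong₂ (λ a S → a * z ^ℚ length S) (χ-leaf w∉ sR) (steiner-skip T u∈ w∉ j (w∉ ∘ sR w))

  module _ {vs} {es : List (Edge n)} {u w e} (T : Growth vs es) (u∈ : u ∈ vs) (w∉ : w ∉ vs) (j : Joins e u w) where

    -- The set R′ is R without w and possibly without u. Once u is added, both agree on the old
    -- vertices and have the same Steiner tree there.
    weight-attached : ∀ R R′ → Any (_∈ˢ R) vs → (∀ v → v ≢ w → v ∈ˢ R → v ∈ˢ R′) → (∀ v → v ∈ˢ R′ → v ∈ˢ (⁅ u ⁆ ∪ R)) →
      w ∈ˢ R → steinerWeight (leaf T u∈ w∉ j) R ≡ z * steinerWeight T (⁅ u ⁆ ∪ R′)
    weight-attached R R′ m R⊆ R′⊆ w∈R = begin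
      χ (w ∷ vs) R * z ^ℚ length (steiner (leaf T u∈ w∉ j) R)
        ≡⟨ cong₂ (λ a S → a * z ^ℚ length S) (χ-yes {vs = w ∷ vs} (there m)) (trans (steiner-both T u∈ w∉ j w∈R m) (cong (e ∷_) same)) ⟩
      1ℚ * (z * z ^ℚ length (steiner T (⁅ u ⁆ ∪ R′)))
        ≡⟨ lem z _ ⟩
      z * (1ℚ * z ^ℚ length (steiner T (⁅ u ⁆ ∪ R′)))
        ≡⟨ cong (λ a → z * (a * z ^ℚ length (steiner T (⁅ u ⁆ ∪ R′)))) (sym (χ-yes (lose u∈ (∈-∪-here u R′)))) ⟩
      z * steinerWeight T (⁅ u ⁆ ∪ R′) ∎
      where
      open ≡-Reasoning
      lem : ∀ a b → 1ℚ * (a * b) ≡ a * (1ℚ * b)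
      lem = solve-∀ ℚ-ring
      fwd : ∀ v → v ∈ vs → v ∈ˢ (⁅ u ⁆ ∪ R) → v ∈ˢ (⁅ u ⁆ ∪ R′)
      fwd v v∈ v∈R with ∈⁅⁆∪⁻ u R v∈R
      ... | inj₁ refl = ∈-∪-here u R′
      ... | inj₂ v∈R′ = ∈-∪-there u R′ (R⊆ v (λ { refl → w∉ v∈ }) v∈R′)
      bwd : ∀ v → v ∈ vs → v ∈ˢ (⁅ u ⁆ ∪ R′) → v ∈ˢ (⁅ u ⁆ ∪ R)
      bwd v v∈ v∈R′ with ∈⁅⁆∪⁻ u R′ v∈R′
      ... | inj₁ refl = ∈-∪-here u R
      ... | inj₂ v∈′  = R′⊆ v v∈′
      same : steiner T (⁅ u ⁆ ∪ R) ≡ steiner T (⁅ u ⁆ ∪ R′)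
      same = steiner-cong T fwd bwd

    -- If R is nonempty, then w is linked to u at the price of one edge. For empty R the Steiner
    -- tree is the single vertex w of weight 1, while z times the weight of u alone is z; the last
    -- summand makes up for the difference.
    weight-new : ∀ R → Supported vs R →
      steinerWeight (leaf T u∈ w∉ j) (⁅ w ⁆ ∪ R) ≡ z * steinerWeight T (⁅ u ⁆ ∪ R) + (1ℚ - z) * (1ℚ - χ vs R)
    weight-new R sR = cases (meets? R vs)
      where
      skip-w : ∀ v → v ≢ w → v ∈ˢ (⁅ w ⁆ ∪ R) → v ∈ˢ R
      skip-w v v≢w v∈ with ∈⁅⁆∪⁻ w R v∈
      ... | inj₁ v≡w = ⊥-elim (v≢w v≡w)
      ... | inj₂ v∈R = v∈R
      lem₁ : ∀ a z → a ≡ a + (1ℚ - z) * (1ℚ - 1ℚ)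
      lem₁ = solve-∀ ℚ-ring
      lem₂ : ∀ z → 1ℚ * 1ℚ ≡ z * (1ℚ * 1ℚ) + (1ℚ - z) * (1ℚ - 0ℚ)
      lem₂ = solve-∀ ℚ-ring
      cases : Dec (Any (_∈ˢ R) vs) → _
      cases (yes m) = trans (weight-attached (⁅ w ⁆ ∪ R) R (Any.map (∈-∪-there w R) m) skip-w (λ v v∈ → ∈-∪-there u _ (∈-∪-there w R v∈)) (∈-∪-here w R))
        (trans (lem₁ _ z) (cong (λ a → z * steinerWeight T (⁅ u ⁆ ∪ R) + (1ℚ - z) * (1ℚ - a)) (sym (χ-yes m))))
      cases (no ¬m) = trans (cong₂ (λ a S → a * z ^ℚ length S) (χ-yes {vs = w ∷ vs} (here (∈-∪-here w R)))
          (steiner-only T u∈ w∉ j (∈-∪-here w R) λ m → let v , v∈ , v∈R = find m in ¬m (lose v∈ (skip-w v (λ v≡w → w∉ (subst (_∈ vs) v≡w v∈)) v∈R))))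
        (trans (lem₂ z) (cong₂ (λ a b → z * a + (1ℚ - z) * (1ℚ - b))
          (sym (cong₂ (λ a S → a * z ^ℚ length S) (χ-yes (lose u∈ (∈-∪-here u R))) (⊆[]⇒≡[] (steiner-minimal T (⁅ u ⁆ ∪ R) [] trivial)))) (sym (χ-no ¬m))))
        where
        only-u : ∀ {x} → x ∈ vs → x ∈ˢ (⁅ u ⁆ ∪ R) → x ≡ u
        only-u x∈ x∈R′ with ∈⁅⁆∪⁻ u R x∈R′
        ... | inj₁ eq  = eq
        ... | inj₂ x∈R = ⊥-elim (¬m (lose x∈ x∈R))
        trivial : ∀ a b → a ∈ vs → a ∈ˢ (⁅ u ⁆ ∪ R) → b ∈ vs → b ∈ˢ (⁅ u ⁆ ∪ R) → Walk [] a b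
        trivial a b a∈ a∈R′ b∈ b∈R′ = subst₂ (Walk []) (sym (only-u a∈ a∈R′)) (sym (only-u b∈ b∈R′)) stop

    weight-both : ∀ R → steinerWeight (leaf T u∈ w∉ j) (⁅ w ⁆ ∪ (⁅ u ⁆ ∪ R)) ≡ z * steinerWeight T (⁅ u ⁆ ∪ R)
    weight-both R = trans
      (weight-attached (⁅ w ⁆ ∪ (⁅ u ⁆ ∪ R)) R′ (lose u∈ (∈-∪-there w _ (∈-∪-here u R))) skip-w
        (λ v v∈ → ∈-∪-there u _ (∈-∪-there w _ v∈)) (∈-∪-here w _))
      (cong (λ P → z * steinerWeight T P) (∪-absorb ⁅ u ⁆ R))
      where
      R′ : Subset n
      R′ = ⁅ u ⁆ ∪ R
      skip-w : ∀ v → v ≢ w → v ∈ˢ (⁅ w ⁆ ∪ R′) → v ∈ˢ R′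
      skip-w v v≢w v∈ with ∈⁅⁆∪⁻ w R′ v∈
      ... | inj₁ v≡w = ⊥-elim (v≢w v≡w)
      ... | inj₂ v∈R = v∈R

    -- The summands match the two cases in `terms`. For an edge outside of F, the factor 1 - z comes
    -- with a separate component w that contributes ω w. For an edge in F, the factor z comes with
    -- the contraction into u, whose weight absorbs ω w and the new loop q.
    steinerSum-leaf : ∀ ω → marked (leaf T u∈ w∉ j) q ω (steinerWeight (leaf T u∈ w∉ j)) ≡
      (1ℚ - z) * (marked T q ω (steinerWeight T) + ω w) + z * marked T q (ω [ u ↦ ω u ⊕ (ω w ⊕ q) ]) (steinerWeight T)
    steinerSum-leaf ω = begin
      marked T q ω (steinerWeight T′) + ω w * marked T q ω (λ R → steinerWeight T′ (⁅ w ⁆ ∪ R)) +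
      q * (1ℚ + ω w) * marked T q ω (λ R → steinerWeight T′ (⁅ w ⁆ ∪ (⁅ u ⁆ ∪ R)))
        ≡⟨ cong₂ _+_ (cong₂ (λ a b → a + ω w * b) (marked-cong T q ω (weight-old T u∈ w∉ j))
             (trans (marked-cong T q ω weight-new) (trans (marked-linear T q ω z (1ℚ - z) _ _) (cong (λ a → z * D + (1ℚ - z) * a) (marked-empty T q ω)))))
             (cong (_*_ (q * (1ℚ + ω w))) (trans (marked-cong T q ω λ R _ → trans (weight-both R) (lem₀ z _)) (trans (marked-linear T q ω z 0ℚ _ (λ _ → 0ℚ)) (lem₁ z D (marked T q ω (λ _ → 0ℚ)))))) ⟩
      M + ω w * (z * D + (1ℚ - z) * 1ℚ) + q * (1ℚ + ω w) * (z * D)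
        ≡⟨ lem₂ M (ω w) z D q ⟩
      (1ℚ - z) * (M + ω w) + z * (M + (ω w ⊕ q) * D)
        ≡⟨ cong (λ a → (1ℚ - z) * (M + ω w) + z * a) (sym (marked-extra T q ω u∈ (ω w ⊕ q) (steinerWeight T))) ⟩
      (1ℚ - z) * (M + ω w) + z * marked T q (ω [ u ↦ ω u ⊕ (ω w ⊕ q) ]) (steinerWeight T) ∎
      where
      open ≡-Reasoning
      T′ = leaf T u∈ w∉ j
      M D : ℚ
      M = marked T q ω (steinerWeight T)
      D = marked T q ω (λ R → steinerWeight T (⁅ u ⁆ ∪ R))
      lem₀ : ∀ z a → z * a ≡ z * a + 0ℚ * 0ℚ
      lem₀ = solve-∀ ℚ-ring
      lem₁ : ∀ z a b → z * a + 0ℚ * b ≡ z * a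
      lem₁ = solve-∀ ℚ-ring
      lem₂ : ∀ m o z d q → m + o * (z * d + (1ℚ - z) * 1ℚ) + q * (1ℚ + o) * (z * d) ≡
        (1ℚ - z) * (m + o) + z * (m + (o + q + o * q) * d)
      lem₂ = solve-∀ ℚ-ring

  -- A vertex of weight s stands for s - 1 contracted edges, of which we mark a nonempty set.
  loops : ℕ → ℚ
  loops s = (1ℚ + q) ^ℚ (s ℕ.∸ 1) - 1ℚ

  -- Since s + t - 1 = (s - 1) + (t - 1) + 1, the loops of both vertices are joined by one more, the
  -- contracted edge, which enters as q.
  loops-merge : ∀ s t → 1 ≤ s → 1 ≤ t → loops (s ℕ.+ t) ≡ loops s ⊕ (loops t ⊕ q)
  loops-merge (suc s) (suc t) _ _ = trans (cong (λ a → a - 1ℚ) (^ℚ-+ (1ℚ + q) s (suc t))) (lem q ((1ℚ + q) ^ℚ s) ((1ℚ + q) ^ℚ t))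
    where
    lem : ∀ q a b → a * ((1ℚ + q) * b) - 1ℚ ≡ (a - 1ℚ) + ((b - 1ℚ) + q + (b - 1ℚ) * q) + (a - 1ℚ) * ((b - 1ℚ) + q + (b - 1ℚ) * q)
    lem = solve-∀ ℚ-ring

  ∑-terms-leaf : ∀ {vs} {es : List (Edge n)} {u w e} (T : Growth vs es) (u∈ : u ∈ vs) (w∉ : w ∉ vs) (j : Joins e u w) wt
    (F : ℕ × ℕ × List ℕ → ℚ) → ∑ (terms (leaf T u∈ w∉ j) wt) F ≡
    ∑ (terms T wt) (λ (f , h , τ) → F (f , suc h , wt w ∷ τ)) + ∑ (terms T (merge wt u w)) (λ (f , h , τ) → F (suc f , h , τ))
  ∑-terms-leaf T u∈ w∉ j wt F = trans (∑-++ (map _ (terms T wt)) _ F) (cong₂ _+_ (∑-map _ (terms T wt) F) (∑-map _ (terms T _) F))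

  -- Each edge is put into F with weight z and left out with weight 1 - z. In `terms≡steinerSum`
  -- this sums up the constant contribution of a component that consists of the new leaf.
  terms-total : ∀ {vs} {es : List (Edge n)} (T : Growth vs es) wt →
    ∑ (terms T wt) (λ (f , h , τ) → z ^ℚ f * (1ℚ - z) ^ℚ h) ≡ 1ℚ
  terms-total (root r) wt = refl
  terms-total (leaf {u = u} {w} T u∈ w∉ j) wt = begin
    _ ≡⟨ ∑-terms-leaf T u∈ w∉ j wt _ ⟩
    ∑ (terms T wt) (λ (f , h , τ) → z ^ℚ f * ((1ℚ - z) * (1ℚ - z) ^ℚ h)) + ∑ (terms T (merge wt u w)) (λ (f , h , τ) → z * z ^ℚ f * (1ℚ - z) ^ℚ h)
      ≡⟨ cong₂ _+_ (trans (∑-cong (terms T wt) λ (f , h , τ) → lem₁ (z ^ℚ f) (1ℚ - z) ((1ℚ - z) ^ℚ h)) (∑-*ˡ (1ℚ - z) (terms T wt) _))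
           (trans (∑-cong (terms T _) λ (f , h , τ) → ℚₚ.*-assoc z (z ^ℚ f) ((1ℚ - z) ^ℚ h)) (∑-*ˡ z (terms T _) _)) ⟩
    _ ≡⟨ cong₂ (λ a b → (1ℚ - z) * a + z * b) (terms-total T wt) (terms-total T (merge wt u w)) ⟩
    (1ℚ - z) * 1ℚ + z * 1ℚ ≡⟨ lem₂ z ⟩
    1ℚ ∎
    where
    open ≡-Reasoning
    lem₁ : ∀ a b c → a * (b * c) ≡ b * (a * c)
    lem₁ = solve-∀ ℚ-ring
    lem₂ : ∀ z → (1ℚ - z) * 1ℚ + z * 1ℚ ≡ 1ℚ
    lem₂ = solve-∀ ℚ-ring

  terms≡steinerSum : ∀ {vs} {es : List (Edge n)} (T : Growth vs es) wt → (∀ v → 1 ≤ wt v) →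
    ∑ (terms T wt) (λ (f , h , τ) → z ^ℚ f * (1ℚ - z) ^ℚ h * ∑ τ loops) ≡ marked T q (loops ∘ wt) (steinerWeight T)
  terms≡steinerSum (root r) wt 1≤wt = trans (lem₀ (loops (wt r)))
    (sym (trans (cong₂ (λ a b → a * 1ℚ + loops (wt r) * (b * 1ℚ)) (χ-no {vs = [ r ]} λ { (here r∈) → Subₚ.∉⊥ r∈ }) (χ-yes {vs = [ r ]} (here (Subₚ.x∈⁅x⁆ r)))) (lem₁ (loops (wt r)))))
    where
    lem₀ : ∀ a → 1ℚ * 1ℚ * (a + 0ℚ) + 0ℚ ≡ a
    lem₀ = solve-∀ ℚ-ring
    lem₁ : ∀ a → 0ℚ * 1ℚ + a * (1ℚ * 1ℚ) ≡ a
    lem₁ = solve-∀ ℚ-ring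
  terms≡steinerSum (leaf {vs} {u = u} {w} T u∈ w∉ j) wt 1≤wt = begin
    _ ≡⟨ ∑-terms-leaf T u∈ w∉ j wt _ ⟩
    ∑ L₁ (λ (f , h , τ) → z ^ℚ f * ((1ℚ - z) * (1ℚ - z) ^ℚ h) * (loops (wt w) + ∑ τ loops)) + ∑ L₂ (λ (f , h , τ) → z * z ^ℚ f * (1ℚ - z) ^ℚ h * ∑ τ loops)
      ≡⟨ cong₂ _+_ (trans (∑-cong L₁ λ (f , h , τ) → lem₁ (z ^ℚ f) (1ℚ - z) ((1ℚ - z) ^ℚ h) (loops (wt w)) (∑ τ loops)) (∑-*ˡ (1ℚ - z) L₁ _))
           (trans (∑-cong L₂ λ (f , h , τ) → lem₂ z (z ^ℚ f) ((1ℚ - z) ^ℚ h) (∑ τ loops)) (∑-*ˡ z L₂ _)) ⟩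
    (1ℚ - z) * ∑ L₁ (λ (f , h , τ) → z ^ℚ f * (1ℚ - z) ^ℚ h * ∑ τ loops + loops (wt w) * (z ^ℚ f * (1ℚ - z) ^ℚ h)) +
    z * ∑ L₂ (λ (f , h , τ) → z ^ℚ f * (1ℚ - z) ^ℚ h * ∑ τ loops)
      ≡⟨ cong₂ (λ a b → (1ℚ - z) * a + z * b)
           (trans (∑-+ L₁ _ _) (cong₂ _+_ (terms≡steinerSum T wt 1≤wt) (trans (∑-*ˡ (loops (wt w)) L₁ _) (trans (cong (loops (wt w) *_) (terms-total T wt)) (ℚₚ.*-identityʳ _)))))
           (trans (terms≡steinerSum T (merge wt u w) 1≤merge) (marked-weight-cong T q merged (steinerWeight T))) ⟩
    (1ℚ - z) * (marked T q (loops ∘ wt) (steinerWeight T) + loops (wt w)) + z * marked T q ((loops ∘ wt) [ u ↦ loops (wt u) ⊕ (loops (wt w) ⊕ q) ]) (steinerWeight T)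
      ≡⟨ sym (steinerSum-leaf T u∈ w∉ j (loops ∘ wt)) ⟩
    _ ∎
    where
    open ≡-Reasoning
    L₁ L₂ : List (ℕ × ℕ × List ℕ)
    L₁ = terms T wt
    L₂ = terms T (merge wt u w)
    lem₁ : ∀ a b c g s → a * (b * c) * (g + s) ≡ b * (a * c * s + g * (a * c))
    lem₁ = solve-∀ ℚ-ring
    lem₂ : ∀ z a c s → z * a * c * s ≡ z * (a * c * s)
    lem₂ = solve-∀ ℚ-ring
    1≤merge : ∀ v → 1 ≤ merge wt u w v
    1≤merge v with v Fin.≟ u
    ... | yes refl = ℕₚ.≤-trans (1≤wt v) (ℕₚ.m≤m+n (wt v) (wt w))
    ... | no _     = 1≤wt v
    merged : ∀ v → v ∈ vs → loops (merge wt u w v) ≡ ((loops ∘ wt) [ u ↦ loops (wt u) ⊕ (loops (wt w) ⊕ q) ]) v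
    merged v _ with v Fin.≟ u
    ... | yes refl = loops-merge (wt v) (wt w) (1≤wt v) (1≤wt w)
    ... | no _     = refl

  terms≡∑subs : ∀ {vs} {es : List (Edge n)} (T : Growth vs es) →
    ∑ (terms T (λ _ → 1)) (λ (f , h , τ) → z ^ℚ f * (1ℚ - z) ^ℚ h * ∑ τ loops) ≡
    ∑ (subs es) (λ A → q ^ℚ length A * steinerWeight T (verts A))
  -- All weights are 1 at the start and `loops 1` computes to 0ℚ, so no vertex is marked.
  terms≡∑subs T = trans (terms≡steinerSum T (λ _ → 1) (λ _ → s≤s z≤n)) (marked-unmarked T q (steinerWeight T))

-- Binomial expansions

Polynomial : Set
Polynomial = List (ℚ × ℕ)

-- The linear functional that sends t^e to g e. Powers of x in place of g evaluate P at x, and `δ m`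
-- extracts a coefficient; like terms need not be collected for either.
pair : Polynomial → (ℕ → ℚ) → ℚ
pair P g = ∑ P (λ (d , e) → d * g e)

extract-≡ : (L : List A) (a : A → ℚ) (P : A → Polynomial) (M : List B) (b : B → ℚ) (Q : B → Polynomial) →
  (∀ t → ∑ L (λ i → a i * pair (P i) (ℕ→ℚ t ^ℚ_)) ≡ ∑ M (λ k → b k * pair (Q k) (ℕ→ℚ t ^ℚ_))) →
  ∀ g → ∑ L (λ i → a i * pair (P i) g) ≡ ∑ M (λ k → b k * pair (Q k) g)
extract-≡ {A} {B} L a P M b Q agree g = x-y≡0⇒x≡y _ _ (trans (sym (split g)) (extract Z proj₂ proj₁ vanish g))
  where
  scaled : ℚ → Polynomial → Polynomial
  scaled c = map λ (d , e) → c * d , e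
  pair-scaled : ∀ c R g → pair (scaled c R) g ≡ c * pair R g
  pair-scaled c R g = trans (∑-map _ R _) (trans (∑-cong R λ (d , e) → ℚₚ.*-assoc c d (g e)) (∑-*ˡ c R _))
  Z : Polynomial
  Z = concatMap (λ i → scaled (a i) (P i)) L ++ concatMap (λ k → scaled (- b k) (Q k)) M
  lem₁ : ∀ c d → (- c) * d ≡ (- 1ℚ) * (c * d)
  lem₁ = solve-∀ ℚ-ring
  lem₂ : ∀ c d → c + (- 1ℚ) * d ≡ c - d
  lem₂ = solve-∀ ℚ-ring
  split : ∀ g → pair Z g ≡ ∑ L (λ i → a i * pair (P i) g) - ∑ M (λ k → b k * pair (Q k) g)
  split g = trans (∑-++ (concatMap (λ i → scaled (a i) (P i)) L) _ _) (trans (cong₂ _+_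
    (trans (∑-concatMap _ L _) (∑-cong L λ i → pair-scaled (a i) (P i) g))
    (trans (∑-concatMap _ M _) (trans (∑-cong M λ k → trans (pair-scaled (- b k) (Q k) g) (lem₁ (b k) _)) (∑-*ˡ (- 1ℚ) M _))))
    (lem₂ (∑ L λ i → a i * pair (P i) g) _))
  vanish : ∀ t → pair Z (ℕ→ℚ t ^ℚ_) ≡ 0ℚ
  vanish t = trans (split (ℕ→ℚ t ^ℚ_)) (trans (cong (_- ∑ M (λ k → b k * pair (Q k) (ℕ→ℚ t ^ℚ_))) (agree t)) (ℚₚ.+-inverseʳ (∑ M (λ k → b k * pair (Q k) (ℕ→ℚ t ^ℚ_)))))

monomial : ℕ → Polynomial
monomial e = [ 1ℚ , e ]

pair-monomial : ∀ e g → pair (monomial e) g ≡ g e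
pair-monomial e g = lem (g e)
  where
  lem : ∀ a → 1ℚ * a + 0ℚ ≡ a
  lem = solve-∀ ℚ-ring

-- x^f (1 + c x)^h
binomial : ℚ → ℕ → ℕ → Polynomial
binomial c (suc f) h       = map (λ (d , e) → d , suc e) (binomial c f h)
binomial c zero    zero    = [ 1ℚ , 0 ]
binomial c zero    (suc h) = binomial c zero h ++ map (λ (d , e) → c * d , suc e) (binomial c zero h)

binomial-suc : ∀ c h g → pair (binomial c zero (suc h)) g ≡ pair (binomial c zero h) g + c * pair (binomial c zero h) (g ∘ suc)
binomial-suc c h g = trans (∑-++ (binomial c zero h) _ _) (cong (pair (binomial c zero h) g +_)
  (trans (∑-map _ (binomial c zero h) _) (trans (∑-cong (binomial c zero h) λ (d , e) → ℚₚ.*-assoc c d _) (∑-*ˡ c (binomial c zero h) _))))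

binomial-eval : ∀ c f h x → pair (binomial c f h) (x ^ℚ_) ≡ x ^ℚ f * (1ℚ + c * x) ^ℚ h
binomial-eval c (suc f) h x = trans (∑-map _ (binomial c f h) _) (trans (∑-cong (binomial c f h) λ (d , e) → lem d x (x ^ℚ e))
  (trans (∑-*ˡ x (binomial c f h) _) (trans (cong (x *_) (binomial-eval c f h x)) (sym (ℚₚ.*-assoc x _ _)))))
  where
  lem : ∀ d x y → d * (x * y) ≡ x * (d * y)
  lem = solve-∀ ℚ-ring
binomial-eval c zero zero x = refl
binomial-eval c zero (suc h) x = trans (binomial-suc c h (x ^ℚ_)) (trans
  (cong (λ a → pair (binomial c zero h) (x ^ℚ_) + c * a) (trans (∑-cong (binomial c zero h) λ (d , e) → lem d x (x ^ℚ e)) (∑-*ˡ x (binomial c zero h) _)))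
  (trans (cong (λ a → a + c * (x * a)) (binomial-eval c zero h x)) (lem′ c x ((1ℚ + c * x) ^ℚ h))))
  where
  lem : ∀ d x y → d * (x * y) ≡ x * (d * y)
  lem = solve-∀ ℚ-ring
  lem′ : ∀ c x y → 1ℚ * y + c * (x * (1ℚ * y)) ≡ 1ℚ * ((1ℚ + c * x) * y)
  lem′ = solve-∀ ℚ-ring

-- The binomial coefficient h C (m - f), which is 0 for m < f.
shiftedC : ℕ → ℕ → ℕ → ℕ
shiftedC zero    h m       = h C m
shiftedC (suc f) h zero    = 0
shiftedC (suc f) h (suc m) = shiftedC f h m

nC0≡1 : ∀ h → h C 0 ≡ 1
nC0≡1 h = trans (Comb.nCk≡nC[n∸k] {0} {h} z≤n) (Comb.nCn≡1 h)

pair-δ-suc : ∀ (P : Polynomial) → pair P (λ e → δ 0 (suc e)) ≡ 0ℚ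
pair-δ-suc P = trans (∑-cong P λ (d , e) → ℚₚ.*-zeroʳ d) (∑-zero P)

-- The coefficient is c^(m-f) C(h, m-f). For c² = 1 the power equals c^f c^m, which avoids the
-- subtraction; the cases c = -1 and c = 1 serve z and q.
binomial-coefficient : ∀ c → c * c ≡ 1ℚ → ∀ f h m →
  pair (binomial c f h) (δ m) ≡ c ^ℚ f * c ^ℚ m * ℕ→ℚ (shiftedC f h m)
binomial-coefficient c c²≡1 (suc f) h zero = trans (∑-map _ (binomial c f h) _)
  (trans (pair-δ-suc (binomial c f h)) (sym (ℚₚ.*-zeroʳ (c ^ℚ suc f * 1ℚ))))
binomial-coefficient c c²≡1 (suc f) h (suc m) = trans (∑-map _ (binomial c f h) _) (trans (binomial-coefficient c c²≡1 f h m)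
  (cong (_* ℕ→ℚ (shiftedC f h m)) (trans (lem₀ (c ^ℚ f) (c ^ℚ m)) (trans (cong (_* (c ^ℚ f * c ^ℚ m)) (sym c²≡1)) (lem c (c ^ℚ f) (c ^ℚ m))))))
  where
  lem₀ : ∀ a b → a * b ≡ 1ℚ * (a * b)
  lem₀ = solve-∀ ℚ-ring
  lem : ∀ c a b → c * c * (a * b) ≡ c * a * (c * b)
  lem = solve-∀ ℚ-ring
binomial-coefficient c c²≡1 zero zero zero = refl
binomial-coefficient c c²≡1 zero zero (suc m) = trans (lem (1ℚ * c ^ℚ suc m)) (cong (λ k → 1ℚ * c ^ℚ suc m * ℕ→ℚ k) (sym (Comb.k>n⇒nCk≡0 {0} {suc m} (s≤s z≤n))))
  where
  lem : ∀ a → 1ℚ * 0ℚ + 0ℚ ≡ a * 0ℚ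
  lem = solve-∀ ℚ-ring
binomial-coefficient c c²≡1 zero (suc h) zero = trans (binomial-suc c h (δ 0)) (trans
  (cong₂ (λ a b → a + c * b) (binomial-coefficient c c²≡1 zero h zero) (pair-δ-suc (binomial c zero h)))
  (trans (lem c (ℕ→ℚ (h C 0))) (cong (λ k → 1ℚ * 1ℚ * ℕ→ℚ k) (trans (nC0≡1 h) (sym (nC0≡1 (suc h)))))))
  where
  lem : ∀ c a → 1ℚ * 1ℚ * a + c * 0ℚ ≡ 1ℚ * 1ℚ * a
  lem = solve-∀ ℚ-ring
binomial-coefficient c c²≡1 zero (suc h) (suc m) = trans (binomial-suc c h (δ (suc m))) (trans
  (cong₂ (λ a b → a + c * b) (binomial-coefficient c c²≡1 zero h (suc m)) (binomial-coefficient c c²≡1 zero h m))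
  (trans (lem c (c ^ℚ m) (ℕ→ℚ (h C suc m)) (ℕ→ℚ (h C m))) (cong (1ℚ * c ^ℚ suc m *_)
    (trans (sym (ℕ→ℚ-+ (h C m) (h C suc m))) (cong ℕ→ℚ (Comb.nCk+nC[k+1]≡[n+1]C[k+1] h m))))))
  where
  lem : ∀ c p a b → 1ℚ * (c * p) * a + c * (1ℚ * p * b) ≡ 1ℚ * (c * p) * (b + a)
  lem = solve-∀ ℚ-ring

neg1^≡ : ∀ m → (- 1ℚ) ^ℚ m ≡ neg1^ m
neg1^≡ zero    = refl
neg1^≡ (suc m) = trans (lem _) (cong -_ (neg1^≡ m))
  where
  lem : ∀ a → (- 1ℚ) * a ≡ - a
  lem = solve-∀ ℚ-ring

alternating-coefficient : ∀ f h m → pair (binomial (- 1ℚ) f h) (δ m) ≡ neg1^ f * neg1^ m * ℕ→ℚ (shiftedC f h m)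
alternating-coefficient f h m = trans (binomial-coefficient (- 1ℚ) refl f h m)
  (cong (_* ℕ→ℚ (shiftedC f h m)) (cong₂ _*_ (neg1^≡ f) (neg1^≡ m)))

alternating-eval : ∀ f h x → pair (binomial (- 1ℚ) f h) (x ^ℚ_) ≡ x ^ℚ f * (1ℚ - x) ^ℚ h
alternating-eval f h x = trans (binomial-eval (- 1ℚ) f h x) (cong (λ a → x ^ℚ f * a ^ℚ h) (lem x))
  where
  lem : ∀ x → 1ℚ + (- 1ℚ) * x ≡ 1ℚ - x
  lem = solve-∀ ℚ-ring

shiftedC-< : ∀ f h m → m ℕ.< f → shiftedC f h m ≡ 0
shiftedC-< (suc f) h zero    _         = refl
shiftedC-< (suc f) h (suc m) (s≤s m<f) = shiftedC-< f h m m<f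

shiftedC-≥ : ∀ f h m → f ≤ m → shiftedC f h m ≡ h C (m ℕ.∸ f)
shiftedC-≥ zero    h m       _         = refl
shiftedC-≥ (suc f) h (suc m) (s≤s f≤m) = shiftedC-≥ f h m f≤m

-- With ℓ = h + 1 and n = f + h + 1 the lower index ℓ - n + m becomes m - f.
binomShift≡shiftedC : ∀ f h m → binomShift (suc h) (suc (f ℕ.+ h)) m ≡ shiftedC f h m
binomShift≡shiftedC f h m = cases (m ℕ.<? f)
  where
  test : Bool
  test = (suc h ℕ.+ m) ℕ.<ᵇ suc (f ℕ.+ h)
  cases : Dec (m ℕ.< f) → binomShift (suc h) (suc (f ℕ.+ h)) m ≡ shiftedC f h m
  cases (yes m<f) = trans (cong (λ b → if b then 0 else (h C ((suc h ℕ.+ m) ℕ.∸ suc (f ℕ.+ h)))) (test-true test (ℕₚ.<⇒<ᵇ lt))) (sym (shiftedC-< f h m m<f))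
    where
    lt : suc h ℕ.+ m ℕ.< suc (f ℕ.+ h)
    lt = s≤s (subst (h ℕ.+ m ℕ.<_) (ℕₚ.+-comm h f) (ℕₚ.+-monoʳ-< h m<f))
    test-true : ∀ b → T b → b ≡ true
    test-true true _ = refl
  cases (no m≮f) = trans (cong (λ b → if b then 0 else (h C ((suc h ℕ.+ m) ℕ.∸ suc (f ℕ.+ h)))) (test-false test (λ t → m≮f (gt (ℕₚ.<ᵇ⇒< (suc h ℕ.+ m) (suc (f ℕ.+ h)) t)))))
      (trans (cong (h C_) (trans (cong (h ℕ.+ m ℕ.∸_) (ℕₚ.+-comm f h)) (ℕₚ.[m+n]∸[m+o]≡n∸o h m f))) (sym (shiftedC-≥ f h m (ℕₚ.≮⇒≥ m≮f))))
    where
    gt : suc h ℕ.+ m ℕ.< suc (f ℕ.+ h) → m ℕ.< f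
    gt (s≤s lt) = ℕₚ.+-cancelˡ-< h m f (subst (h ℕ.+ m ℕ.<_) (ℕₚ.+-comm f h) lt)
    test-false : ∀ b → ¬ T b → b ≡ false
    test-false false _  = refl
    test-false true  ¬t = ⊥-elim (¬t tt)

loopsPolynomial : List ℕ → Polynomial
loopsPolynomial = concatMap λ s → (- 1ℚ , 0) ∷ binomial 1ℚ 0 (s ℕ.∸ 1)

loopsPolynomial-eval : ∀ q τ → pair (loopsPolynomial τ) (q ^ℚ_) ≡ ∑ τ (λ s → (1ℚ + q) ^ℚ (s ℕ.∸ 1) - 1ℚ)
loopsPolynomial-eval q τ = trans (∑-concatMap _ τ _) (∑-cong τ λ s →
  trans (cong (_+_ ((- 1ℚ) * 1ℚ)) (binomial-eval 1ℚ 0 (s ℕ.∸ 1) q))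
    (trans (lem ((1ℚ + 1ℚ * q) ^ℚ (s ℕ.∸ 1))) (cong (λ a → (1ℚ + a) ^ℚ (s ℕ.∸ 1) - 1ℚ) (ℚₚ.*-identityˡ q))))
  where
  lem : ∀ a → (- 1ℚ) * 1ℚ + 1ℚ * a ≡ a - 1ℚ
  lem = solve-∀ ℚ-ring

loopsPolynomial-coefficient : ∀ a τ → pair (loopsPolynomial τ) (δ (suc a)) ≡ ∑ τ (λ s → ℕ→ℚ ((s ℕ.∸ 1) C suc a))
loopsPolynomial-coefficient a τ = trans (∑-concatMap _ τ _) (∑-cong τ λ s →
  trans (cong (_+_ ((- 1ℚ) * 0ℚ)) (binomial-coefficient 1ℚ refl 0 (s ℕ.∸ 1) (suc a)))
    (trans (cong (λ b → (- 1ℚ) * 0ℚ + 1ℚ * b * ℕ→ℚ ((s ℕ.∸ 1) C suc a)) (1^ℚ (suc a))) (lem (ℕ→ℚ ((s ℕ.∸ 1) C suc a)))))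
  where
  lem : ∀ a → (- 1ℚ) * 0ℚ + 1ℚ * 1ℚ * a ≡ a
  lem = solve-∀ ℚ-ring

-- Coefficients of the connector polynomial

partSum≡∑ : ∀ τ d → ℕ→ℚ (partSum τ d) ≡ ∑ τ (λ s → ℕ→ℚ ((s ℕ.∸ 1) C d))
partSum≡∑ []      d = refl
partSum≡∑ (s ∷ τ) d = trans (ℕ→ℚ-+ ((s ℕ.∸ 1) C d) _) (cong (ℕ→ℚ ((s ℕ.∸ 1) C d) +_) (partSum≡∑ τ d))

terms-sizes : ∀ {vs} {es : List (Edge n)} (T : Growth vs es) wt → ∀ {f h τ} → (f , h , τ) ∈ terms T wt →
  f ℕ.+ h ≡ length es × length τ ≡ suc h
terms-sizes (root r) wt (here refl) = refl , refl
terms-sizes (leaf {u = u} {w} T u∈ w∉ j) wt t∈ with ∈-++⁻ (map _ (terms T wt)) t∈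
... | inj₁ t∈₁ with ∈-map⁻ _ t∈₁
...   | (f , h , τ) , s∈ , refl = trans (ℕₚ.+-suc f h) (cong suc (proj₁ (terms-sizes T wt s∈))) , cong suc (proj₂ (terms-sizes T wt s∈))
terms-sizes (leaf {u = u} {w} T u∈ w∉ j) wt t∈ | inj₂ t∈₂ with ∈-map⁻ _ t∈₂
...   | (f , h , τ) , s∈ , refl = cong suc (proj₁ (terms-sizes T _ s∈)) , proj₂ (terms-sizes T _ s∈)

-- The identity `terms≡∑subs` holds at all natural q and z. Extraction in z at fixed q replaces the
-- powers of z by g; extraction in q then replaces the powers of q by g′.
terms-coefficient : ∀ {vs} {es : List (Edge n)} (T : Growth vs es) (g g′ : ℕ → ℚ) →
  ∑ (terms T (λ _ → 1)) (λ (f , h , τ) → pair (binomial (- 1ℚ) f h) g * pair (loopsPolynomial τ) g′) ≡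
  ∑ (subs es) (λ A → χ vs (verts A) * (g (length (steiner T (verts A))) * g′ (length A)))
terms-coefficient {n} {vs} {es} T g g′ = begin
  ∑ Tₛ (λ (f , h , τ) → pair (binomial (- 1ℚ) f h) g * pair (loopsPolynomial τ) g′)
    ≡⟨ extract-≡ Tₛ (λ (f , h , τ) → pair (binomial (- 1ℚ) f h) g) (λ (f , h , τ) → loopsPolynomial τ)
         (subs es) (λ A → χ vs (verts A) * g (length (steiner T (verts A)))) (monomial ∘ length) in-q g′ ⟩
  ∑ (subs es) (λ A → χ vs (verts A) * g (length (steiner T (verts A))) * pair (monomial (length A)) g′)
    ≡⟨ ∑-cong (subs es) (λ A → trans (cong (χ vs (verts A) * g (length (steiner T (verts A))) *_) (pair-monomial (length A) g′)) (ℚₚ.*-assoc (χ vs (verts A)) _ _)) ⟩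
  ∑ (subs es) (λ A → χ vs (verts A) * (g (length (steiner T (verts A))) * g′ (length A))) ∎
  where
  open ≡-Reasoning
  Tₛ : List (ℕ × ℕ × List ℕ)
  Tₛ = terms T (λ _ → 1)
  lem′ : ∀ a b c → a * b * c ≡ b * c * a
  lem′ = solve-∀ ℚ-ring
  in-z : ∀ q z → ∑ Tₛ (λ (f , h , τ) → pair (loopsPolynomial τ) (ℕ→ℚ q ^ℚ_) * pair (binomial (- 1ℚ) f h) (ℕ→ℚ z ^ℚ_)) ≡
    ∑ (subs es) (λ A → ℕ→ℚ q ^ℚ length A * χ vs (verts A) * pair (monomial (length (steiner T (verts A)))) (ℕ→ℚ z ^ℚ_))
  in-z q z = begin
    _ ≡⟨ ∑-cong Tₛ (λ (f , h , τ) → trans (ℚₚ.*-comm (pair (loopsPolynomial τ) (ℕ→ℚ q ^ℚ_)) _)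
           (cong₂ _*_ (alternating-eval f h (ℕ→ℚ z)) (loopsPolynomial-eval (ℕ→ℚ q) τ))) ⟩
    _ ≡⟨ GeneratingFunction.terms≡∑subs (ℕ→ℚ q) (ℕ→ℚ z) T ⟩
    _ ≡⟨ ∑-cong (subs es) (λ A → trans (sym (ℚₚ.*-assoc (ℕ→ℚ q ^ℚ length A) (χ vs (verts A)) _))
           (cong (ℕ→ℚ q ^ℚ length A * χ vs (verts A) *_) (sym (pair-monomial (length (steiner T (verts A))) (ℕ→ℚ z ^ℚ_))))) ⟩
    _ ∎
  in-q : ∀ q → ∑ Tₛ (λ (f , h , τ) → pair (binomial (- 1ℚ) f h) g * pair (loopsPolynomial τ) (ℕ→ℚ q ^ℚ_)) ≡
    ∑ (subs es) (λ A → χ vs (verts A) * g (length (steiner T (verts A))) * pair (monomial (length A)) (ℕ→ℚ q ^ℚ_))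
  in-q q = begin
    _ ≡⟨ ∑-cong Tₛ (λ (f , h , τ) → ℚₚ.*-comm (pair (binomial (- 1ℚ) f h) g) _) ⟩
    _ ≡⟨ extract-≡ Tₛ (λ (f , h , τ) → pair (loopsPolynomial τ) (ℕ→ℚ q ^ℚ_)) (λ (f , h , τ) → binomial (- 1ℚ) f h)
           (subs es) (λ A → ℕ→ℚ q ^ℚ length A * χ vs (verts A)) (λ A → monomial (length (steiner T (verts A)))) (in-z q) g ⟩
    _ ≡⟨ ∑-cong (subs es) (λ A → trans (cong (ℕ→ℚ q ^ℚ length A * χ vs (verts A) *_) (pair-monomial (length (steiner T (verts A))) g))
           (trans (lem′ (ℕ→ℚ q ^ℚ length A) (χ vs (verts A)) _) (cong (χ vs (verts A) * g (length (steiner T (verts A))) *_) (sym (pair-monomial (length A) (ℕ→ℚ q ^ℚ_)))))) ⟩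
    _ ∎

-- The parameter m is the size a + b of A ∪ K(A). In this form the lemma also serves `φ`, where the
-- size is i and the number of edges of A varies.
coefficient-K : ∀ {vs} {es E : List (Edge n)} (T : Growth vs es) → 1 ≤ n →
  vs ↭ allFin n → es ↭ E → (c : List ℕ → ℚ) → IsPowerSumExpansion n E c → ∀ a m →
  ∑ (partitions n) (λ τ → neg1^ m * ℕ→ℚ (binomShift (length τ) n m) * ℕ→ℚ (partSum τ (suc a)) * c τ) ≡
  ∑ (subs es) (λ A → δ m (length (steiner T (verts A))) * δ (suc a) (length A))
coefficient-K {n} {vs} {es} T 1≤n vs↭ es↭ c expansion a m = begin
  ∑ (partitions n) (λ τ → neg1^ m * ℕ→ℚ (binomShift (length τ) n m) * ℕ→ℚ (partSum τ (suc a)) * c τ)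
    ≡⟨ ∑-cong (partitions n) to-functional ⟩
  ∑ (partitions n) (λ τ → c τ * (g₁ (length τ ℕ.∸ 1) * ∑ τ g₃))
    ≡⟨ expansion-functional T 1≤n vs↭ es↭ c expansion g₁ g₃ ⟩
  ∑ (terms T (λ _ → 1)) (λ (f , h , τ) → neg1^ f * (g₁ (length τ ℕ.∸ 1) * ∑ τ g₃))
    ≡⟨ ∑-cong-∈ (terms T (λ _ → 1)) to-pairs ⟩
  ∑ (terms T (λ _ → 1)) (λ (f , h , τ) → pair (binomial (- 1ℚ) f h) (δ m) * pair (loopsPolynomial τ) (δ (suc a)))
    ≡⟨ terms-coefficient T (δ m) (δ (suc a)) ⟩
  ∑ (subs es) (λ A → χ vs (verts A) * (δ m (length (steiner T (verts A))) * δ (suc a) (length A)))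
    ≡⟨ ∑-cong-∈ (subs es) drop-χ ⟩
  ∑ (subs es) (λ A → δ m (length (steiner T (verts A))) * δ (suc a) (length A)) ∎
  where
  open ≡-Reasoning
  -- `expansion-functional` needs a function of ℓ - 1. For τ = [] the argument 0 would be mistaken
  -- for ℓ = 1, but there the empty sum over the parts makes both sides 0.
  g₁ g₃ : ℕ → ℚ
  g₁ k = neg1^ m * ℕ→ℚ (binomShift (suc k) n m)
  g₃ s = ℕ→ℚ ((s ℕ.∸ 1) C suc a)
  lem₁ : ∀ a b → a * 0ℚ * b ≡ b * (a * 0ℚ)
  lem₁ = solve-∀ ℚ-ring
  to-functional : ∀ τ → neg1^ m * ℕ→ℚ (binomShift (length τ) n m) * ℕ→ℚ (partSum τ (suc a)) * c τ ≡ c τ * (g₁ (length τ ℕ.∸ 1) * ∑ τ g₃)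
  to-functional [] = trans (lem₂ (neg1^ m * ℕ→ℚ (binomShift 0 n m)) (c [])) (sym (lem₃ (c []) (g₁ 0)))
    where
    lem₂ : ∀ a b → a * 0ℚ * b ≡ 0ℚ
    lem₂ = solve-∀ ℚ-ring
    lem₃ : ∀ a b → a * (b * 0ℚ) ≡ 0ℚ
    lem₃ = solve-∀ ℚ-ring
  to-functional τ@(_ ∷ τ′) = trans (ℚₚ.*-comm (g₁ (length τ′) * ℕ→ℚ (partSum τ (suc a))) (c τ))
    (cong (λ b → c τ * (g₁ (length τ′) * b)) (partSum≡∑ τ (suc a)))
  to-pairs : ∀ t → t ∈ terms T (λ _ → 1) → (let (f , h , τ) = t in neg1^ f * (g₁ (length τ ℕ.∸ 1) * ∑ τ g₃) ≡
    pair (binomial (- 1ℚ) f h) (δ m) * pair (loopsPolynomial τ) (δ (suc a)))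
  to-pairs (f , h , τ) t∈ = begin
    neg1^ f * (g₁ (length τ ℕ.∸ 1) * ∑ τ g₃)
      ≡⟨ cong (λ k → neg1^ f * (g₁ (k ℕ.∸ 1) * ∑ τ g₃)) (proj₂ (terms-sizes T (λ _ → 1) t∈)) ⟩
    neg1^ f * (g₁ h * ∑ τ g₃)
      ≡⟨ cong (λ k → neg1^ f * (neg1^ m * ℕ→ℚ k * ∑ τ g₃)) (trans (cong (λ k → binomShift (suc h) k m) n≡) (binomShift≡shiftedC f h m)) ⟩
    neg1^ f * (neg1^ m * ℕ→ℚ (shiftedC f h m) * ∑ τ g₃)
      ≡⟨ lem₄ (neg1^ f) (neg1^ m) (ℕ→ℚ (shiftedC f h m)) (∑ τ g₃) ⟩
    neg1^ f * neg1^ m * ℕ→ℚ (shiftedC f h m) * ∑ τ g₃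
      ≡⟨ sym (cong₂ _*_ (alternating-coefficient f h m) (loopsPolynomial-coefficient a τ)) ⟩
    pair (binomial (- 1ℚ) f h) (δ m) * pair (loopsPolynomial τ) (δ (suc a)) ∎
    where
    n≡ : n ≡ suc (f ℕ.+ h)
    n≡ = trans (sym (trans (↭-length vs↭) (Listₚ.length-tabulate id))) (trans (growth-length T) (cong suc (sym (proj₁ (terms-sizes T (λ _ → 1) t∈)))))
    lem₄ : ∀ a b c d → a * (b * c * d) ≡ a * b * c * d
    lem₄ = solve-∀ ℚ-ring
  drop-χ : ∀ A → A ∈ subs es → χ vs (verts A) * (δ m (length (steiner T (verts A))) * δ (suc a) (length A)) ≡ δ m (length (steiner T (verts A))) * δ (suc a) (length A)
  drop-χ [] _ = trans (cong (χ vs ∅ *_) (ℚₚ.*-zeroʳ (δ m (length (steiner T ∅))))) (trans (ℚₚ.*-zeroʳ (χ vs ∅)) (sym (ℚₚ.*-zeroʳ (δ m (length (steiner T ∅))))))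
  drop-χ A@(e ∷ _) A∈ = trans (cong (_* X) (χ-yes (lose (proj₁ (growth-incident T e (All.head (∈subs⇒⊆ es A∈)))) (∈-verts⁺ {A = A} (e , here refl , inj₁ refl)))))
    (ℚₚ.*-identityˡ X)
    where
    X : ℚ
    X = δ m (length (steiner T (verts A))) * δ (suc a) (length A)

-- Edge sets between the leaf edges of a subtree and the subtree

𝟙-∧ : ∀ a b → 𝟙 (a ∧ b) ≡ 𝟙 a * 𝟙 b
𝟙-∧ true  b = sym (ℚₚ.*-identityˡ (𝟙 b))
𝟙-∧ false b = sym (ℚₚ.*-zeroˡ (𝟙 b))

𝟙-yes : {P : Set} (p? : Dec P) → P → 𝟙 (does p?) ≡ 1ℚ
𝟙-yes p? p = cong 𝟙 (dec-true p? p)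

𝟙-no : {P : Set} (p? : Dec P) → ¬ P → 𝟙 (does p?) ≡ 0ℚ
𝟙-no p? ¬p = cong 𝟙 (dec-false p? ¬p)

𝟙-⇔ : {P Q : Set} (p? : Dec P) (q? : Dec Q) → (P → Q) → (Q → P) → 𝟙 (does p?) ≡ 𝟙 (does q?)
𝟙-⇔ (yes p) q? P⇒Q Q⇒P = sym (𝟙-yes q? (P⇒Q p))
𝟙-⇔ (no ¬p) q? P⇒Q Q⇒P = sym (𝟙-no q? (¬p ∘ Q⇒P))

subs-unique : {xs : List A} → Unique xs → Unique (subs xs)
subs-unique {xs = []}     _          = [] ∷ []
subs-unique {xs = x ∷ xs} (x∉ ∷ xs!) = Uniqueₚ.++⁺ (subs-unique xs!) (Uniqueₚ.map⁺ Listₚ.∷-injectiveʳ (subs-unique xs!)) disjoint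
  where
  disjoint : ∀ {ys} → ¬ (ys ∈ subs xs × ys ∈ map (x ∷_) (subs xs))
  disjoint (ys∈ , ys∈′) with ∈-map⁻ (x ∷_) ys∈′
  ... | zs , _ , refl = All.lookup x∉ (All.head (∈subs⇒⊆ xs ys∈)) refl

_⊆?_ : (A B : List (Edge n)) → Dec (A ⊆ B)
A ⊆? B = All.all? (λ e → e ∈ᵉ? B) A

∑-subs-∷ : (x : A) (xs : List A) (F : List A → ℚ) → ∑ (subs (x ∷ xs)) F ≡ ∑ (subs xs) F + ∑ (subs xs) (λ A → F (x ∷ A))
∑-subs-∷ x xs F = trans (∑-++ (subs xs) _ F) (cong (∑ (subs xs) F +_) (∑-map (x ∷_) (subs xs) F))

∑-subs-⊆ : {es : List (Edge n)} → Unique es → ∀ {S} → S ∈ subs es → ∀ (F : List (Edge n) → ℚ) →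
  ∑ (subs es) (λ A → 𝟙 (does (A ⊆? S)) * F A) ≡ ∑ (subs S) F
∑-subs-⊆ {es = []} _ (here refl) F = cong (_+ 0ℚ) (ℚₚ.*-identityˡ (F []))
∑-subs-⊆ {es = e ∷ es} (e∉ ∷ es!) {S} S∈ F with ∈-++⁻ (subs es) S∈
... | inj₁ S∈₁ = trans (∑-subs-∷ e es _) (trans (cong₂ _+_ (∑-subs-⊆ es! S∈₁ F)
    (trans (∑-cong (subs es) λ A → trans (cong (_* F (e ∷ A)) (𝟙-no ((e ∷ A) ⊆? S) λ e∷A⊆ →
        All.lookup e∉ (All.lookup (∈subs⇒⊆ es S∈₁) (All.head e∷A⊆)) refl)) (ℚₚ.*-zeroˡ (F (e ∷ A)))) (∑-zero (subs es))))
  (ℚₚ.+-identityʳ _))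
... | inj₂ S∈₂ with ∈-map⁻ (e ∷_) S∈₂
...   | S′ , S′∈ , refl = trans (∑-subs-∷ e es _) (trans (cong₂ _+_
    (trans (∑-cong-∈ (subs es) λ A A∈ → cong (_* F A) (𝟙-⇔ (A ⊆? S) (A ⊆? S′) (⊆-drop (fresh A∈)) ⊆-there)) (∑-subs-⊆ es! S′∈ F))
    (trans (∑-cong-∈ (subs es) λ A A∈ → cong (_* F (e ∷ A)) (𝟙-⇔ ((e ∷ A) ⊆? S) (A ⊆? S′) (⊆-drop (fresh A∈) ∘ All.tail) (λ A⊆ → here refl ∷ ⊆-there A⊆)))
      (∑-subs-⊆ es! S′∈ (λ A → F (e ∷ A)))))
  (sym (∑-subs-∷ e S′ F)))
  where
  fresh : ∀ {A} → A ∈ subs es → All (e ≢_) A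
  fresh A∈ = All.map (All.lookup e∉) (∈subs⇒⊆ es A∈)

-- The sum factors over the edges of S: a selected edge must be in A and gives x, any other gives (1
-- - x) + x = 1. The selection ℓ is an arbitrary predicate because the leaf predicate depends on S
-- and would change in the induction.
∑-subs-⊇ : (x : ℚ) (ℓ : Edge n → Bool) {S : List (Edge n)} → Unique S →
  ∑ (subs S) (λ A → 𝟙 (does (filterᵇ ℓ S ⊆? A)) * (x ^ℚ length A * (1ℚ - x) ^ℚ (length S ℕ.∸ length A))) ≡ x ^ℚ length (filterᵇ ℓ S)
∑-subs-⊇ x ℓ {[]} _ = refl
∑-subs-⊇ x ℓ {e ∷ S} (e∉ ∷ S!) = trans (∑-subs-∷ e S _) (cases (ℓ e) refl)
  where
  W : List (Edge _) → ℚ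
  W A = x ^ℚ length A * (1ℚ - x) ^ℚ (length S ℕ.∸ length A)
  IH : ∑ (subs S) (λ A → 𝟙 (does (filterᵇ ℓ S ⊆? A)) * W A) ≡ x ^ℚ length (filterᵇ ℓ S)
  IH = ∑-subs-⊇ x ℓ S!
  fresh : All (e ≢_) (filterᵇ ℓ S)
  fresh = All.tabulate λ f∈ → All.lookup e∉ (proj₁ (∈-filter⁻ (T? ∘ ℓ) {xs = S} f∈))
  lem : ∀ i x w v → i * (x * w * v) ≡ x * (i * (w * v))
  lem = solve-∀ ℚ-ring
  lem₁ : ∀ i w y v → i * (w * (y * v)) ≡ y * (i * (w * v))
  lem₁ = solve-∀ ℚ-ring
  lem₂ : ∀ x a → (1ℚ - x) * a + x * a ≡ a
  lem₂ = solve-∀ ℚ-ring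
  with-e : (i : List (Edge _) → ℚ) → (∀ A → A ∈ subs S → i A ≡ 𝟙 (does (filterᵇ ℓ S ⊆? A))) →
    ∑ (subs S) (λ A → i A * (x ^ℚ suc (length A) * (1ℚ - x) ^ℚ (length S ℕ.∸ length A))) ≡ x * x ^ℚ length (filterᵇ ℓ S)
  with-e i i≡ = trans (∑-cong-∈ (subs S) λ A A∈ → trans (cong (_* (x ^ℚ suc (length A) * (1ℚ - x) ^ℚ (length S ℕ.∸ length A))) (i≡ A A∈))
      (lem (𝟙 (does (filterᵇ ℓ S ⊆? A))) x (x ^ℚ length A) _))
    (trans (∑-*ˡ x (subs S) _) (cong (x *_) IH))
  cases : ∀ b → ℓ e ≡ b →
    ∑ (subs S) (λ A → 𝟙 (does (filterᵇ ℓ (e ∷ S) ⊆? A)) * (x ^ℚ length A * (1ℚ - x) ^ℚ (suc (length S) ℕ.∸ length A))) +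
    ∑ (subs S) (λ A → 𝟙 (does (filterᵇ ℓ (e ∷ S) ⊆? (e ∷ A))) * (x ^ℚ suc (length A) * (1ℚ - x) ^ℚ (length S ℕ.∸ length A))) ≡
    x ^ℚ length (filterᵇ ℓ (e ∷ S))
  cases true ℓe rewrite ℓe = trans (cong₂ _+_
      (trans (∑-cong-∈ (subs S) λ A A∈ → trans (cong (_* (x ^ℚ length A * (1ℚ - x) ^ℚ (suc (length S) ℕ.∸ length A)))
          (𝟙-no ((e ∷ filterᵇ ℓ S) ⊆? A) λ ⊆A → All.lookup e∉ (All.lookup (∈subs⇒⊆ S A∈) (All.head ⊆A)) refl))
        (ℚₚ.*-zeroˡ (x ^ℚ length A * (1ℚ - x) ^ℚ (suc (length S) ℕ.∸ length A)))) (∑-zero (subs S)))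
      (with-e _ λ A A∈ → 𝟙-⇔ ((e ∷ filterᵇ ℓ S) ⊆? (e ∷ A)) (filterᵇ ℓ S ⊆? A) (⊆-drop fresh ∘ All.tail) (λ ⊆A → here refl ∷ ⊆-there ⊆A)))
    (ℚₚ.+-identityˡ _)
  cases false ℓe rewrite ℓe = trans (cong₂ _+_
      (trans (∑-cong-∈ (subs S) λ A A∈ → trans (cong (λ k → 𝟙 (does (filterᵇ ℓ S ⊆? A)) * (x ^ℚ length A * (1ℚ - x) ^ℚ k)) (ℕₚ.+-∸-assoc 1 (∈subs⇒length≤ S A∈)))
          (lem₁ (𝟙 (does (filterᵇ ℓ S ⊆? A))) (x ^ℚ length A) (1ℚ - x) _))
        (trans (∑-*ˡ (1ℚ - x) (subs S) _) (cong (_*_ (1ℚ - x)) IH)))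
      (with-e _ λ A A∈ → 𝟙-⇔ (filterᵇ ℓ S ⊆? (e ∷ A)) (filterᵇ ℓ S ⊆? A) (⊆-drop fresh) ⊆-there))
    (lem₂ x _)

∑-upTo-suc : ∀ j (F : ℕ → ℚ) → ∑ (upTo (suc j)) F ≡ F 0 + ∑ (upTo j) (F ∘ suc)
∑-upTo-suc j F = cong (F 0 +_) (trans (cong (λ ks → ∑ ks F) (sym (Listₚ.map-upTo suc j))) (∑-map suc (upTo j) F))

∑-upTo-δ : ∀ j k (F : ℕ → ℚ) → ∑ (upTo j) (λ d → F d * δ d k) ≡ (if k ℕ.<ᵇ j then F k else 0ℚ)
∑-upTo-δ zero    k       F = refl
∑-upTo-δ (suc j) zero    F = trans (∑-upTo-suc j λ d → F d * δ d 0) (trans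
  (cong (F 0 * 1ℚ +_) (trans (∑-cong (upTo j) λ d → ℚₚ.*-zeroʳ (F (suc d))) (∑-zero (upTo j)))) (lem (F 0)))
  where
  lem : ∀ a → a * 1ℚ + 0ℚ ≡ a
  lem = solve-∀ ℚ-ring
∑-upTo-δ (suc j) (suc k) F = trans (∑-upTo-suc j λ d → F d * δ d (suc k)) (trans
  (cong₂ _+_ (ℚₚ.*-zeroʳ (F 0)) (∑-upTo-δ j k (F ∘ suc))) (ℚₚ.+-identityˡ _))

shiftedC-if : ∀ f h m → ℕ→ℚ (shiftedC (suc f) h m) ≡ (if f ℕ.<ᵇ m then ℕ→ℚ (h C (m ℕ.∸ suc f)) else 0ℚ)
shiftedC-if f       h zero    = refl
shiftedC-if zero    h (suc m) = refl
shiftedC-if (suc f) h (suc m) = shiftedC-if f h m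

δ-subst : ∀ i k (F : ℕ → ℚ) → δ i k * F i ≡ δ i k * F k
δ-subst i k F with i ℕ.≡ᵇ k in eq
... | true  = cong (λ m → 1ℚ * F m) (ℕₚ.≡ᵇ⇒≡ i k (subst T (sym eq) tt))
... | false = trans (ℚₚ.*-zeroˡ (F i)) (sym (ℚₚ.*-zeroˡ (F k)))

module SubtreeSums {n} {vs : List (Fin n)} {es : List (Edge n)} (T : Growth vs es) (acyclic : ¬ Cycle es) where

  open Closure T acyclic
  open ClosureLeaves T acyclic

  nonempty? : (A : List (Edge n)) → Dec (A ≢ [])
  nonempty? []      = no λ A≢[] → A≢[] refl
  nonempty? (_ ∷ _) = yes λ ()

  _≟ˡ_ : (A B : List (Edge n)) → Dec (A ≡ B)
  _≟ˡ_ = Listₚ.≡-dec _≟ᵉ_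

  tree? : (S : List (Edge n)) → Dec (S ≢ [] × closure S ≡ S)
  tree? S = nonempty? S ×-dec (closure S ≟ˡ S)

  is-tree : ∀ {S} → S ∈ subs es → S ≢ [] × closure S ≡ S → IsTreeEdges S
  is-tree S∈ (S≢[] , eq) = closed⇒tree S∈ S≢[] eq

  tree-is : ∀ {S} → S ∈ subs es → IsTreeEdges S → S ≢ [] × closure S ≡ S
  tree-is S∈ (S≢[] , conn , _) = S≢[] , tree⇒closed S∈ conn

  ∑-closing : ∀ x {S} → S ∈ subs es →
    ∑ (subs es) (λ A → 𝟙 (does (nonempty? A)) * 𝟙 (does (closure A ≟ˡ S)) * (x ^ℚ length A * (1ℚ - x) ^ℚ (length S ℕ.∸ length A))) ≡
    𝟙 (does (tree? S)) * x ^ℚ length (leafEdges S)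
  ∑-closing x {S} S∈ = cases (tree? S)
    where
    W : List (Edge n) → ℚ
    W A = x ^ℚ length A * (1ℚ - x) ^ℚ (length S ℕ.∸ length A)
    closes? : ∀ A → Dec (A ≢ [] × closure A ≡ S)
    closes? A = nonempty? A ×-dec (closure A ≟ˡ S)
    cases : Dec (S ≢ [] × closure S ≡ S) →
      ∑ (subs es) (λ A → 𝟙 (does (nonempty? A)) * 𝟙 (does (closure A ≟ˡ S)) * W A) ≡ 𝟙 (does (tree? S)) * x ^ℚ length (leafEdges S)
    cases (no ¬tree) = trans (trans (∑-cong-∈ (subs es) λ A A∈ → trans (cong (_* W A) (trans (sym (𝟙-∧ (does (nonempty? A)) _))
        (𝟙-no (closes? A) λ (A≢[] , eq) → ¬tree (tree-is S∈ (proj₁ (closure≡⇒ A∈ A≢[] eq)))))) (ℚₚ.*-zeroˡ (W A))) (∑-zero (subs es)))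
      (sym (trans (cong (_* x ^ℚ length (leafEdges S)) (𝟙-no (tree? S) ¬tree)) (ℚₚ.*-zeroˡ (x ^ℚ length (leafEdges S)))))
    cases (yes tree) = trans (∑-cong-∈ (subs es) λ A A∈ → trans (cong (_* W A) (trans (sym (𝟙-∧ (does (nonempty? A)) _))
        (trans (𝟙-⇔ (closes? A) (A ⊆? S ×-dec leafEdges S ⊆? A)
          (λ (A≢[] , eq) → let _ , L⊆A , A⊆S = closure≡⇒ A∈ A≢[] eq in A⊆S , L⊆A)
          (λ (A⊆S , L⊆A) → nonempty L⊆A , closure≡⇐ S∈ (nonempty L⊆A) tree′ L⊆A A⊆S))
          (𝟙-∧ (does (A ⊆? S)) _)))) (ℚₚ.*-assoc (𝟙 (does (A ⊆? S))) _ (W A)))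
      (trans (∑-subs-⊆ es-unique S∈ (λ A → 𝟙 (does (leafEdges S ⊆? A)) * W A))
      (trans (∑-subs-⊇ x (leafᵇ S) (∈subs⇒unique es-unique S∈))
      (sym (trans (cong (_* x ^ℚ length (leafEdges S)) (𝟙-yes (tree? S) tree)) (ℚₚ.*-identityˡ (x ^ℚ length (leafEdges S)))))))
      where
      tree′ : IsTreeEdges S
      tree′ = is-tree S∈ tree
      nonempty : ∀ {A} → leafEdges S ⊆ A → A ≢ []
      nonempty L⊆A refl = tree-has-leaf S∈ tree′ (⊆[]⇒≡[] L⊆A)

  -- The sets A are sorted by their closure S. Within a class, δ forces i to be the number of edges
  -- of S, so `∑-closing` applies.
  ∑-by-closure : ∀ i x →
    ∑ (subs es) (λ A → 𝟙 (does (nonempty? A)) * δ i (length (closure A)) * (x ^ℚ length A * (1ℚ - x) ^ℚ (i ℕ.∸ length A))) ≡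
    ∑ (subs es) (λ S → 𝟙 (does (tree? S)) * δ i (length S) * x ^ℚ length (leafEdges S))
  ∑-by-closure i x = begin
    ∑ (subs es) (λ A → 𝟙 (does (nonempty? A)) * δ i (length (closure A)) * W i A)
      ≡⟨ ∑-cong (subs es) (λ A → sym (∑-select _≟ˡ_ (subs es) (subs-unique es-unique) (closure A) (closure∈subs A)
           (λ S → 𝟙 (does (nonempty? A)) * δ i (length S) * W i A))) ⟩
    ∑ (subs es) (λ A → ∑ (subs es) (λ S → 𝟙 (does (closure A ≟ˡ S)) * (𝟙 (does (nonempty? A)) * δ i (length S) * W i A)))
      ≡⟨ ∑-swap (subs es) (subs es) _ ⟩
    ∑ (subs es) (λ S → ∑ (subs es) (λ A → 𝟙 (does (closure A ≟ˡ S)) * (𝟙 (does (nonempty? A)) * δ i (length S) * W i A)))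
      ≡⟨ ∑-cong-∈ (subs es) (λ S S∈ → trans (trans (∑-cong (subs es) λ A → trans (at-length A S)
           (lem (𝟙 (does (closure A ≟ˡ S))) (𝟙 (does (nonempty? A))) (δ i (length S)) (W (length S) A))) (∑-*ˡ (δ i (length S)) (subs es) _))
           (trans (cong (δ i (length S) *_) (∑-closing x S∈)) (lem′ (δ i (length S)) (𝟙 (does (tree? S))) _))) ⟩
    ∑ (subs es) (λ S → 𝟙 (does (tree? S)) * δ i (length S) * x ^ℚ length (leafEdges S)) ∎
    where
    open ≡-Reasoning
    W : ℕ → List (Edge n) → ℚ
    W k A = x ^ℚ length A * (1ℚ - x) ^ℚ (k ℕ.∸ length A)
    lem : ∀ c a d w → c * (a * d * w) ≡ d * (a * c * w)
    lem = solve-∀ ℚ-ring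
    lem′ : ∀ d a w → d * (a * w) ≡ a * d * w
    lem′ = solve-∀ ℚ-ring
    at-length : ∀ A S → 𝟙 (does (closure A ≟ˡ S)) * (𝟙 (does (nonempty? A)) * δ i (length S) * W i A) ≡
      𝟙 (does (closure A ≟ˡ S)) * (𝟙 (does (nonempty? A)) * δ i (length S) * W (length S) A)
    at-length A S = cong (𝟙 (does (closure A ≟ˡ S)) *_) (trans (ℚₚ.*-assoc (𝟙 (does (nonempty? A))) _ _)
      (trans (cong (𝟙 (does (nonempty? A)) *_) (δ-subst i (length S) (λ k → W k A))) (sym (ℚₚ.*-assoc (𝟙 (does (nonempty? A))) _ _))))

  -- The coefficient of x^j in `∑-by-closure`. A set A of d edges contributes (-1)^(d+j) C(i-d,
  -- j-d), which is where the inner coefficients of `φ` come from.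
  ∑-alternating : ∀ i j →
    ∑ (subs es) (λ A → 𝟙 (does (nonempty? A)) * δ i (length (closure A)) * (neg1^ (length A) * neg1^ j * ℕ→ℚ (shiftedC (length A) (i ℕ.∸ length A) j))) ≡
    ∑ (subs es) (λ S → 𝟙 (does (tree? S)) * δ i (length S) * δ j (length (leafEdges S)))
  ∑-alternating i j = begin
    _ ≡⟨ ∑-cong (subs es) (λ A → cong (𝟙 (does (nonempty? A)) * δ i (length (closure A)) *_) (sym (alternating-coefficient (length A) (i ℕ.∸ length A) j))) ⟩
    _ ≡⟨ extract-≡ (subs es) (λ A → 𝟙 (does (nonempty? A)) * δ i (length (closure A))) (λ A → binomial (- 1ℚ) (length A) (i ℕ.∸ length A))
           (subs es) (λ S → 𝟙 (does (tree? S)) * δ i (length S)) (monomial ∘ length ∘ leafEdges) (λ t →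
             trans (∑-cong (subs es) λ A → cong (𝟙 (does (nonempty? A)) * δ i (length (closure A)) *_) (alternating-eval (length A) (i ℕ.∸ length A) (ℕ→ℚ t)))
             (trans (∑-by-closure i (ℕ→ℚ t))
             (∑-cong (subs es) λ S → cong (𝟙 (does (tree? S)) * δ i (length S) *_) (sym (pair-monomial (length (leafEdges S)) (ℕ→ℚ t ^ℚ_)))))) (δ j) ⟩
    _ ≡⟨ ∑-cong (subs es) (λ S → cong (𝟙 (does (tree? S)) * δ i (length S) *_) (pair-monomial (length (leafEdges S)) (δ j))) ⟩
    _ ∎
    where open ≡-Reasoning

  -- Formally, `φ` at (i, j) is the sum over d of (-1)^(j+d) C(i-d, j-d) times `ψ` at (d, i-d). So
  -- `coefficient-K` applies for each d, with the size fixed at i.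
  coefficient-S : ∀ {E} → 1 ≤ n → vs ↭ allFin n → es ↭ E → (c : List ℕ → ℚ) → IsPowerSumExpansion n E c → ∀ i j →
    ∑ (partitions n) (λ τ → φ n τ i j * c τ) ≡
    ∑ (subs es) (λ S → 𝟙 (does (tree? S)) * δ i (length S) * δ j (length (leafEdges S)))
  coefficient-S 1≤n vs↭ es↭ c expansion i j = begin
    ∑ (partitions n) (λ τ → φ n τ i j * c τ)
      ≡⟨ ∑-cong (partitions n) expand-φ ⟩
    ∑ (partitions n) (λ τ → ∑ (upTo j) (λ d → a d * K d τ))
      ≡⟨ ∑-swap (partitions n) (upTo j) _ ⟩
    ∑ (upTo j) (λ d → ∑ (partitions n) (λ τ → a d * K d τ))
      ≡⟨ ∑-cong (upTo j) (λ d → trans (∑-*ˡ (a d) (partitions n) (K d)) (trans (cong (a d *_) (coefficient-K T 1≤n vs↭ es↭ c expansion d i))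
           (sym (∑-*ˡ (a d) (subs es) _)))) ⟩
    ∑ (upTo j) (λ d → ∑ (subs es) (λ A → a d * (δ i (length (closure A)) * δ (suc d) (length A))))
      ≡⟨ ∑-swap (upTo j) (subs es) _ ⟩
    ∑ (subs es) (λ A → ∑ (upTo j) (λ d → a d * (δ i (length (closure A)) * δ (suc d) (length A))))
      ≡⟨ ∑-cong (subs es) collapse ⟩
    _ ≡⟨ ∑-alternating i j ⟩
    ∑ (subs es) (λ S → 𝟙 (does (tree? S)) * δ i (length S) * δ j (length (leafEdges S))) ∎
    where
    open ≡-Reasoning
    a : ℕ → ℚ
    a d = neg1^ j * (neg1^ (suc d) * ℕ→ℚ ((i ℕ.∸ suc d) C (j ℕ.∸ suc d)))
    K : ℕ → List ℕ → ℚ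
    K d τ = neg1^ i * ℕ→ℚ (binomShift (length τ) n i) * ℕ→ℚ (partSum τ (suc d)) * c τ
    neg1^-+ : ∀ k l → neg1^ (k ℕ.+ l) ≡ neg1^ k * neg1^ l
    neg1^-+ k l = trans (sym (neg1^≡ (k ℕ.+ l))) (trans (^ℚ-+ (- 1ℚ) k l) (cong₂ _*_ (neg1^≡ k) (neg1^≡ l)))
    expand-φ : ∀ τ → φ n τ i j * c τ ≡ ∑ (upTo j) (λ d → a d * K d τ)
    expand-φ τ = begin
      neg1^ (i ℕ.+ j) * bin * sumℚ (map G (map suc (upTo j))) * c τ
        ≡⟨ cong₂ (λ s t → s * bin * t * c τ) (neg1^-+ i j) (trans (sumℚ-map (map suc (upTo j)) G) (∑-map suc (upTo j) G)) ⟩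
      neg1^ i * neg1^ j * bin * ∑ (upTo j) (G ∘ suc) * c τ
        ≡⟨ lem₁ (neg1^ i) (neg1^ j) bin _ (c τ) ⟩
      neg1^ i * neg1^ j * bin * c τ * ∑ (upTo j) (G ∘ suc)
        ≡⟨ sym (∑-*ˡ (neg1^ i * neg1^ j * bin * c τ) (upTo j) (G ∘ suc)) ⟩
      ∑ (upTo j) (λ d → neg1^ i * neg1^ j * bin * c τ * G (suc d))
        ≡⟨ ∑-cong (upTo j) (λ d → lem₂ (neg1^ i) (neg1^ j) bin (c τ) (neg1^ (suc d)) (ℕ→ℚ ((i ℕ.∸ suc d) C (j ℕ.∸ suc d))) (ℕ→ℚ (partSum τ (suc d)))) ⟩
      ∑ (upTo j) (λ d → a d * K d τ) ∎
      where
      bin : ℚ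
      bin = ℕ→ℚ (binomShift (length τ) n i)
      G : ℕ → ℚ
      G d = neg1^ d * ℕ→ℚ ((i ℕ.∸ d) C (j ℕ.∸ d)) * ℕ→ℚ (partSum τ d)
      lem₁ : ∀ p q b s c → p * q * b * s * c ≡ p * q * b * c * s
      lem₁ = solve-∀ ℚ-ring
      lem₂ : ∀ p q b c r k s → p * q * b * c * (r * k * s) ≡ q * (r * k) * (p * b * s * c)
      lem₂ = solve-∀ ℚ-ring
    -- The index d stands for d + 1 in `φ`, so a nonempty A meets only d = |A| - 1, and the empty
    -- one meets none. The bound |A| ≤ j of the summation range is matched by the vanishing of
    -- `shiftedC` for |A| > j.
    collapse : ∀ A → ∑ (upTo j) (λ d → a d * (δ i (length (closure A)) * δ (suc d) (length A))) ≡
      𝟙 (does (nonempty? A)) * δ i (length (closure A)) * (neg1^ (length A) * neg1^ j * ℕ→ℚ (shiftedC (length A) (i ℕ.∸ length A) j))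
    collapse [] = trans (trans (∑-cong (upTo j) λ d → lem₃ (a d) (δ i (length (closure [])))) (∑-zero (upTo j)))
      (sym (lem₄ (δ i (length (closure []))) (1ℚ * neg1^ j * ℕ→ℚ (shiftedC 0 i j))))
      where
      lem₃ : ∀ a b → a * (b * 0ℚ) ≡ 0ℚ
      lem₃ = solve-∀ ℚ-ring
      lem₄ : ∀ a b → 0ℚ * a * b ≡ 0ℚ
      lem₄ = solve-∀ ℚ-ring
    collapse A@(_ ∷ A′) = begin
      ∑ (upTo j) (λ d → a d * (δ i (length (closure A)) * δ d k))
        ≡⟨ trans (∑-cong (upTo j) λ d → lem₅ (a d) (δ i (length (closure A))) (δ d k)) (∑-*ˡ (δ i (length (closure A))) (upTo j) _) ⟩
      δ i (length (closure A)) * ∑ (upTo j) (λ d → a d * δ d k)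
        ≡⟨ cong (δ i (length (closure A)) *_) (trans (∑-upTo-δ j k a) (pull (k ℕ.<ᵇ j) _)) ⟩
      δ i (length (closure A)) * (neg1^ j * (neg1^ (suc k) * (if k ℕ.<ᵇ j then ℕ→ℚ ((i ℕ.∸ suc k) C (j ℕ.∸ suc k)) else 0ℚ)))
        ≡⟨ cong (λ s → δ i (length (closure A)) * (neg1^ j * (neg1^ (suc k) * s))) (sym (shiftedC-if k (i ℕ.∸ suc k) j)) ⟩
      δ i (length (closure A)) * (neg1^ j * (neg1^ (suc k) * ℕ→ℚ (shiftedC (suc k) (i ℕ.∸ suc k) j)))
        ≡⟨ lem₆ (δ i (length (closure A))) (neg1^ j) (neg1^ (suc k)) _ ⟩
      1ℚ * δ i (length (closure A)) * (neg1^ (suc k) * neg1^ j * ℕ→ℚ (shiftedC (suc k) (i ℕ.∸ suc k) j)) ∎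
      where
      k : ℕ
      k = length A′
      lem₅ : ∀ a d e → a * (d * e) ≡ d * (a * e)
      lem₅ = solve-∀ ℚ-ring
      lem₆ : ∀ d p r s → d * (p * (r * s)) ≡ 1ℚ * d * (r * p * s)
      lem₆ = solve-∀ ℚ-ring
      lem₇ : ∀ p r → p * (r * 0ℚ) ≡ 0ℚ
      lem₇ = solve-∀ ℚ-ring
      pull : ∀ b s → (if b then neg1^ j * (neg1^ (suc k) * s) else 0ℚ) ≡ neg1^ j * (neg1^ (suc k) * (if b then s else 0ℚ))
      pull true  s = refl
      pull false s = sym (lem₇ (neg1^ j) (neg1^ (suc k)))

-- Counting

count-cong : {P Q : A → Set} {xs : List A} {k : ℕ} → (∀ x → x ∈ xs → (P x → Q x) × (Q x → P x)) →
  Count P xs k → Count Q xs k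
count-cong P⇔Q nil         = nil
count-cong P⇔Q (here p c)  = here (proj₁ (P⇔Q _ (here refl)) p) (count-cong (λ x x∈ → P⇔Q x (there x∈)) c)
count-cong P⇔Q (skip ¬p c) = skip (¬p ∘ proj₂ (P⇔Q _ (here refl))) (count-cong (λ x x∈ → P⇔Q x (there x∈)) c)

count-++ : {P : A → Set} {xs ys : List A} {k l : ℕ} → Count P xs k → Count P ys l → Count P (xs ++ ys) (k ℕ.+ l)
count-++ nil         d = d
count-++ (here p c)  d = here p (count-++ c d)
count-++ (skip ¬p c) d = skip ¬p (count-++ c d)

count-++⁻ : {P : A → Set} (xs : List A) {ys : List A} {m : ℕ} → Count P (xs ++ ys) m →
  ∃ λ k → ∃ λ l → m ≡ k ℕ.+ l × Count P xs k × Count P ys l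
count-++⁻ []       c = 0 , _ , refl , nil , c
count-++⁻ (x ∷ xs) (here p c) with count-++⁻ xs c
... | k , l , refl , c₁ , c₂ = suc k , l , refl , here p c₁ , c₂
count-++⁻ (x ∷ xs) (skip ¬p c) with count-++⁻ xs c
... | k , l , refl , c₁ , c₂ = k , l , refl , skip ¬p c₁ , c₂

count-map : {P : B → Set} (h : A → B) {xs : List A} {k : ℕ} → Count (P ∘ h) xs k → Count P (map h xs) k
count-map h nil         = nil
count-map h (here p c)  = here p (count-map h c)
count-map h (skip ¬p c) = skip ¬p (count-map h c)

count-map⁻ : {P : B → Set} (h : A → B) (xs : List A) {k : ℕ} → Count P (map h xs) k → Count (P ∘ h) xs k
count-map⁻ h []       nil         = nil
count-map⁻ h (x ∷ xs) (here p c)  = here p (count-map⁻ h xs c)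
count-map⁻ h (x ∷ xs) (skip ¬p c) = skip ¬p (count-map⁻ h xs c)

PermutationInvariant : (List A → Set) → Set
PermutationInvariant P = ∀ {xs ys} → xs ↭ ys → P xs → P ys

-- Permuting a list reorders its sublists and also permutes the entries within them, whence the
-- invariance demanded of P.
count-subs-↭ : {xs ys : List A} → xs ↭ ys → {P : List A → Set} → PermutationInvariant P →
  ∀ {k} → Count P (subs xs) k → Count P (subs ys) k
count-subs-↭ ↭.refl        inv c = c
count-subs-↭ (↭.trans p q) inv c = count-subs-↭ q inv (count-subs-↭ p inv c)
count-subs-↭ (↭.prep {xs} x p) inv c with count-++⁻ (subs xs) c
... | k , l , refl , c₁ , c₂ = count-++ (count-subs-↭ p inv c₁)
        (count-map (x ∷_) (count-subs-↭ p (inv ∘ ↭.prep x) (count-map⁻ (x ∷_) (subs xs) c₂)))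
count-subs-↭ (↭.swap {xs} {ys} x y p) {P} inv c with count-++⁻ (subs xs ++ map (y ∷_) (subs xs)) c
... | m , m′ , refl , c₁ , c₂ with count-++⁻ (subs xs) c₁ | count-++⁻ (subs xs) (count-map⁻ (x ∷_) (subs xs ++ map (y ∷_) (subs xs)) c₂)
...   | k , k′ , refl , d₁ , d₂ | l , l′ , refl , e₁ , e₂ = subst (Count P _) (lem k k′ l l′)
  (count-++ (count-++ (count-subs-↭ p inv d₁) (count-map (x ∷_) (count-subs-↭ p (inv ∘ ↭.prep x) e₁)))
    (count-map (y ∷_) (count-++ (count-subs-↭ p (inv ∘ ↭.prep y) (count-map⁻ (y ∷_) (subs xs) d₂))
      (count-map (x ∷_) (count-cong (λ A _ → inv (↭.swap x y ↭.refl) , inv (↭.swap y x ↭.refl))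
        (count-subs-↭ p (inv ∘ ↭.prep x ∘ ↭.prep y) (count-map⁻ (y ∷_) (subs xs) e₂)))))))
  where
  lem : ∀ k k′ l l′ → (k ℕ.+ l) ℕ.+ (k′ ℕ.+ l′) ≡ (k ℕ.+ k′) ℕ.+ (l ℕ.+ l′)
  lem k k′ l l′ = trans (ℕₚ.+-assoc k l _) (trans (cong (k ℕ.+_) (trans (sym (ℕₚ.+-assoc l k′ l′))
    (trans (cong (ℕ._+ l′) (ℕₚ.+-comm l k′)) (ℕₚ.+-assoc k′ l l′)))) (sym (ℕₚ.+-assoc k k′ _)))

countIs-∑ : {P : A → Set} (b : A → Bool) (xs : List A) → (∀ x → x ∈ xs → (P x → T (b x)) × (T (b x) → P x)) →
  CountIs P xs (∑ xs (𝟙 ∘ b))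
countIs-∑ b []       P⇔b = 0 , nil , refl
countIs-∑ b (x ∷ xs) P⇔b with b x | P⇔b x (here refl) | countIs-∑ b xs (λ y y∈ → P⇔b y (there y∈))
... | true  | _ , b⇒P | k , c , eq = suc k , here (b⇒P tt) c , trans (ℕ→ℚ-+ 1 k) (cong (1ℚ +_) eq)
... | false | P⇒b , _ | k , c , eq = k , skip P⇒b c , trans eq (sym (ℚₚ.+-identityˡ _))

countIs-none : {P : A → Set} (xs : List A) → (∀ x → x ∈ xs → ¬ P x) → CountIs P xs 0ℚ
countIs-none []       none = 0 , nil , refl
countIs-none (x ∷ xs) none with countIs-none xs (λ y y∈ → none y (there y∈))
... | k , c , eq = k , skip (none x (here refl)) c , eq

countIs-if : {P : A → Set} (xs : List A) (b : Bool) {r : ℚ} → CountIs P xs r → (∀ x → x ∈ xs → P x → T b) →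
  CountIs P xs (if b then r else 0ℚ)
countIs-if xs true  counted P⇒b = counted
countIs-if xs false counted P⇒b = countIs-none xs P⇒b

countIs-map : {P : A → Set} {Q : B → Set} {xs : List A} {ys : List B} {r : ℚ} →
  (∀ {k} → Count P xs k → Count Q ys k) → CountIs P xs r → CountIs Q ys r
countIs-map f (k , counted , eq) = k , f counted , eq

-- Invariance under reordering of the edges

↭⇒⊆ : {xs ys : List A} → xs ↭ ys → xs ⊆ ys
↭⇒⊆ p = All.tabulate (∈-resp-↭ p)

isTreeEdges-++ : {A A′ K : List (Edge n)} → A ↭ A′ → IsTreeEdges (A ++ K) → IsTreeEdges (A′ ++ K)
isTreeEdges-++ {K = K} p = isTreeEdges-cong (↭⇒⊆ (↭ₚ.++⁺ʳ K p)) (↭⇒⊆ (↭ₚ.++⁺ʳ K (↭-sym p)))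

nonempty-↭ : {xs ys : List A} → xs ↭ ys → xs ≢ [] → ys ≢ []
nonempty-↭ p xs≢[] refl = xs≢[] (⊆[]⇒≡[] (↭⇒⊆ p))

connectorWith-invariant : ∀ {es : List (Edge n)} a b → PermutationInvariant (ConnectorWith es a b)
connectorWith-invariant a b p (A≢[] , |A| , K , (K⊆ , K! , disjoint , tree , minimal) , |K|) =
  nonempty-↭ p A≢[] , trans (sym (↭-length p)) |A| , K ,
  (K⊆ , K! , All.map (_∘ ∈-resp-↭ (↭-sym p)) disjoint , isTreeEdges-++ p tree , λ K′ K′⊆ tree′ → minimal K′ K′⊆ (isTreeEdges-++ (↭-sym p) tree′)) , |K|

connectorWith-edges : ∀ {es E : List (Edge n)} → es ↭ E → ∀ {a b A} → ConnectorWith es a b A → ConnectorWith E a b A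
connectorWith-edges es↭ (A≢[] , |A| , K , (K⊆ , rest) , |K|) = A≢[] , |A| , K , (⊆-trans K⊆ (↭⇒⊆ es↭) , rest) , |K|

leafEdges-↭ : {S S′ : List (Edge n)} → S ↭ S′ → length (leafEdges S) ≡ length (leafEdges S′)
leafEdges-↭ {S = S} {S′} p = trans (↭-length (filter-↭ (T? ∘ leafᵇ S) p)) (cong length (Listₚ.filter-≐ (T? ∘ leafᵇ S) (T? ∘ leafᵇ S′)
  ((λ {e} → subst T (same e)) , (λ {e} → subst T (sym (same e)))) S′))
  where
  deg-↭ : ∀ v → deg S v ≡ deg S′ v
  deg-↭ v = ↭-length (filter-↭ (T? ∘ touchesᵇ v) p)
  same : ∀ e → leafᵇ S e ≡ leafᵇ S′ e
  same e = cong₂ (λ k l → (k ℕ.≡ᵇ 1) ∨ (l ℕ.≡ᵇ 1)) (deg-↭ (proj₁ e)) (deg-↭ (proj₂ e))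

subtreeWith-invariant : ∀ {es : List (Edge n)} i j → PermutationInvariant (SubtreeWith es i j)
subtreeWith-invariant i j p (tree , |S| , |L|) = isTreeEdges-cong (↭⇒⊆ p) (↭⇒⊆ (↭-sym p)) tree ,
  trans (sym (↭-length p)) |S| , trans (sym (leafEdges-↭ p)) |L|

T-∧⁺ : ∀ {a b} → T a → T b → T (a ∧ b)
T-∧⁺ ta tb = Equivalence.from Boolₚ.T-∧ (ta , tb)

T-∧⁻ : ∀ {a b} → T (a ∧ b) → T a × T b
T-∧⁻ = Equivalence.to Boolₚ.T-∧

T-does⁺ : {P : Set} (p? : Dec P) → P → T (does p?)
T-does⁺ p? p = subst T (sym (dec-true p? p)) tt

T-does⁻ : {P : Set} (p? : Dec P) → T (does p?) → P
T-does⁻ (yes p) _ = p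

-- Both coefficients as numbers of edge sets

module Counting {n} {vs : List (Fin n)} {es E : List (Edge n)} (G : Growth vs es) (acyclic : ¬ Cycle es)
  (1≤n : 1 ≤ n) (vs↭ : vs ↭ allFin n) (es↭ : es ↭ E) (c : List ℕ → ℚ) (expansion : IsPowerSumExpansion n E c) where

  open Closure G acyclic
  open ClosureLeaves G acyclic
  open SubtreeSums G acyclic

  count-connectors : ∀ a b → CountIs (ConnectorWith es a b) (subs es) (coeffK n c a b)
  count-connectors zero b = countIs-none (subs es) λ { [] _ (A≢[] , _) → A≢[] refl }
  count-connectors (suc a) b = subst (CountIs (ConnectorWith es (suc a) b) (subs es))
    (trans (∑-cong (subs es) λ A → 𝟙-∧ (m ℕ.≡ᵇ length (closure A)) _)
      (sym (trans (sumℚ-map (partitions n) _) (coefficient-K G 1≤n vs↭ es↭ c expansion a m))))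
    (countIs-∑ (λ A → (m ℕ.≡ᵇ length (closure A)) ∧ (suc a ℕ.≡ᵇ length A)) (subs es) λ A A∈ → to A∈ , from A A∈)
    where
    m : ℕ
    m = suc a ℕ.+ b
    to : ∀ {A} → A ∈ subs es → ConnectorWith es (suc a) b A → T ((m ℕ.≡ᵇ length (closure A)) ∧ (suc a ℕ.≡ᵇ length A))
    to A∈ w = let _ , |A| , |C| = connectorWith⇒ A∈ w in T-∧⁺ (ℕₚ.≡⇒≡ᵇ m _ (sym |C|)) (ℕₚ.≡⇒≡ᵇ (suc a) _ (sym |A|))
    from : ∀ A → A ∈ subs es → T ((m ℕ.≡ᵇ length (closure A)) ∧ (suc a ℕ.≡ᵇ length A)) → ConnectorWith es (suc a) b A
    from A A∈ t with T-∧⁻ {m ℕ.≡ᵇ length (closure A)} t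
    from []        A∈ t | _  , ()
    from A@(_ ∷ _) A∈ t | t₁ , t₂ = connectorWith⇐ A∈ (λ ()) (sym (ℕₚ.≡ᵇ⇒≡ (suc a) _ t₂)) (sym (ℕₚ.≡ᵇ⇒≡ m _ t₁))

  subtreeᵇ : ℕ → ℕ → List (Edge n) → Bool
  subtreeᵇ i j S = (does (tree? S) ∧ (i ℕ.≡ᵇ length S)) ∧ (j ℕ.≡ᵇ length (leafEdges S))

  count-in-range : ∀ i j → CountIs (SubtreeWith es i j) (subs es) (sumℚ (map (λ τ → φ n τ i j * c τ) (partitions n)))
  count-in-range i j = subst (CountIs (SubtreeWith es i j) (subs es))
    (trans (∑-cong (subs es) λ S → trans (𝟙-∧ (does (tree? S) ∧ (i ℕ.≡ᵇ length S)) _) (cong (_* δ j (length (leafEdges S))) (𝟙-∧ (does (tree? S)) _)))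
      (sym (trans (sumℚ-map (partitions n) _) (coefficient-S 1≤n vs↭ es↭ c expansion i j))))
    (countIs-∑ (subtreeᵇ i j) (subs es) λ S S∈ → to S∈ , from S∈)
    where
    to : ∀ {S} → S ∈ subs es → SubtreeWith es i j S → T (subtreeᵇ i j S)
    to {S} S∈ (tree , |S| , |L|) = T-∧⁺ (T-∧⁺ (T-does⁺ (tree? S) (tree-is S∈ tree)) (ℕₚ.≡⇒≡ᵇ i _ (sym |S|))) (ℕₚ.≡⇒≡ᵇ j _ (sym |L|))
    from : ∀ {S} → S ∈ subs es → T (subtreeᵇ i j S) → SubtreeWith es i j S
    from {S} S∈ t with T-∧⁻ {does (tree? S) ∧ (i ℕ.≡ᵇ length S)} t
    ... | t₁₂ , t₃ with T-∧⁻ {does (tree? S)} t₁₂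
    ...   | t₁ , t₂ = is-tree S∈ (T-does⁻ (tree? S) t₁) , sym (ℕₚ.≡ᵇ⇒≡ i _ t₂) , sym (ℕₚ.≡ᵇ⇒≡ j _ t₃)

  -- Outside of 1 ≤ j ≤ i < n the value of `coeffS` is 0, so no subtree may have such parameters: a
  -- subtree has a leaf edge, its leaf edges are among its edges, and these are among the n - 1
  -- edges of the tree.
  subtree-range : ∀ {i j S} → S ∈ subs es → SubtreeWith es i j S → T ((1 ℕ.≤ᵇ j) ∧ (j ℕ.≤ᵇ i) ∧ (i ℕ.<ᵇ n))
  subtree-range {S = S} S∈ (tree , refl , refl) = T-∧⁺ {1 ℕ.≤ᵇ length (leafEdges S)} (ℕₚ.≤⇒≤ᵇ (positive (leafEdges S) (tree-has-leaf S∈ tree)))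
    (T-∧⁺ {length (leafEdges S) ℕ.≤ᵇ length S} (ℕₚ.≤⇒≤ᵇ (Listₚ.length-filter (T? ∘ leafᵇ S) S))
      (ℕₚ.<⇒<ᵇ (subst (length S ℕ.<_) size (s≤s (∈subs⇒length≤ es S∈)))))
    where
    positive : (L : List (Edge n)) → L ≢ [] → 1 ≤ length L
    positive []      L≢[] = ⊥-elim (L≢[] refl)
    positive (_ ∷ _) _    = s≤s z≤n
    size : suc (length es) ≡ n
    size = trans (sym (growth-length G)) (trans (↭-length vs↭) (Listₚ.length-tabulate id))

  count-subtrees : ∀ i j → CountIs (SubtreeWith es i j) (subs es) (coeffS n c i j)
  count-subtrees i j = countIs-if (subs es) ((1 ℕ.≤ᵇ j) ∧ (j ℕ.≤ᵇ i) ∧ (i ℕ.<ᵇ n)) (count-in-range i j) λ S S∈ → subtree-range S∈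

theorem1 : (n : ℕ) → 1 ≤ n → (E : List (Edge n)) → IsTree n E →
    (c : List ℕ → ℚ) → IsPowerSumExpansion n E c →
    (∀ a b → CountIs (ConnectorWith E a b) (subs E) (coeffK n c a b)) ×
    (∀ i j → CountIs (SubtreeWith E i j) (subs E) (coeffS n c i j))
theorem1 n 1≤n E tree c expansion = conclude (tree⇒growth 1≤n tree)
  where
  conclude : (∃ λ vs → ∃ λ es → Growth vs es × vs ↭ allFin n × es ↭ E) →
    (∀ a b → CountIs (ConnectorWith E a b) (subs E) (coeffK n c a b)) ×
    (∀ i j → CountIs (SubtreeWith E i j) (subs E) (coeffS n c i j))
  conclude (vs , es , G , vs↭ , es↭) =
    (λ a b → countIs-map (count-cong (λ A _ → connectorWith-edges es↭ , connectorWith-edges (↭-sym es↭)) ∘ count-subs-↭ es↭ (connectorWith-invariant a b)) (count-connectors a b)) ,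
    (λ i j → countIs-map (count-subs-↭ es↭ (subtreeWith-invariant {es = E} i j)) (count-subtrees i j))
    where
    open Counting G (proj₂ (proj₂ tree) ∘ cycle-mono (↭⇒⊆ es↭)) 1≤n vs↭ es↭ c expansion
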